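{- Let $p$ be a prime, $q=p^l$, $n\ge 2$ and $k\ge 1$ integers with $p\nmid k$. For $m\in\mathbb N$ let $d_m=\gcd(k,q^m-1)$ and $d=d_1$. If \[q\ge \max\left\{\sqrt{(d-1)^6+6d},\ (d_2-1)^2+1,\ \lfloor (d_3-1)^{4/3}\rfloor+1\right\},\] then every matrix in $M_n(\mathbb F_q)$ is of the form $A^k+B^k$ with $A,B\in M_n(\mathbb F_q)$. -}

module Defs where

open import Level using (Level; _⊔_; suc)
open import Data.Nat using (ℕ; zero; suc)
open import Data.Fin using (Fin; _≟_)
open import Data.Vec.Functional using (foldr)
open import Relation.Binary.PropositionalEquality using (_≡_)
open import Relation.Nullary using (¬_; Dec; yes; no)
open import Data.Product using (Σ; ∃; ∃-syntax; _×_)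
open import Algebra.Bundles using (CommutativeRing)

record FiniteField (c ℓ : Level) (q : ℕ) : Set (Level.suc (c ⊔ ℓ)) where
  field
    commRing : CommutativeRing c ℓ
  open CommutativeRing commRing public
  field
    0≉1     : ¬ (0# ≈ 1#)
    inverse : ∀ x → ¬ (x ≈ 0#) → ∃[ y ] (x * y ≈ 1#)
    toFin       : Carrier → Fin q
    fromFin     : Fin q → Carrier
    toFin-cong  : ∀ {x y} → x ≈ y → toFin x ≡ toFin y
    from∘to     : ∀ x → fromFin (toFin x) ≈ x
    to∘from     : ∀ i → toFin (fromFin i) ≡ i

module Matrices {c ℓ q} (F : FiniteField c ℓ q) where
  open FiniteField F

  Mat : ℕ → Set c
  Mat n = Fin n → Fin n → Carrier

  _≈ₘ_ : ∀ {n} → Mat n → Mat n → Set ℓ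
  A ≈ₘ B = ∀ i j → A i j ≈ B i j

  _+ₘ_ : ∀ {n} → Mat n → Mat n → Mat n
  (A +ₘ B) i j = A i j + B i j

  _*ₘ_ : ∀ {n} → Mat n → Mat n → Mat n
  (A *ₘ B) i j = foldr _+_ 0# (λ t → A i t * B t j)

  identity : ∀ {n} → Mat n
  identity i j with i ≟ j
  ... | yes _ = 1#
  ... | no  _ = 0#

  _^ₘ_ : ∀ {n} → Mat n → ℕ → Mat n
  A ^ₘ zero  = identity
  A ^ₘ suc k = A *ₘ (A ^ₘ k)

{-# OPTIONS --safe #-}
module Submission where

-- For z in a field with Q elements let χ(z) = #{y : yᵏ = z} - 1. The map z ↦ χ(z) has sum 0, is invariant
-- under multiplication by non-zero k-th powers, and ∑ χ² = (Q - 1) m with m = #{y : yᵏ = 1} - 1 < gcd(k , Q - 1).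
-- A second moment over all lines y = s x + t, together with Cauchy–Schwarz, gives
-- (∑ χ(x) f(t) b(x + t))² ≤ m² Q ∑ f² ∑ b², an elementary substitute for the Weil bound on diagonal equations.
-- If a is not a sum of two (three) k-th powers then (χ ∗ χ)(a) = - Q (resp. (χ ∗ χ ∗ χ)(a) = - Q²), and
-- the inequality forces Q ≤ m⁴ (resp. Q ≤ m³).
--
-- A non-scalar matrix is conjugate to one with any prescribed diagonal of the right trace. Choosing the
-- diagonal entries as sums aᵢ + bᵢ of k-th powers (three powers suffice to hit the trace), the matrix is the sum of
-- a lower triangular matrix with diagonal a and an upper triangular one with diagonal b. As p ∤ k,
-- such matrices are k-th powers if at most one diagonal entry vanishes.
-- A scalar matrix is cut into blocks of sizes 2 and 3, on which a scalar is a sum of two k-th powers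
-- in F[x]/(x² - x - c), resp. F[x]/(x³ - x - c), acting by multiplication. A value c making the polynomial rootless
-- exists because x² - x and x³ - x take the same value at 0 and 1, so they are not surjective on F.

open import Defs
open import Level using (Level; 0ℓ)
open import Algebra.Bundles using (CommutativeRing; RawRing)
open import Algebra.Structures using (IsCommutativeRing)

-- Two obstacles shape the proof. A scalar matrix is fixed by every conjugation, so its diagonal
-- cannot be adjusted, and splitting it entry by entry would need two k-th powers to suffice in F
-- itself, for which `(d - 1)⁴ < q` would be required. The second and third hypotheses supply the
-- analogous inequality for the fields with q² and q³ elements instead. For all other matrices only
-- the trace has to be matched, and there `(d - 1)³ < q` is enough, which follows from the first
-- hypothesis. Four powers are available, two on each side. One of them, non-zero and otherwise
-- free, keeps the remainder away from 0, the value that the three-power statement excludes. This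
-- choice needs two different non-zero k-th powers; the first hypothesis, with its term `6 d`,
-- guarantees them. The estimate stays in ℤ because `χ` cannot distinguish a slope that is a
-- non-zero k-th power from slope 1: one line may be replaced by a weighted sum over all lines, and
-- their second moment is computed exactly since `∑ χ = 0`.

module IntegerCoefficients {c ℓ} (R : CommutativeRing c ℓ) where

  open CommutativeRing R
  open import Algebra.Solver.Ring.AlmostCommutativeRing using (fromCommutativeRing; _-Raw-AlmostCommutative⟶_)
  open import Algebra.Properties.Semiring.Mult.TCOptimised semiring using (_×_; ×-homo-+; ×1-homo-*; 1+×)
  open import Algebra.Properties.Ring ring using (-‿distribˡ-*; -‿distribʳ-*; -0#≈0#; -‿involutive; -‿+-comm)
  open import Relation.Binary.Reasoning.Setoid setoid
  open import Data.Nat as ℕ using (ℕ; zero; suc)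
  open import Data.Integer as ℤ using (ℤ; +_; -[1+_]; _⊖_)
  open import Data.Integer.Properties as ℤ using ([1+m]⊖[1+n]≡m⊖n; -◃n≡-n; +◃n≡+n)
  import Data.Sign as Sign
  open import Data.Maybe using (Maybe; just; nothing)
  open import Relation.Nullary using (yes; no)
  open import Relation.Binary.PropositionalEquality as ≡ using (_≡_)

  -- The solver takes its coefficients in ℤ and not in the ring: cancelling terms requires a
  -- decision whether coefficients agree, and integers provide one over every commutative ring.
  ⟦_⟧ᶻ : ℤ → Carrier
  ⟦ + n ⟧ᶻ = n × 1#
  ⟦ -[1+ n ] ⟧ᶻ = - (suc n × 1#)

  -‿homo : ∀ i → ⟦ ℤ.- i ⟧ᶻ ≈ - ⟦ i ⟧ᶻ
  -‿homo (+ zero) = sym -0#≈0#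
  -‿homo (+ suc n) = refl
  -‿homo -[1+ n ] = sym (-‿involutive _)

  ⊖-homo : ∀ m n → ⟦ m ⊖ n ⟧ᶻ ≈ m × 1# - n × 1#
  ⊖-homo m zero = sym (trans (+-congˡ -0#≈0#) (+-identityʳ _))
  ⊖-homo zero (suc n) = sym (+-identityˡ _)
  ⊖-homo (suc m) (suc n) = begin
    ⟦ suc m ⊖ suc n ⟧ᶻ ≡⟨ ≡.cong ⟦_⟧ᶻ ([1+m]⊖[1+n]≡m⊖n m n) ⟩
    ⟦ m ⊖ n ⟧ᶻ ≈⟨ ⊖-homo m n ⟩
    m × 1# - n × 1# ≈⟨ +-congʳ (+-identityˡ _) ⟨
    (0# + m × 1#) - n × 1# ≈⟨ +-congʳ (+-congʳ (-‿inverseʳ 1#)) ⟨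
    (1# - 1# + m × 1#) - n × 1# ≈⟨ +-congʳ (+-assoc _ _ _) ⟩
    (1# + (- 1# + m × 1#)) - n × 1# ≈⟨ +-congʳ (+-congˡ (+-comm _ _)) ⟩
    (1# + (m × 1# - 1#)) - n × 1# ≈⟨ +-congʳ (+-assoc _ _ _) ⟨
    ((1# + m × 1#) - 1#) - n × 1# ≈⟨ +-assoc _ _ _ ⟩
    (1# + m × 1#) + (- 1# - n × 1#) ≈⟨ +-congˡ (-‿+-comm _ _) ⟩
    (1# + m × 1#) - (1# + n × 1#) ≈⟨ +-cong (1+× m 1#) (-‿cong (1+× n 1#)) ⟨
    suc m × 1# - suc n × 1# ∎

  +-homo : ∀ i j → ⟦ i ℤ.+ j ⟧ᶻ ≈ ⟦ i ⟧ᶻ + ⟦ j ⟧ᶻ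
  +-homo (+ m) (+ n) = ×-homo-+ 1# m n
  +-homo (+ m) -[1+ n ] = ⊖-homo m (suc n)
  +-homo -[1+ m ] (+ n) = trans (⊖-homo n (suc m)) (+-comm _ _)
  +-homo -[1+ m ] -[1+ n ] = begin
    - (suc (suc (m ℕ.+ n)) × 1#) ≡⟨ ≡.cong (λ k → - (suc k × 1#)) (≡.sym (ℕ.+-suc m n)) ⟩
    - ((suc m ℕ.+ suc n) × 1#) ≈⟨ -‿cong (×-homo-+ 1# (suc m) (suc n)) ⟩
    - (suc m × 1# + suc n × 1#) ≈⟨ -‿+-comm _ _ ⟨
    - (suc m × 1#) - suc n × 1# ∎
    where import Data.Nat.Properties as ℕ

  -◃-homo : ∀ n → ⟦ Sign.- ℤ.◃ n ⟧ᶻ ≈ - (n × 1#)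
  -◃-homo n = trans (reflexive (≡.cong ⟦_⟧ᶻ (-◃n≡-n n))) (-‿homo (+ n))

  *-homo : ∀ i j → ⟦ i ℤ.* j ⟧ᶻ ≈ ⟦ i ⟧ᶻ * ⟦ j ⟧ᶻ
  *-homo (+ m) (+ n) = trans (reflexive (≡.cong ⟦_⟧ᶻ (+◃n≡+n (m ℕ.* n)))) (×1-homo-* m n)
  *-homo (+ m) -[1+ n ] = trans (-◃-homo (m ℕ.* suc n)) (trans (-‿cong (×1-homo-* m (suc n))) (-‿distribʳ-* _ _))
  *-homo -[1+ m ] (+ n) = trans (-◃-homo (suc m ℕ.* n)) (trans (-‿cong (×1-homo-* (suc m) n)) (-‿distribˡ-* _ _))
  *-homo -[1+ m ] -[1+ n ] = begin
    (suc m ℕ.* suc n) × 1# ≈⟨ ×1-homo-* (suc m) (suc n) ⟩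
    (suc m × 1#) * (suc n × 1#) ≈⟨ -‿involutive _ ⟨
    - - ((suc m × 1#) * (suc n × 1#)) ≈⟨ -‿cong (-‿distribˡ-* _ _) ⟩
    - (- (suc m × 1#) * (suc n × 1#)) ≈⟨ -‿distribʳ-* _ _ ⟩
    - (suc m × 1#) * - (suc n × 1#) ∎

  ℤ⟶R : CommutativeRing.rawRing ℤ.+-*-commutativeRing -Raw-AlmostCommutative⟶ fromCommutativeRing R
  ℤ⟶R = record
    { ⟦_⟧ = ⟦_⟧ᶻ ; +-homo = +-homo ; *-homo = *-homo ; -‿homo = -‿homo ; 0-homo = refl ; 1-homo = refl }

  _≟ᶻ_ : ∀ i j → Maybe (⟦ i ⟧ᶻ ≈ ⟦ j ⟧ᶻ)
  i ≟ᶻ j with i ℤ.≟ j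
  ... | yes i≡j = just (reflexive (≡.cong ⟦_⟧ᶻ i≡j))
  ... | no _ = nothing

  open import Algebra.Solver.Ring _ _ ℤ⟶R _≟ᶻ_ public

open import Algebra.Morphism.Structures using (IsRingMonomorphism)
import Algebra.Morphism.RingMonomorphism as RingMonomorphism
open import Data.Nat as ℕ using (ℕ; zero; suc; _∸_; z≤n; s≤s)
open import Data.Nat.Properties as ℕ using ()
open import Data.Nat.GCD using (gcd; gcd[m,n]≤n; gcd[m,n]≢0; gcd-GCD; module Bézout)
open import Data.Nat.Divisibility using (_∣_)
open import Data.Nat.Primality using (Prime; prime⇒irreducible)
open import Data.Nat.Coprimality using (Coprime; coprime-Bézout)
open import Data.Nat.Tactic.RingSolver as ℕ-Solver using ()
open import Data.Integer as ℤ using (ℤ; +_; -[1+_]; 0ℤ; 1ℤ; ∣_∣)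
open import Data.Integer.Properties as ℤ using ()
open import Data.Integer.Tactic.RingSolver using (solve-∀)
open import Data.Fin as Fin using (Fin; zero; suc; _≟_; toℕ; opposite; combine; remQuot; splitAt; _↑ˡ_; _↑ʳ_; join)
open import Data.Fin.Properties using (any?; all?; toℕ<n; toℕ-injective; suc-injective; <-cmp; pigeonhole; opposite-prop; opposite-involutive; remQuot-combine; combine-remQuot; splitAt-↑ˡ; splitAt-↑ʳ; join-splitAt)
open import Data.Fin.Permutation using (permutation)
open import Data.List using (List; []; _∷_; _++_; map)
open import Data.Vec as Vec using (Vec; []; _∷_)
open import Data.Vec.Functional using (foldr)
open import Data.Product using (∃; ∃-syntax; Σ; _×_; _,_; proj₁; proj₂)
open import Data.Sum as Sum using (_⊎_; inj₁; inj₂)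
open import Data.Unit using (⊤; tt)
open import Data.Empty using (⊥; ⊥-elim)
open import Function using (_∘_; id)
open import Relation.Nullary using (¬_; yes; no; ¬?)
open import Relation.Nullary.Decidable using (_×-dec_; decidable-stable)
open import Relation.Binary using (tri<; tri≈; tri>)
open import Relation.Binary.PropositionalEquality as ≡ using (_≡_; _≢_; refl; sym; trans; cong; cong₂; subst; subst₂; module ≡-Reasoning)

-- Finite sums of integers and the Cauchy-Schwarz inequality.

module IntegerSums where

  open import Data.Integer using (_+_; _*_; -_; _-_; _≤_)
  open import Data.Integer.Properties using (+-mono-≤; ≤-refl; ≤-trans; *-comm; +-identityˡ; +-identityʳ; *-zeroˡ; *-identityˡ; ≤-reflexive; module ≤-Reasoning)
  open import Algebra.Properties.Semiring.Sum ℤ.+-*-semiring public using () renaming (sum to ∑; sum-cong-≗ to ∑-cong; ∑-distrib-+ to ∑-+; ∑-comm to ∑-swap; *-distribˡ-sum to *-∑; sum-permute to ∑-permute)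

  -- Kronecker symbol by recursion on both indices, in step with the recursion of `∑`, so that `∑-δ`
  -- is a plain induction.
  δ : ∀ {n} → Fin n → Fin n → ℤ
  δ zero zero = 1ℤ
  δ zero (suc _) = 0ℤ
  δ (suc _) zero = 0ℤ
  δ (suc i) (suc j) = δ i j

  δ-refl : ∀ {n} (i : Fin n) → δ i i ≡ 1ℤ
  δ-refl zero = refl
  δ-refl (suc i) = δ-refl i

  δ-≢ : ∀ {n} {i j : Fin n} → i ≢ j → δ i j ≡ 0ℤ
  δ-≢ {i = zero} {zero} i≢j = ⊥-elim (i≢j refl)
  δ-≢ {i = zero} {suc j} i≢j = refl
  δ-≢ {i = suc i} {zero} i≢j = refl
  δ-≢ {i = suc i} {suc j} i≢j = δ-≢ (λ i≡j → i≢j (cong suc i≡j))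

  δ-injective : ∀ {m n} (f : Fin m → Fin n) → (∀ {i j} → f i ≡ f j → i ≡ j) → ∀ i j → δ (f i) (f j) ≡ δ i j
  δ-injective f inj i j with i ≟ j
  ... | yes refl = trans (δ-refl (f i)) (sym (δ-refl i))
  ... | no i≢j = trans (δ-≢ (λ eq → i≢j (inj eq))) (sym (δ-≢ i≢j))

  δ-nonNeg : ∀ {n} (i j : Fin n) → 0ℤ ℤ.≤ δ i j
  δ-nonNeg zero zero = ℤ.+≤+ ℕ.z≤n
  δ-nonNeg zero (suc j) = ≤-refl
  δ-nonNeg (suc i) zero = ≤-refl
  δ-nonNeg (suc i) (suc j) = δ-nonNeg i j

  ∑-zero : ∀ {n} (f : Fin n → ℤ) → (∀ i → f i ≡ 0ℤ) → ∑ f ≡ 0ℤ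
  ∑-zero {zero} f f≡0 = refl
  ∑-zero {suc n} f f≡0 = cong₂ _+_ (f≡0 zero) (∑-zero (λ i → f (suc i)) (λ i → f≡0 (suc i)))

  ∑-const : ∀ n (c : ℤ) → ∑ {n} (λ _ → c) ≡ + n * c
  ∑-const zero c = sym (*-zeroˡ c)
  ∑-const (suc n) c = trans (cong (_+_ c) (∑-const n c)) (lem c (+ n))
    where
    lem : ∀ c n → c + n * c ≡ (1ℤ + n) * c
    lem = solve-∀

  ∑-δ : ∀ {n} (f : Fin n → ℤ) (j : Fin n) → ∑ (λ i → δ i j * f i) ≡ f j
  ∑-δ {suc n} f zero = trans (cong₂ _+_ (*-identityˡ (f zero)) (∑-zero _ (λ i → *-zeroˡ (f (suc i))))) (+-identityʳ (f zero))
  ∑-δ {suc n} f (suc j) = trans (cong₂ _+_ (*-zeroˡ (f zero)) (∑-δ (λ i → f (suc i)) j)) (+-identityˡ _)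

  ∑-neg : ∀ {n} (f : Fin n → ℤ) → ∑ (λ i → - f i) ≡ - ∑ f
  ∑-neg {zero} f = refl
  ∑-neg {suc n} f = trans (cong (_+_ (- f zero)) (∑-neg (λ i → f (suc i)))) (lem (f zero) _)
    where
    lem : ∀ a b → - a + - b ≡ - (a + b)
    lem = solve-∀

  ∑-- : ∀ {n} (f g : Fin n → ℤ) → ∑ (λ i → f i - g i) ≡ ∑ f - ∑ g
  ∑-- f g = trans (∑-+ f (λ i → - g i)) (cong (_+_ (∑ f)) (∑-neg g))

  ∑-* : ∀ {n} (f : Fin n → ℤ) c → ∑ (λ i → f i * c) ≡ ∑ f * c
  ∑-* f c = trans (∑-cong (λ i → *-comm (f i) c)) (trans (sym (*-∑ c f)) (*-comm c (∑ f)))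

  ∑-reindex : ∀ {n} (f : Fin n → ℤ) (g h : Fin n → Fin n) → (∀ i → g (h i) ≡ i) → (∀ i → h (g i) ≡ i) → ∑ (λ i → f (g i)) ≡ ∑ f
  ∑-reindex f g h gh hg = sym (∑-permute f (permutation g h gh hg))

  ∑-mono : ∀ {n} (f g : Fin n → ℤ) → (∀ i → f i ≤ g i) → ∑ f ≤ ∑ g
  ∑-mono {zero} f g f≤g = ≤-refl
  ∑-mono {suc n} f g f≤g = +-mono-≤ (f≤g zero) (∑-mono _ _ (λ i → f≤g (suc i)))

  ∑-nonNeg : ∀ {n} (f : Fin n → ℤ) → (∀ i → 0ℤ ≤ f i) → 0ℤ ≤ ∑ f
  ∑-nonNeg {n} f 0≤f = ≤-trans (≤-reflexive (sym (∑-zero {n} (λ _ → 0ℤ) (λ _ → refl)))) (∑-mono _ f 0≤f)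

  sq-nonNeg : ∀ x → 0ℤ ≤ x * x
  sq-nonNeg (+ zero) = ≤-refl
  sq-nonNeg (+ suc n) = ℤ.+≤+ z≤n
  sq-nonNeg -[1+ n ] = ℤ.+≤+ z≤n

  ∑-quadratic : ∀ {n} (f g : Fin n → ℤ) x y → ∑ (λ i → (f i * y - g i * x) * (f i * y - g i * x)) ≡ ∑ (λ i → f i * f i) * (y * y) - (+ 2) * (∑ (λ i → f i * g i) * (x * y)) + ∑ (λ i → g i * g i) * (x * x)
  ∑-quadratic {zero} f g x y = lem x y
    where
    lem : ∀ x y → 0ℤ ≡ 0ℤ * (y * y) - (+ 2) * (0ℤ * (x * y)) + 0ℤ * (x * x)
    lem = solve-∀
  ∑-quadratic {suc n} f g x y = trans (cong (_+_ ((f zero * y - g zero * x) * (f zero * y - g zero * x))) (∑-quadratic (λ i → f (suc i)) (λ i → g (suc i)) x y)) (lem (f zero) (g zero) x y (∑ (λ i → f (suc i) * f (suc i))) (∑ (λ i → f (suc i) * g (suc i))) (∑ (λ i → g (suc i) * g (suc i))))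
    where
    lem : ∀ a b x y A B C → (a * y - b * x) * (a * y - b * x) + (A * (y * y) - (+ 2) * (B * (x * y)) + C * (x * x)) ≡ (a * a + A) * (y * y) - (+ 2) * ((a * b + B) * (x * y)) + (b * b + C) * (x * x)
    lem = solve-∀

  -- Induction without any division: when terms `x`, `y` are added, the difference of the two sides
  -- grows by exactly `∑ (f′ y - g′ x)²`, which `∑-quadratic` expands.
  cauchy-schwarz : ∀ {n} (f g : Fin n → ℤ) → ∑ (λ i → f i * g i) * ∑ (λ i → f i * g i) ≤ ∑ (λ i → f i * f i) * ∑ (λ i → g i * g i)
  cauchy-schwarz {zero} f g = ≤-refl
  cauchy-schwarz {suc n} f g = begin
    (x * y + B) * (x * y + B)  ≡⟨ lem₁ x y B ⟩
    (x * y) * (x * y) + (+ 2) * (B * (x * y)) + (B * B + 0ℤ) ≤⟨ +-mono-≤ (≤-refl {(x * y) * (x * y) + (+ 2) * (B * (x * y))}) (+-mono-≤ (cauchy-schwarz f′ g′) (∑-nonNeg _ (λ i → sq-nonNeg (f′ i * y - g′ i * x)))) ⟩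
    (x * y) * (x * y) + (+ 2) * (B * (x * y)) + (A * C + ∑ (λ i → (f′ i * y - g′ i * x) * (f′ i * y - g′ i * x))) ≡⟨ cong (λ z → (x * y) * (x * y) + (+ 2) * (B * (x * y)) + (A * C + z)) (∑-quadratic f′ g′ x y) ⟩
    (x * y) * (x * y) + (+ 2) * (B * (x * y)) + (A * C + (A * (y * y) - (+ 2) * (B * (x * y)) + C * (x * x))) ≡⟨ lem₂ x y A B C ⟩
    (x * x + A) * (y * y + C) ∎
    where
    open ≤-Reasoning
    f′ = λ i → f (suc i)
    g′ = λ i → g (suc i)
    x = f zero
    y = g zero
    A = ∑ (λ i → f′ i * f′ i)
    B = ∑ (λ i → f′ i * g′ i)
    C = ∑ (λ i → g′ i * g′ i)
    lem₁ : ∀ x y B → (x * y + B) * (x * y + B) ≡ (x * y) * (x * y) + (+ 2) * (B * (x * y)) + (B * B + 0ℤ)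
    lem₁ = solve-∀
    lem₂ : ∀ x y A B C → (x * y) * (x * y) + (+ 2) * (B * (x * y)) + (A * C + (A * (y * y) - (+ 2) * (B * (x * y)) + C * (x * x))) ≡ (x * x + A) * (y * y + C)
    lem₂ = solve-∀

  abs-mono : ∀ {i j} → 0ℤ ≤ i → i ≤ j → ∣ i ∣ ℕ.≤ ∣ j ∣
  abs-mono {+ _} {+ _} _ (ℤ.+≤+ le) = le

  *-mono : ∀ {a b c} → 0ℤ ≤ a → b ≤ c → a * b ≤ a * c
  *-mono {a} 0≤a b≤c = ℤ.*-monoˡ-≤-nonNeg a ⦃ ℤ.nonNegative 0≤a ⦄ b≤c

open IntegerSums

-- Carried by Fin q with propositional equality, so that sums over the field are sums over Fin q.
record Field (q : ℕ) : Set where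
  infixl 6 _⊕_
  infixl 7 _⊗_
  infix 8 ⊖_
  field
    _⊕_ _⊗_ : Fin q → Fin q → Fin q
    ⊖_ : Fin q → Fin q
    0# 1# : Fin q
    isCommutativeRing : IsCommutativeRing _≡_ _⊕_ _⊗_ ⊖_ 0# 1#
    0≢1 : 0# ≢ 1#
    inverse : ∀ x → x ≢ 0# → ∃ λ y → x ⊗ y ≡ 1#

  commutativeRing : CommutativeRing 0ℓ 0ℓ
  commutativeRing = record { isCommutativeRing = isCommutativeRing }

  infixr 9 _^_
  _^_ : Fin q → ℕ → Fin q
  x ^ zero = 1#
  x ^ suc n = x ⊗ (x ^ n)

-- Finite fields: Fermat's theorem, roots of polynomials, roots of unity.

module FieldProperties {q} (F : Field q) where

  open Field F
  open IsCommutativeRing isCommutativeRing public using (+-assoc; +-comm; +-identityˡ; +-identityʳ; -‿inverseˡ; -‿inverseʳ; *-assoc; *-comm; *-identityˡ; *-identityʳ; zeroˡ; zeroʳ; distribˡ; distribʳ)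
  open CommutativeRing commutativeRing using (semiring; *-commutativeMonoid)
  open IntegerCoefficients commutativeRing public using (solve; _:=_; _:+_; _:*_; :-_; con)
  open import Algebra.Properties.Semiring.Sum semiring public using () renaming (sum to Σ#; sum-cong-≗ to Σ#-cong; ∑-distrib-+ to Σ#-⊕; ∑-comm to Σ#-swap; *-distribˡ-sum to ⊗-Σ#; *-distribʳ-sum to Σ#-⊗; sum-permute to Σ#-permute)
  open import Algebra.Properties.CommutativeMonoid.Sum *-commutativeMonoid using () renaming (sum to ∏; sum-cong-≗ to ∏-cong; ∑-distrib-+ to ∏-distrib; sum-permute to ∏-permute)
  open import Algebra.Properties.Semiring.Mult semiring public using () renaming (_×_ to _·_; ×1-homo-* to ·1-homo-⊗)
  open ≡-Reasoning

  inv : Fin q → Fin q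
  inv x with x ≟ 0#
  ... | yes _ = 0#
  ... | no x≢0 = proj₁ (inverse x x≢0)

  inv-inverseʳ : ∀ {x} → x ≢ 0# → x ⊗ inv x ≡ 1#
  inv-inverseʳ {x} x≢0 with x ≟ 0#
  ... | yes x≡0 = ⊥-elim (x≢0 x≡0)
  ... | no x≢0 = proj₂ (inverse x x≢0)

  inv-inverseˡ : ∀ {x} → x ≢ 0# → inv x ⊗ x ≡ 1#
  inv-inverseˡ {x} x≢0 = trans (*-comm (inv x) x) (inv-inverseʳ x≢0)

  inv-cancelˡ : ∀ {x} → x ≢ 0# → ∀ z → inv x ⊗ (x ⊗ z) ≡ z
  inv-cancelˡ {x} x≢0 z = trans (sym (*-assoc (inv x) x z)) (trans (cong (_⊗ z) (inv-inverseˡ x≢0)) (*-identityˡ z))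

  inv-cancelʳ : ∀ {x} → x ≢ 0# → ∀ z → x ⊗ (inv x ⊗ z) ≡ z
  inv-cancelʳ {x} x≢0 z = trans (sym (*-assoc x (inv x) z)) (trans (cong (_⊗ z) (inv-inverseʳ x≢0)) (*-identityˡ z))

  ⊗-cancelˡ : ∀ {x y z} → x ≢ 0# → x ⊗ y ≡ x ⊗ z → y ≡ z
  ⊗-cancelˡ {x} {y} {z} x≢0 xy≡xz = trans (sym (inv-cancelˡ x≢0 y)) (trans (cong (inv x ⊗_) xy≡xz) (inv-cancelˡ x≢0 z))

  ⊗-nonZero : ∀ {x y} → x ≢ 0# → y ≢ 0# → x ⊗ y ≢ 0#
  ⊗-nonZero {x} x≢0 y≢0 xy≡0 = y≢0 (⊗-cancelˡ x≢0 (trans xy≡0 (sym (zeroʳ x))))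

  inv-nonZero : ∀ {x} → x ≢ 0# → inv x ≢ 0#
  inv-nonZero {x} x≢0 eq = 0≢1 (trans (sym (zeroʳ x)) (trans (cong (x ⊗_) (sym eq)) (inv-inverseʳ x≢0)))

  ⊕-cancelʳ : ∀ x y → (x ⊕ y) ⊕ ⊖ y ≡ x
  ⊕-cancelʳ = solve 2 (λ x y → (x :+ y) :+ :- y := x) refl

  ⊖-cancelʳ : ∀ x y → (x ⊕ ⊖ y) ⊕ y ≡ x
  ⊖-cancelʳ = solve 2 (λ x y → (x :+ :- y) :+ y := x) refl

  x⊖y≡0⇒x≡y : ∀ {x y} → x ⊕ ⊖ y ≡ 0# → x ≡ y
  x⊖y≡0⇒x≡y {x} {y} eq = trans (sym (⊖-cancelʳ x y)) (trans (cong (_⊕ y) eq) (+-identityˡ y))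

  ^-+ : ∀ x m n → x ^ (m ℕ.+ n) ≡ x ^ m ⊗ x ^ n
  ^-+ x zero n = sym (*-identityˡ _)
  ^-+ x (suc m) n = trans (cong (x ⊗_) (^-+ x m n)) (sym (*-assoc x _ _))

  1^ : ∀ n → 1# ^ n ≡ 1#
  1^ zero = refl
  1^ (suc n) = trans (*-identityˡ _) (1^ n)

  ^-* : ∀ x m n → x ^ (m ℕ.* n) ≡ (x ^ n) ^ m
  ^-* x zero n = refl
  ^-* x (suc m) n = trans (^-+ x n (m ℕ.* n)) (cong (x ^ n ⊗_) (^-* x m n))

  ^-⊗ : ∀ x y n → (x ⊗ y) ^ n ≡ x ^ n ⊗ y ^ n
  ^-⊗ x y zero = sym (*-identityˡ 1#)
  ^-⊗ x y (suc n) = trans (cong (x ⊗ y ⊗_) (^-⊗ x y n)) (lem x y (x ^ n) (y ^ n))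
    where
    lem : ∀ x y a b → x ⊗ y ⊗ (a ⊗ b) ≡ x ⊗ a ⊗ (y ⊗ b)
    lem = solve 4 (λ x y a b → x :* y :* (a :* b) := x :* a :* (y :* b)) refl

  ^-nonZero : ∀ {x} → x ≢ 0# → ∀ n → x ^ n ≢ 0#
  ^-nonZero x≢0 zero = λ eq → 0≢1 (sym eq)
  ^-nonZero x≢0 (suc n) = ⊗-nonZero x≢0 (^-nonZero x≢0 n)

  0^ : ∀ {n} → 1 ℕ.≤ n → 0# ^ n ≡ 0#
  0^ {suc n} _ = zeroˡ _

  Σ#-zero : ∀ {n} (f : Fin n → Fin q) → (∀ i → f i ≡ 0#) → Σ# f ≡ 0#
  Σ#-zero {zero} f f≡0 = refl
  Σ#-zero {suc n} f f≡0 = trans (cong₂ _⊕_ (f≡0 zero) (Σ#-zero _ (λ i → f≡0 (suc i)))) (+-identityˡ 0#)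

  private
    -- With `j = 0#` this is the factor by which `unit` changes under multiplication by `x`: the
    -- factor is `x` at every non-zero element, whereas at `0#` nothing changes.
    except : ∀ {n} → Fin q → Fin n → Fin n → Fin q
    except x zero zero = 1#
    except x zero (suc i) = x
    except x (suc j) zero = x
    except x (suc j) (suc i) = except x j i

    except-≡ : ∀ {n} x (j : Fin n) → except x j j ≡ 1#
    except-≡ x zero = refl
    except-≡ x (suc j) = except-≡ x j

    except-≢ : ∀ {n} x {j i : Fin n} → i ≢ j → except x j i ≡ x
    except-≢ x {zero} {zero} i≢j = ⊥-elim (i≢j refl)
    except-≢ x {zero} {suc i} i≢j = refl
    except-≢ x {suc j} {zero} i≢j = refl
    except-≢ x {suc j} {suc i} i≢j = except-≢ x (λ eq → i≢j (cong suc eq))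

    ∏-const : ∀ n x → ∏ {n} (λ _ → x) ≡ x ^ n
    ∏-const zero x = refl
    ∏-const (suc n) x = cong (x ⊗_) (∏-const n x)

    ∏-except : ∀ {n} x (j : Fin n) → x ⊗ ∏ (except x j) ≡ x ^ n
    ∏-except {suc n} x zero = cong (x ⊗_) (trans (*-identityˡ _) (∏-const n x))
    ∏-except {suc n} x (suc j) = cong (x ⊗_) (∏-except x j)

    ∏-nonZero : ∀ {n} (f : Fin n → Fin q) → (∀ i → f i ≢ 0#) → ∏ f ≢ 0#
    ∏-nonZero {zero} f f≢0 eq = 0≢1 (sym eq)
    ∏-nonZero {suc n} f f≢0 = ⊗-nonZero (f≢0 zero) (∏-nonZero _ (λ i → f≢0 (suc i)))

    -- Replacing 0 by 1 makes the product over all of `Fin q` the product of the non-zero elements,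
    -- with no need to enumerate these.
    unit : Fin q → Fin q
    unit y with y ≟ 0#
    ... | yes _ = 1#
    ... | no _ = y

    unit-nonZero : ∀ y → unit y ≢ 0#
    unit-nonZero y with y ≟ 0#
    ... | yes _ = λ eq → 0≢1 (sym eq)
    ... | no y≢0 = y≢0

    unit-⊗ : ∀ {x} → x ≢ 0# → ∀ y → unit (x ⊗ y) ≡ except x 0# y ⊗ unit y
    unit-⊗ {x} x≢0 y with y ≟ 0# | (x ⊗ y) ≟ 0#
    ... | yes refl | yes _ = trans (sym (*-identityʳ 1#)) (cong (_⊗ 1#) (sym (except-≡ x 0#)))
    ... | yes refl | no neq = ⊥-elim (neq (zeroʳ x))
    ... | no y≢0 | yes eq = ⊥-elim (⊗-nonZero x≢0 y≢0 eq)
    ... | no y≢0 | no _ = cong (_⊗ y) (sym (except-≢ x y≢0))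

  -- Multiplication by `x` permutes the field, so it leaves `∏ unit` unchanged; hence the `q - 1`
  -- factors `x` that it introduces multiply to 1. One more factor gives the exponent `q` and avoids
  -- truncated subtraction.
  fermat : ∀ {x} → x ≢ 0# → x ^ q ≡ x
  fermat {x} x≢0 = begin
    x ^ q ≡⟨ ∏-except x 0# ⟨
    x ⊗ ∏ (except x 0#) ≡⟨ cong (x ⊗_) ∏≡1 ⟩
    x ⊗ 1# ≡⟨ *-identityʳ x ⟩
    x ∎
    where
    P = ∏ unit
    eq : P ⊗ ∏ (except x 0#) ≡ P ⊗ 1#
    eq = begin
      P ⊗ ∏ (except x 0#) ≡⟨ *-comm P _ ⟩
      ∏ (except x 0#) ⊗ P ≡⟨ ∏-distrib (except x 0#) unit ⟨
      ∏ (λ y → except x 0# y ⊗ unit y) ≡⟨ ∏-cong (unit-⊗ x≢0) ⟨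
      ∏ (λ y → unit (x ⊗ y)) ≡⟨ ∏-permute unit (permutation (x ⊗_) (inv x ⊗_) (inv-cancelʳ x≢0) (inv-cancelˡ x≢0)) ⟨
      P ≡⟨ *-identityʳ P ⟨
      P ⊗ 1# ∎
    ∏≡1 : ∏ (except x 0#) ≡ 1#
    ∏≡1 = ⊗-cancelˡ (∏-nonZero unit unit-nonZero) eq

  ^-pred : ∀ {x n} → x ≢ 0# → x ^ n ≡ x → 1 ℕ.≤ n → x ^ (n ∸ 1) ≡ 1#
  ^-pred {x} {suc n} x≢0 eq _ = ⊗-cancelˡ x≢0 (trans eq (sym (*-identityʳ x)))

  1≤q : 1 ℕ.≤ q
  1≤q = ℕ.≤-trans (ℕ.s≤s ℕ.z≤n) (toℕ<n 0#)

  -- In natural numbers Bézout reads `d + b (q - 1) = a k`, or the same with the roles exchanged.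
  -- Powers with either multiple as exponent are 1, so the one added to `d` can be cancelled. The
  -- assumption `1 ≤ k` makes `y` non-zero, as Fermat requires.
  ^≡1⇒^gcd≡1 : ∀ {y k} → 1 ℕ.≤ k → y ^ k ≡ 1# → y ^ gcd k (q ∸ 1) ≡ 1#
  ^≡1⇒^gcd≡1 {y} {k} 1≤k yᵏ≡1 = go (Bézout.identity (gcd-GCD k (q ∸ 1)))
    where
    y≢0 : y ≢ 0#
    y≢0 refl = 0≢1 (trans (sym (0^ 1≤k)) yᵏ≡1)
    power≡1 : ∀ m n → y ^ n ≡ 1# → y ^ (m ℕ.* n) ≡ 1#
    power≡1 m n eq = trans (^-* y m n) (trans (cong (_^ m) eq) (1^ m))
    yq≡1 : y ^ (q ∸ 1) ≡ 1#
    yq≡1 = ^-pred y≢0 (fermat y≢0) 1≤q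
    cancel : ∀ d m {n} → d ℕ.+ m ≡ n → y ^ m ≡ 1# → y ^ n ≡ 1# → y ^ d ≡ 1#
    cancel d m refl yᵐ yⁿ = begin
      y ^ d ≡⟨ *-identityʳ _ ⟨
      y ^ d ⊗ 1# ≡⟨ cong (y ^ d ⊗_) yᵐ ⟨
      y ^ d ⊗ y ^ m ≡⟨ ^-+ y d m ⟨
      y ^ (d ℕ.+ m) ≡⟨ yⁿ ⟩
      1# ∎
    go : ∀ {d} → Bézout.Identity.Identity d k (q ∸ 1) → y ^ d ≡ 1#
    go {d} (Bézout.+- a b eq) = cancel d (b ℕ.* (q ∸ 1)) eq (power≡1 b (q ∸ 1) yq≡1) (power≡1 a k yᵏ≡1)
    go {d} (Bézout.-+ a b eq) = cancel d (a ℕ.* k) eq (power≡1 a k yᵏ≡1) (power≡1 b (q ∸ 1) yq≡1)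

  -- ⟦ c₀ ∷ … ∷ cₙ₋₁ ∷ [] ⟧ is the monic polynomial xⁿ + cₙ₋₁ xⁿ⁻¹ + … + c₀.
  ⟦_⟧ : ∀ {n} → Vec (Fin q) n → Fin q → Fin q
  ⟦ [] ⟧ x = 1#
  ⟦ c ∷ cs ⟧ x = c ⊕ x ⊗ ⟦ cs ⟧ x

  -- Horner's scheme: the intermediate values at `r` are the coefficients of the quotient by
  -- `x - r`.
  quotient : ∀ {n} → Vec (Fin q) (suc n) → Fin q → Vec (Fin q) n
  quotient (c ∷ []) r = []
  quotient (c ∷ cs@(_ ∷ _)) r = ⟦ cs ⟧ r ∷ quotient cs r

  factor : ∀ {n} (p : Vec (Fin q) (suc n)) r x → ⟦ p ⟧ x ≡ (x ⊕ ⊖ r) ⊗ ⟦ quotient p r ⟧ x ⊕ ⟦ p ⟧ r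
  factor (c ∷ []) r x = solve 3 (λ c r x → c :+ x :* con 1ℤ := (x :+ :- r) :* con 1ℤ :+ (c :+ r :* con 1ℤ)) refl c r x
  factor (c ∷ cs@(_ ∷ _)) r x = trans (cong (λ z → c ⊕ x ⊗ z) (factor cs r x)) (lem c r x (⟦ quotient cs r ⟧ x) (⟦ cs ⟧ r))
    where
    lem : ∀ c r x Q s → c ⊕ x ⊗ ((x ⊕ ⊖ r) ⊗ Q ⊕ s) ≡ (x ⊕ ⊖ r) ⊗ (s ⊕ x ⊗ Q) ⊕ (c ⊕ r ⊗ s)
    lem = solve 5 (λ c r x Q s → c :+ x :* ((x :+ :- r) :* Q :+ s) := (x :+ :- r) :* (s :+ x :* Q) :+ (c :+ r :* s)) refl

  -- Each root of `p` is either the chosen root `r` or a root of the quotient, since a field has no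
  -- zero divisors. Counting by a sum of `δ` lets the bound be compared with `κ` term by term.
  #roots≤degree : ∀ {n} (p : Vec (Fin q) n) → ∑ (λ y → δ (⟦ p ⟧ y) 0#) ℤ.≤ + n
  #roots≤degree {zero} [] = ℤ.≤-reflexive (∑-zero {q} (λ _ → δ 1# 0#) (λ _ → δ-≢ (λ eq → 0≢1 (sym eq))))
  #roots≤degree {suc n} p with any? (λ r → ⟦ p ⟧ r ≟ 0#)
  ... | no ¬root = ℤ.≤-trans (ℤ.≤-reflexive (∑-zero _ (λ y → δ-≢ (λ eq → ¬root (y , eq))))) (ℤ.+≤+ ℕ.z≤n)
  ... | yes (r , pr≡0) = ℤ.≤-trans (∑-mono _ _ pointwise) (ℤ.≤-trans (ℤ.≤-reflexive (∑-+ (λ y → δ y r) (λ y → δ (⟦ p′ ⟧ y) 0#))) (ℤ.+-mono-≤ (ℤ.≤-reflexive ∑δ≡1) (#roots≤degree p′)))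
    where
    p′ = quotient p r
    ∑δ≡1 : ∑ (λ y → δ y r) ≡ 1ℤ
    ∑δ≡1 = trans (∑-cong (λ y → sym (ℤ.*-identityʳ (δ y r)))) (∑-δ (λ _ → 1ℤ) r)
    pointwise : ∀ y → δ (⟦ p ⟧ y) 0# ℤ.≤ δ y r ℤ.+ δ (⟦ p′ ⟧ y) 0#
    pointwise y with ⟦ p ⟧ y ≟ 0# | y ≟ r | ⟦ p′ ⟧ y ≟ 0#
    ... | no py≢0 | _ | _ = ℤ.≤-trans (ℤ.≤-reflexive (δ-≢ py≢0)) (ℤ.+-mono-≤ (δ-nonNeg y r) (δ-nonNeg (⟦ p′ ⟧ y) 0#))
    ... | yes py≡0 | yes y≡r | _ = ℤ.≤-trans (ℤ.≤-reflexive (trans (cong (λ z → δ z 0#) py≡0) (δ-refl 0#))) (ℤ.+-mono-≤ (ℤ.≤-reflexive (sym (trans (cong (λ z → δ z r) y≡r) (δ-refl r)))) (δ-nonNeg (⟦ p′ ⟧ y) 0#))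
    ... | yes py≡0 | no y≢r | yes eq = ℤ.≤-trans (ℤ.≤-reflexive (trans (cong (λ z → δ z 0#) py≡0) (δ-refl 0#))) (ℤ.+-mono-≤ (δ-nonNeg y r) (ℤ.≤-reflexive (sym (trans (cong (λ z → δ z 0#) eq) (δ-refl 0#)))))
    ... | yes py≡0 | no y≢r | no neq = ⊥-elim (⊗-nonZero (λ eq → y≢r (x⊖y≡0⇒x≡y eq)) neq (begin
      (y ⊕ ⊖ r) ⊗ ⟦ p′ ⟧ y ≡⟨ +-identityʳ _ ⟨
      (y ⊕ ⊖ r) ⊗ ⟦ p′ ⟧ y ⊕ 0# ≡⟨ cong ((y ⊕ ⊖ r) ⊗ ⟦ p′ ⟧ y ⊕_) pr≡0 ⟨
      (y ⊕ ⊖ r) ⊗ ⟦ p′ ⟧ y ⊕ ⟦ p ⟧ r ≡⟨ factor p r y ⟨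
      ⟦ p ⟧ y ≡⟨ py≡0 ⟩
      0# ∎))

  monomial : ∀ n x → ⟦ Vec.replicate n 0# ⟧ x ≡ x ^ n
  monomial zero x = refl
  monomial (suc n) x = trans (+-identityˡ _) (cong (x ⊗_) (monomial n x))

  #roots-of-unity : ∀ d → 1 ℕ.≤ d → ∑ (λ y → δ (y ^ d) 1#) ℤ.≤ + d
  #roots-of-unity (suc d) _ = ℤ.≤-trans (ℤ.≤-reflexive (∑-cong same)) (#roots≤degree (⊖ 1# ∷ Vec.replicate d 0#))
    where
    eval : ∀ y → ⟦ ⊖ 1# ∷ Vec.replicate d 0# ⟧ y ≡ y ^ suc d ⊕ ⊖ 1#
    eval y = trans (+-comm _ _) (cong (λ z → y ⊗ z ⊕ ⊖ 1#) (monomial d y))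
    same : ∀ y → δ (y ^ suc d) 1# ≡ δ (⟦ ⊖ 1# ∷ Vec.replicate d 0# ⟧ y) 0#
    same y with y ^ suc d ≟ 1#
    ... | yes eq = trans (trans (cong (λ z → δ z 1#) eq) (δ-refl 1#)) (sym (trans (cong (λ z → δ z 0#) (trans (eval y) (trans (cong (_⊕ ⊖ 1#) eq) (-‿inverseʳ 1#)))) (δ-refl 0#)))
    ... | no neq = trans (δ-≢ neq) (sym (δ-≢ (λ eq → neq (x⊖y≡0⇒x≡y (trans (sym (eval y)) eq)))))

-- The function `χ`, its invariance, and its second moment over all lines.

module Powers {q} (F : Field q) (k : ℕ) (1≤k : 1 ℕ.≤ k) where

  open import Data.Integer using (_+_; _*_; -_; _-_; _≤_)
  open Field F
  open FieldProperties F
  open ≡-Reasoning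

  N : ℤ
  N = + q

  κ : Fin q → ℤ
  κ z = ∑ (λ y → δ z (y ^ k))

  -- Over ℂ this is the sum of the non-trivial multiplicative characters whose order divides `k`.
  -- Keeping them together gives an integer-valued function, so no complex roots of unity appear.
  χ : Fin q → ℤ
  χ z = κ z - 1ℤ

  conv : (Fin q → ℤ) → (Fin q → ℤ) → Fin q → ℤ
  conv f g u = ∑ (λ x → f x * g (u ⊕ ⊖ x))

  Invariant : (Fin q → ℤ) → Set
  Invariant G = ∀ c → c ≢ 0# → ∀ z → G (c ^ k ⊗ z) ≡ G z

  ∑-scale : ∀ {c} → c ≢ 0# → (f : Fin q → ℤ) → ∑ (λ x → f (c ⊗ x)) ≡ ∑ f
  ∑-scale {c} c≢0 f = ∑-reindex f (c ⊗_) (inv c ⊗_) (inv-cancelʳ c≢0) (inv-cancelˡ c≢0)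

  ∑-shift : ∀ c (f : Fin q → ℤ) → ∑ (λ x → f (x ⊕ c)) ≡ ∑ f
  ∑-shift c f = ∑-reindex f (_⊕ c) (_⊕ ⊖ c) (λ x → ⊖-cancelʳ x c) (λ x → ⊕-cancelʳ x c)

  ∑-swap-* : ∀ (f g : Fin q → ℤ) (h : Fin q → Fin q → ℤ) → ∑ (λ s → f s * ∑ (λ t → g t * h s t)) ≡ ∑ (λ t → g t * ∑ (λ s → f s * h s t))
  ∑-swap-* f g h = begin
    ∑ (λ s → f s * ∑ (λ t → g t * h s t)) ≡⟨ ∑-cong (λ s → *-∑ (f s) (λ t → g t * h s t)) ⟩
    ∑ (λ s → ∑ (λ t → f s * (g t * h s t))) ≡⟨ ∑-swap (λ s t → f s * (g t * h s t)) ⟩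
    ∑ (λ t → ∑ (λ s → f s * (g t * h s t))) ≡⟨ ∑-cong (λ t → ∑-cong (λ s → lem (f s) (g t) (h s t))) ⟩
    ∑ (λ t → ∑ (λ s → g t * (f s * h s t))) ≡⟨ ∑-cong (λ t → sym (*-∑ (g t) (λ s → f s * h s t))) ⟩
    ∑ (λ t → g t * ∑ (λ s → f s * h s t)) ∎
    where
    lem : ∀ a b c → a * (b * c) ≡ b * (a * c)
    lem = solve-∀

  ∑-κ : ∀ g → ∑ (λ z → κ z * g z) ≡ ∑ (λ y → g (y ^ k))
  ∑-κ g = begin
    ∑ (λ z → κ z * g z) ≡⟨ ∑-cong (λ z → sym (∑-* (λ y → δ z (y ^ k)) (g z))) ⟩
    ∑ (λ z → ∑ (λ y → δ z (y ^ k) * g z)) ≡⟨ ∑-swap (λ z y → δ z (y ^ k) * g z) ⟩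
    ∑ (λ y → ∑ (λ z → δ z (y ^ k) * g z)) ≡⟨ ∑-cong (λ y → ∑-δ g (y ^ k)) ⟩
    ∑ (λ y → g (y ^ k)) ∎

  ∑-χ-* : ∀ g → ∑ (λ z → χ z * g z) ≡ ∑ (λ y → g (y ^ k)) - ∑ g
  ∑-χ-* g = begin
    ∑ (λ z → χ z * g z) ≡⟨ ∑-cong (λ z → lem (κ z) (g z)) ⟩
    ∑ (λ z → κ z * g z - g z) ≡⟨ ∑-- (λ z → κ z * g z) g ⟩
    ∑ (λ z → κ z * g z) - ∑ g ≡⟨ cong (_- ∑ g) (∑-κ g) ⟩
    ∑ (λ y → g (y ^ k)) - ∑ g ∎
    where
    lem : ∀ a b → (a - 1ℤ) * b ≡ a * b - b
    lem = solve-∀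

  ∑χ*const≡0 : ∀ c → ∑ (λ z → χ z * c) ≡ 0ℤ
  ∑χ*const≡0 c = trans (∑-χ-* (λ _ → c)) (ℤ.+-inverseʳ (∑ {q} (λ _ → c)))

  ∑χ≡0 : ∑ χ ≡ 0ℤ
  ∑χ≡0 = trans (∑-cong (λ z → sym (ℤ.*-identityʳ (χ z)))) (∑χ*const≡0 1ℤ)

  κ-invariant : Invariant κ
  κ-invariant c c≢0 z = begin
    ∑ (λ y → δ (c ^ k ⊗ z) (y ^ k)) ≡⟨ ∑-scale c≢0 (λ y → δ (c ^ k ⊗ z) (y ^ k)) ⟨
    ∑ (λ y → δ (c ^ k ⊗ z) ((c ⊗ y) ^ k)) ≡⟨ ∑-cong (λ y → cong (δ (c ^ k ⊗ z)) (^-⊗ c y k)) ⟩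
    ∑ (λ y → δ (c ^ k ⊗ z) (c ^ k ⊗ y ^ k)) ≡⟨ ∑-cong (λ y → δ-injective (c ^ k ⊗_) (⊗-cancelˡ (^-nonZero c≢0 k)) z (y ^ k)) ⟩
    ∑ (λ y → δ z (y ^ k)) ∎

  χ-invariant : Invariant χ
  χ-invariant c c≢0 z = cong (_- 1ℤ) (κ-invariant c c≢0 z)

  conv-invariant : ∀ {f g} → Invariant f → Invariant g → Invariant (conv f g)
  conv-invariant {f} {g} f-inv g-inv c c≢0 u = begin
    ∑ (λ x → f x * g (h ⊗ u ⊕ ⊖ x)) ≡⟨ ∑-scale (^-nonZero c≢0 k) (λ x → f x * g (h ⊗ u ⊕ ⊖ x)) ⟨
    ∑ (λ x → f (h ⊗ x) * g (h ⊗ u ⊕ ⊖ (h ⊗ x))) ≡⟨ ∑-cong (λ x → cong₂ _*_ (f-inv c c≢0 x) (trans (cong g (lem h u x)) (g-inv c c≢0 (u ⊕ ⊖ x)))) ⟩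
    ∑ (λ x → f x * g (u ⊕ ⊖ x)) ∎
    where
    h = c ^ k
    lem : ∀ h u x → h ⊗ u ⊕ ⊖ (h ⊗ x) ≡ h ⊗ (u ⊕ ⊖ x)
    lem = solve 3 (λ h u x → h :* u :+ :- (h :* x) := h :* (u :+ :- x)) refl

  -- Invariance makes every `y ≠ 0` contribute `G a`; the deviating value at `y = 0` is entered as a
  -- `δ`-weighted correction so that one sum over the whole field remains.
  ∑-orbit : ∀ {G} → Invariant G → ∀ a → ∑ (λ y → G (a ⊗ y ^ k)) ≡ G 0# + (N - 1ℤ) * G a
  ∑-orbit {G} G-inv a = begin
    ∑ (λ y → G (a ⊗ y ^ k)) ≡⟨ ∑-cong pointwise ⟩
    ∑ (λ y → G a + δ y 0# * (G 0# - G a)) ≡⟨ ∑-+ (λ _ → G a) (λ y → δ y 0# * (G 0# - G a)) ⟩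
    ∑ {q} (λ _ → G a) + ∑ (λ y → δ y 0# * (G 0# - G a)) ≡⟨ cong₂ _+_ (∑-const q (G a)) (∑-δ (λ _ → G 0# - G a) 0#) ⟩
    N * G a + (G 0# - G a) ≡⟨ lem N (G a) (G 0#) ⟩
    G 0# + (N - 1ℤ) * G a ∎
    where
    lem : ∀ N a z → N * a + (z - a) ≡ z + (N - 1ℤ) * a
    lem = solve-∀
    lem₀ : ∀ a z → z ≡ a + 1ℤ * (z - a)
    lem₀ = solve-∀
    lem₁ : ∀ a z → a ≡ a + 0ℤ * (z - a)
    lem₁ = solve-∀
    pointwise : ∀ y → G (a ⊗ y ^ k) ≡ G a + δ y 0# * (G 0# - G a)
    pointwise y with y ≟ 0#
    ... | yes refl = trans (cong G (trans (cong (a ⊗_) (0^ 1≤k)) (zeroʳ a))) (trans (lem₀ (G a) (G 0#)) (cong (λ d → G a + d * (G 0# - G a)) (sym (δ-refl 0#))))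
    ... | no y≢0 = trans (cong G (*-comm a (y ^ k))) (trans (G-inv y y≢0 a) (trans (lem₁ (G a) (G 0#)) (cong (λ d → G a + d * (G 0# - G a)) (sym (δ-≢ y≢0)))))

  ∑-orbit₁ : ∀ {G} → Invariant G → ∑ (λ y → G (y ^ k)) ≡ G 0# + (N - 1ℤ) * G 1#
  ∑-orbit₁ {G} G-inv = trans (∑-cong (λ y → cong G (sym (*-identityˡ (y ^ k))))) (∑-orbit G-inv 1#)

  κ0≡1 : κ 0# ≡ 1ℤ
  κ0≡1 = trans (∑-cong pointwise) (∑-δ (λ _ → 1ℤ) 0#)
    where
    pointwise : ∀ y → δ 0# (y ^ k) ≡ δ y 0# * 1ℤ
    pointwise y with y ≟ 0#
    ... | yes refl = trans (cong (δ 0#) (0^ 1≤k)) (trans (δ-refl 0#) (cong (_* 1ℤ) (sym (δ-refl 0#))))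
    ... | no y≢0 = trans (δ-≢ (λ eq → ^-nonZero y≢0 k (sym eq))) (cong (_* 1ℤ) (sym (δ-≢ y≢0)))

  χ0≡0 : χ 0# ≡ 0ℤ
  χ0≡0 = cong (_- 1ℤ) κ0≡1

  m : ℤ
  m = χ 1#

  ∑χ² : ∑ (λ z → χ z * χ z) ≡ (N - 1ℤ) * m
  ∑χ² = begin
    ∑ (λ z → χ z * χ z) ≡⟨ ∑-χ-* χ ⟩
    ∑ (λ y → χ (y ^ k)) - ∑ χ ≡⟨ cong₂ _-_ (∑-orbit₁ χ-invariant) ∑χ≡0 ⟩
    χ 0# + (N - 1ℤ) * m - 0ℤ ≡⟨ cong (λ z → z + (N - 1ℤ) * m - 0ℤ) χ0≡0 ⟩
    0ℤ + (N - 1ℤ) * m - 0ℤ ≡⟨ lem ((N - 1ℤ) * m) ⟩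
    (N - 1ℤ) * m ∎
    where
    lem : ∀ a → 0ℤ + a - 0ℤ ≡ a
    lem = solve-∀

  ∑-conv : ∀ f g b → ∑ (λ t → g t * ∑ (λ x → f x * b (x ⊕ t))) ≡ ∑ (λ u → b u * conv f g u)
  ∑-conv f g b = begin
    ∑ (λ t → g t * ∑ (λ x → f x * b (x ⊕ t))) ≡⟨ ∑-swap-* g f (λ t x → b (x ⊕ t)) ⟩
    ∑ (λ x → f x * ∑ (λ t → g t * b (x ⊕ t))) ≡⟨ ∑-cong (λ x → cong (f x *_) (inner x)) ⟩
    ∑ (λ x → f x * ∑ (λ u → b u * g (u ⊕ ⊖ x))) ≡⟨ ∑-swap-* f b (λ x u → g (u ⊕ ⊖ x)) ⟩
    ∑ (λ u → b u * ∑ (λ x → f x * g (u ⊕ ⊖ x))) ∎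
    where
    lem : ∀ u x → x ⊕ (u ⊕ ⊖ x) ≡ u
    lem = solve 2 (λ u x → x :+ (u :+ :- x) := u) refl
    inner : ∀ x → ∑ (λ t → g t * b (x ⊕ t)) ≡ ∑ (λ u → b u * g (u ⊕ ⊖ x))
    inner x = begin
      ∑ (λ t → g t * b (x ⊕ t)) ≡⟨ ∑-shift (⊖ x) (λ t → g t * b (x ⊕ t)) ⟨
      ∑ (λ u → g (u ⊕ ⊖ x) * b (x ⊕ (u ⊕ ⊖ x))) ≡⟨ ∑-cong (λ u → trans (cong (λ z → g (u ⊕ ⊖ x) * b z) (lem u x)) (ℤ.*-comm (g (u ⊕ ⊖ x)) (b u))) ⟩
      ∑ (λ u → b u * g (u ⊕ ⊖ x)) ∎

  ∑-of-conv : ∀ f g → ∑ (conv f g) ≡ ∑ f * ∑ g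
  ∑-of-conv f g = begin
    ∑ (λ u → ∑ (λ x → f x * g (u ⊕ ⊖ x))) ≡⟨ ∑-swap (λ u x → f x * g (u ⊕ ⊖ x)) ⟩
    ∑ (λ x → ∑ (λ u → f x * g (u ⊕ ⊖ x))) ≡⟨ ∑-cong (λ x → trans (sym (*-∑ (f x) (λ u → g (u ⊕ ⊖ x)))) (cong (f x *_) (∑-shift (⊖ x) g))) ⟩
    ∑ (λ x → f x * ∑ g) ≡⟨ ∑-* f (∑ g) ⟩
    ∑ f * ∑ g ∎

  module Lines (b : Fin q → ℤ) where

    line : Fin q → Fin q → ℤ
    line s t = ∑ (λ x → χ x * b (s ⊗ x ⊕ t))

    -- A factor `cᵏ` of the slope is moved into the variable `x`, where `χ` does not notice it.
    line-invariant : ∀ t → Invariant (λ s → line s t)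
    line-invariant t c c≢0 s = begin
      ∑ (λ x → χ x * b (h ⊗ s ⊗ x ⊕ t)) ≡⟨ ∑-cong (λ x → cong₂ _*_ (sym (χ-invariant c c≢0 x)) (cong (λ z → b (z ⊕ t)) (lem h s x))) ⟩
      ∑ (λ x → χ (h ⊗ x) * b (s ⊗ (h ⊗ x) ⊕ t)) ≡⟨ ∑-scale (^-nonZero c≢0 k) (λ x → χ x * b (s ⊗ x ⊕ t)) ⟩
      ∑ (λ x → χ x * b (s ⊗ x ⊕ t)) ∎
      where
      h = c ^ k
      lem : ∀ h s x → h ⊗ s ⊗ x ≡ s ⊗ (h ⊗ x)
      lem = solve 3 (λ h s x → h :* s :* x := s :* (h :* x)) refl

    line-0 : ∀ t → line 0# t ≡ 0ℤ
    line-0 t = trans (∑-cong (λ x → cong (λ z → χ x * b z) (trans (cong (_⊕ t) (zeroˡ x)) (+-identityˡ t)))) (∑χ*const≡0 (b t))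

    line-1 : ∀ t → line 1# t ≡ ∑ (λ x → χ x * b (x ⊕ t))
    line-1 t = ∑-cong (λ x → cong (λ z → χ x * b (z ⊕ t)) (*-identityˡ x))

    -- For fixed `x ≠ 0` the value `s x + t` runs through the field as `s` does, giving the constant
    -- `∑ b`; the point `x = 0` carries the weight `χ 0 = 0`. What is left is a multiple of `∑ χ`.
    ∑-line : ∀ t → ∑ (λ s → line s t) ≡ 0ℤ
    ∑-line t = begin
      ∑ (λ s → ∑ (λ x → χ x * b (s ⊗ x ⊕ t))) ≡⟨ ∑-swap (λ s x → χ x * b (s ⊗ x ⊕ t)) ⟩
      ∑ (λ x → ∑ (λ s → χ x * b (s ⊗ x ⊕ t))) ≡⟨ ∑-cong (λ x → trans (sym (*-∑ (χ x) (λ s → b (s ⊗ x ⊕ t)))) (pointwise x)) ⟩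
      ∑ (λ x → χ x * ∑ b) ≡⟨ ∑χ*const≡0 (∑ b) ⟩
      0ℤ ∎
      where
      pointwise : ∀ x → χ x * ∑ (λ s → b (s ⊗ x ⊕ t)) ≡ χ x * ∑ b
      pointwise x with x ≟ 0#
      ... | yes refl = trans (cong (_* ∑ (λ s → b (s ⊗ 0# ⊕ t))) χ0≡0) (trans (ℤ.*-zeroˡ (∑ (λ s → b (s ⊗ 0# ⊕ t)))) (sym (trans (cong (_* ∑ b) χ0≡0) (ℤ.*-zeroˡ (∑ b)))))
      ... | no x≢0 = cong (χ x *_) (trans (∑-cong (λ s → cong (λ z → b (z ⊕ t)) (*-comm s x))) (trans (∑-scale x≢0 (λ s → b (s ⊕ t))) (∑-shift t b)))

    -- The averaging step: the weight `χ s` sums over the slopes `yᵏ`, and for `y ≠ 0` all of these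
    -- give the value at slope 1. Thus the single line of slope 1 is expressed through all lines at
    -- the cost of a factor `N - 1`.
    ∑-χ-line : ∀ t → ∑ (λ s → χ s * line s t) ≡ (N - 1ℤ) * ∑ (λ x → χ x * b (x ⊕ t))
    ∑-χ-line t = begin
      ∑ (λ s → χ s * line s t) ≡⟨ ∑-χ-* (λ s → line s t) ⟩
      ∑ (λ y → line (y ^ k) t) - ∑ (λ s → line s t) ≡⟨ cong₂ _-_ (∑-orbit₁ (line-invariant t)) (∑-line t) ⟩
      line 0# t + (N - 1ℤ) * line 1# t - 0ℤ ≡⟨ cong₂ (λ u v → u + (N - 1ℤ) * v - 0ℤ) (line-0 t) (line-1 t) ⟩
      0ℤ + (N - 1ℤ) * ∑ (λ x → χ x * b (x ⊕ t)) - 0ℤ ≡⟨ lem ((N - 1ℤ) * ∑ (λ x → χ x * b (x ⊕ t))) ⟩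
      (N - 1ℤ) * ∑ (λ x → χ x * b (x ⊕ t)) ∎
      where
      lem : ∀ a → 0ℤ + a - 0ℤ ≡ a
      lem = solve-∀

    corr : Fin q → ℤ
    corr v = ∑ (λ t → b t * b (t ⊕ v))

    ∑corr : ∑ corr ≡ ∑ b * ∑ b
    ∑corr = begin
      ∑ (λ v → ∑ (λ t → b t * b (t ⊕ v))) ≡⟨ ∑-swap (λ v t → b t * b (t ⊕ v)) ⟩
      ∑ (λ t → ∑ (λ v → b t * b (t ⊕ v))) ≡⟨ ∑-cong (λ t → trans (sym (*-∑ (b t) (λ v → b (t ⊕ v)))) (cong (b t *_) (trans (∑-cong (λ v → cong b (+-comm t v))) (∑-shift t b)))) ⟩
      ∑ (λ t → b t * ∑ b) ≡⟨ ∑-* b (∑ b) ⟩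
      ∑ b * ∑ b ∎

    -- `D` is `N²` times the variance of `b`.
    B² D : ℤ
    B² = ∑ b * ∑ b
    D = N * ∑ (λ t → b t * b t) - B²

    corr0 : corr 0# ≡ ∑ (λ t → b t * b t)
    corr0 = ∑-cong (λ t → cong (λ z → b t * b z) (+-identityʳ t))

    -- For `x′ ≠ x` the shifts `s (x′ - x)` run through the whole field, so the answer does not
    -- depend on the pair. The form with `δ` separates this constant from the excess on the
    -- diagonal.
    ∑-corr-scaled : ∀ x x′ → ∑ (λ s → corr (s ⊗ (x′ ⊕ ⊖ x))) ≡ B² + δ x′ x * D
    ∑-corr-scaled x x′ with x′ ≟ x
    ... | yes refl = begin
      ∑ (λ s → corr (s ⊗ (x ⊕ ⊖ x))) ≡⟨ ∑-cong (λ s → trans (cong corr (trans (cong (s ⊗_) (-‿inverseʳ x)) (zeroʳ s))) corr0) ⟩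
      ∑ {q} (λ s → ∑ (λ t → b t * b t)) ≡⟨ ∑-const q (∑ (λ t → b t * b t)) ⟩
      N * ∑ (λ t → b t * b t) ≡⟨ lem B² (N * ∑ (λ t → b t * b t)) ⟩
      B² + 1ℤ * D ≡⟨ cong (λ d → B² + d * D) (sym (δ-refl x)) ⟩
      B² + δ x x * D ∎
      where
      lem : ∀ B X → X ≡ B + 1ℤ * (X - B)
      lem = solve-∀
    ... | no x′≢x = begin
      ∑ (λ s → corr (s ⊗ (x′ ⊕ ⊖ x))) ≡⟨ ∑-cong (λ s → cong corr (*-comm s (x′ ⊕ ⊖ x))) ⟩
      ∑ (λ s → corr ((x′ ⊕ ⊖ x) ⊗ s)) ≡⟨ ∑-scale (λ eq → x′≢x (x⊖y≡0⇒x≡y eq)) corr ⟩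
      ∑ corr ≡⟨ ∑corr ⟩
      B² ≡⟨ lem B² D ⟩
      B² + 0ℤ * D ≡⟨ cong (λ d → B² + d * D) (sym (δ-≢ x′≢x)) ⟩
      B² + δ x′ x * D ∎
      where
      lem : ∀ B D → B ≡ B + 0ℤ * D
      lem = solve-∀

    ∑-line² : ∀ s → ∑ (λ t → line s t * line s t) ≡ ∑ (λ x → χ x * ∑ (λ x′ → χ x′ * corr (s ⊗ (x′ ⊕ ⊖ x))))
    ∑-line² s = begin
      ∑ (λ t → line s t * line s t) ≡⟨ ∑-swap-* (λ t → line s t) χ (λ t x → b (s ⊗ x ⊕ t)) ⟩
      ∑ (λ x → χ x * ∑ (λ t → line s t * b (s ⊗ x ⊕ t))) ≡⟨ ∑-cong (λ x → cong (χ x *_) (inner x)) ⟩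
      ∑ (λ x → χ x * ∑ (λ x′ → χ x′ * corr (s ⊗ (x′ ⊕ ⊖ x)))) ∎
      where
      lem : ∀ s x x′ t → s ⊗ x′ ⊕ (t ⊕ ⊖ (s ⊗ x)) ≡ t ⊕ s ⊗ (x′ ⊕ ⊖ x)
      lem = solve 4 (λ s x x′ t → s :* x′ :+ (t :+ :- (s :* x)) := t :+ s :* (x′ :+ :- x)) refl
      lem′ : ∀ s x t → s ⊗ x ⊕ (t ⊕ ⊖ (s ⊗ x)) ≡ t
      lem′ = solve 3 (λ s x t → s :* x :+ (t :+ :- (s :* x)) := t) refl
      inner : ∀ x → ∑ (λ t → line s t * b (s ⊗ x ⊕ t)) ≡ ∑ (λ x′ → χ x′ * corr (s ⊗ (x′ ⊕ ⊖ x)))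
      inner x = begin
        ∑ (λ t → line s t * b (s ⊗ x ⊕ t)) ≡⟨ ∑-cong (λ t → ℤ.*-comm (line s t) (b (s ⊗ x ⊕ t))) ⟩
        ∑ (λ t → b (s ⊗ x ⊕ t) * ∑ (λ x′ → χ x′ * b (s ⊗ x′ ⊕ t))) ≡⟨ ∑-swap-* (λ t → b (s ⊗ x ⊕ t)) χ (λ t x′ → b (s ⊗ x′ ⊕ t)) ⟩
        ∑ (λ x′ → χ x′ * ∑ (λ t → b (s ⊗ x ⊕ t) * b (s ⊗ x′ ⊕ t))) ≡⟨ ∑-cong (λ x′ → cong (χ x′ *_) (sym (∑-shift (⊖ (s ⊗ x)) (λ t → b (s ⊗ x ⊕ t) * b (s ⊗ x′ ⊕ t))))) ⟩
        ∑ (λ x′ → χ x′ * ∑ (λ t → b (s ⊗ x ⊕ (t ⊕ ⊖ (s ⊗ x))) * b (s ⊗ x′ ⊕ (t ⊕ ⊖ (s ⊗ x))))) ≡⟨ ∑-cong (λ x′ → cong (χ x′ *_) (∑-cong (λ t → cong₂ (λ u v → b u * b v) (lem′ s x t) (lem s x x′ t)))) ⟩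
        ∑ (λ x′ → χ x′ * corr (s ⊗ (x′ ⊕ ⊖ x))) ∎

    -- The second moment is exact: the constant part `B²` is annihilated by `∑ χ = 0`, and only the
    -- diagonal `x′ = x` survives.
    ∑∑-line² : ∑ (λ s → ∑ (λ t → line s t * line s t)) ≡ ∑ (λ x → χ x * χ x) * D
    ∑∑-line² = begin
      ∑ (λ s → ∑ (λ t → line s t * line s t)) ≡⟨ ∑-cong (λ s → trans (∑-line² s) (sym (ℤ.*-identityˡ (∑ (λ x → χ x * ∑ (λ x′ → χ x′ * corr (s ⊗ (x′ ⊕ ⊖ x)))))))) ⟩
      ∑ (λ s → 1ℤ * ∑ (λ x → χ x * ∑ (λ x′ → χ x′ * corr (s ⊗ (x′ ⊕ ⊖ x))))) ≡⟨ ∑-swap-* (λ _ → 1ℤ) χ (λ s x → ∑ (λ x′ → χ x′ * corr (s ⊗ (x′ ⊕ ⊖ x)))) ⟩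
      ∑ (λ x → χ x * ∑ (λ s → 1ℤ * ∑ (λ x′ → χ x′ * corr (s ⊗ (x′ ⊕ ⊖ x))))) ≡⟨ ∑-cong (λ x → cong (χ x *_) (inner x)) ⟩
      ∑ (λ x → χ x * (χ x * D)) ≡⟨ ∑-cong (λ x → sym (ℤ.*-assoc (χ x) (χ x) D)) ⟩
      ∑ (λ x → χ x * χ x * D) ≡⟨ ∑-* (λ x → χ x * χ x) D ⟩
      ∑ (λ x → χ x * χ x) * D ∎
      where
      lem : ∀ c B d D → c * (B + d * D) ≡ c * B + d * (c * D)
      lem = solve-∀
      inner : ∀ x → ∑ (λ s → 1ℤ * ∑ (λ x′ → χ x′ * corr (s ⊗ (x′ ⊕ ⊖ x)))) ≡ χ x * D
      inner x = begin
        ∑ (λ s → 1ℤ * ∑ (λ x′ → χ x′ * corr (s ⊗ (x′ ⊕ ⊖ x)))) ≡⟨ ∑-swap-* (λ _ → 1ℤ) χ (λ s x′ → corr (s ⊗ (x′ ⊕ ⊖ x))) ⟩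
        ∑ (λ x′ → χ x′ * ∑ (λ s → 1ℤ * corr (s ⊗ (x′ ⊕ ⊖ x)))) ≡⟨ ∑-cong (λ x′ → cong (χ x′ *_) (trans (∑-cong (λ s → ℤ.*-identityˡ (corr (s ⊗ (x′ ⊕ ⊖ x))))) (∑-corr-scaled x x′))) ⟩
        ∑ (λ x′ → χ x′ * (B² + δ x′ x * D)) ≡⟨ ∑-cong (λ x′ → lem (χ x′) B² (δ x′ x) D) ⟩
        ∑ (λ x′ → χ x′ * B² + δ x′ x * (χ x′ * D)) ≡⟨ ∑-+ (λ x′ → χ x′ * B²) (λ x′ → δ x′ x * (χ x′ * D)) ⟩
        ∑ (λ x′ → χ x′ * B²) + ∑ (λ x′ → δ x′ x * (χ x′ * D)) ≡⟨ cong₂ _+_ (∑χ*const≡0 B²) (∑-δ (λ x′ → χ x′ * D) x) ⟩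
        0ℤ + χ x * D ≡⟨ ℤ.+-identityˡ (χ x * D) ⟩
        χ x * D ∎

-- Numerical contradictions for two and three powers, with `n = q - 1`.

two-power-bound : ∀ n N m → N ≡ suc n → suc m ℕ.≤ n → m ℕ.^ 4 ℕ.≤ n →
  ¬ (n ℕ.* (n ℕ.* N)) ℕ.* (n ℕ.* (n ℕ.* N)) ℕ.≤ (n ℕ.* m) ℕ.* ((n ℕ.* m) ℕ.* ((n ℕ.* m) ℕ.* (N ℕ.* (n ℕ.* m ℕ.+ 1))))
two-power-bound n@(suc _) N@.(suc n) m refl m<n m⁴≤n le = small m m<n m⁴≤n n≤m³
  where
  open ℕ.≤-Reasoning
  lhs : ∀ n N → (n ℕ.* (n ℕ.* N)) ℕ.* (n ℕ.* (n ℕ.* N)) ≡ (n ℕ.* n ℕ.* n ℕ.* N) ℕ.* (n ℕ.* N)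
  lhs = ℕ-Solver.solve-∀
  rhs : ∀ n N m → (n ℕ.* m) ℕ.* ((n ℕ.* m) ℕ.* ((n ℕ.* m) ℕ.* (N ℕ.* (n ℕ.* m ℕ.+ 1)))) ≡ (n ℕ.* n ℕ.* n ℕ.* N) ℕ.* (n ℕ.* (m ℕ.* (m ℕ.* (m ℕ.* (m ℕ.* 1)))) ℕ.+ (m ℕ.* (m ℕ.* (m ℕ.* 1))))
  rhs = ℕ-Solver.solve-∀
  -- The hypothesis is the bound on `χ ∗ χ` at a point where its absolute value is `N`; the common
  -- factor `n³ N` is removed.
  cancelled : n ℕ.* N ℕ.≤ n ℕ.* m ℕ.^ 4 ℕ.+ m ℕ.^ 3
  cancelled = ℕ.*-cancelˡ-≤ (n ℕ.* n ℕ.* n ℕ.* N) (subst₂ ℕ._≤_ (lhs n N) (rhs n N m) le)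
  n≤m³ : n ℕ.≤ m ℕ.^ 3
  n≤m³ = ℕ.+-cancelˡ-≤ (n ℕ.* n) n (m ℕ.^ 3) (begin
    n ℕ.* n ℕ.+ n ≡⟨ ℕ.+-comm (n ℕ.* n) n ⟩
    n ℕ.+ n ℕ.* n ≡⟨ ℕ.*-suc n n ⟨
    n ℕ.* N ≤⟨ cancelled ⟩
    n ℕ.* m ℕ.^ 4 ℕ.+ m ℕ.^ 3 ≤⟨ ℕ.+-monoˡ-≤ (m ℕ.^ 3) (ℕ.*-monoʳ-≤ n m⁴≤n) ⟩
    n ℕ.* n ℕ.+ m ℕ.^ 3 ∎)
  -- `m⁴ ≤ n ≤ m³` is impossible only from `m = 2` on; `m = 0` contradicts `n ≠ 0`, and `m = 1` is
  -- where `m < n` is needed.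
  small : ∀ m → suc m ℕ.≤ n → m ℕ.^ 4 ℕ.≤ n → n ℕ.≤ m ℕ.^ 3 → ⊥
  small zero _ _ ()
  small (suc zero) 2≤n _ n≤1 = ℕ.<-irrefl refl (ℕ.≤-trans 2≤n n≤1)
  small m@(suc (suc m′)) _ m⁴≤n n≤m³ = ℕ.<-irrefl refl (begin-strict
    m ℕ.^ 3 <⟨ ℕ.m<m*n (m ℕ.^ 3) m ⦃ ℕ.m^n≢0 m 3 ⦄ (ℕ.s≤s (ℕ.s≤s ℕ.z≤n)) ⟩
    m ℕ.^ 3 ℕ.* m ≡⟨ ℕ.*-comm (m ℕ.^ 3) m ⟩
    m ℕ.^ 4 ≤⟨ m⁴≤n ⟩
    n ≤⟨ n≤m³ ⟩
    m ℕ.^ 3 ∎)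

-- Self-improvement: with `f = χ` and `b = χ ∗ χ` the pairing is `e = ∑ (χ ∗ χ)²` itself. It occurs
-- squared on the left and once on the right, so one factor `e` cancels.
energy-bound : ∀ n N m e .⦃ _ : ℕ.NonZero n ⦄ →
  (n ℕ.* e) ℕ.* (n ℕ.* e) ℕ.≤ (n ℕ.* m) ℕ.* ((n ℕ.* m) ℕ.* ((n ℕ.* m) ℕ.* (N ℕ.* e))) → e ℕ.≤ n ℕ.* (m ℕ.^ 3 ℕ.* N)
energy-bound n N m zero le = ℕ.z≤n
energy-bound n@(suc _) N m e@(suc _) le = ℕ.*-cancelˡ-≤ (n ℕ.* n ℕ.* e) (subst₂ ℕ._≤_ (lhs n e) (rhs n N m e) le)
  where
  lhs : ∀ n e → (n ℕ.* e) ℕ.* (n ℕ.* e) ≡ (n ℕ.* n ℕ.* e) ℕ.* e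
  lhs = ℕ-Solver.solve-∀
  rhs : ∀ n N m e → (n ℕ.* m) ℕ.* ((n ℕ.* m) ℕ.* ((n ℕ.* m) ℕ.* (N ℕ.* e))) ≡ (n ℕ.* n ℕ.* e) ℕ.* (n ℕ.* ((m ℕ.* (m ℕ.* (m ℕ.* 1))) ℕ.* N))
  rhs = ℕ-Solver.solve-∀

-- Inserting the bound for `e` and cancelling `n³ N²` leaves `n N² ≤ n m⁶ + m⁵`. With `m³ ≤ n` the
-- right side is at most `n³ + n²`, while the left side is `n³ + 2 n² + n`.
three-power-bound : ∀ n N m e → N ≡ suc n → 1 ℕ.≤ n → m ℕ.^ 3 ℕ.≤ n → e ℕ.≤ n ℕ.* (m ℕ.^ 3 ℕ.* N) →
  ¬ (n ℕ.* (n ℕ.* (N ℕ.* N))) ℕ.* (n ℕ.* (n ℕ.* (N ℕ.* N))) ℕ.≤ (n ℕ.* m) ℕ.* (e ℕ.* ((n ℕ.* m) ℕ.* (N ℕ.* (n ℕ.* m ℕ.+ 1))))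
three-power-bound n@(suc _) N@.(suc n) m e refl 1≤n m³≤n e≤ le = ℕ.<-irrefl refl (begin-strict
  n ℕ.* (m ℕ.^ 3 ℕ.* m ℕ.^ 3) ℕ.+ m ℕ.^ 5 ≤⟨ ℕ.+-mono-≤ (ℕ.*-monoʳ-≤ n (ℕ.*-mono-≤ m³≤n m³≤n)) (m⁵≤ m) ⟩
  n ℕ.* (n ℕ.* n) ℕ.+ m ℕ.^ 3 ℕ.* m ℕ.^ 3 ≤⟨ ℕ.+-monoʳ-≤ (n ℕ.* (n ℕ.* n)) (ℕ.*-mono-≤ m³≤n m³≤n) ⟩
  n ℕ.* (n ℕ.* n) ℕ.+ n ℕ.* n <⟨ ℕ.m<m+n (n ℕ.* (n ℕ.* n) ℕ.+ n ℕ.* n) 1≤n ⟩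
  n ℕ.* (n ℕ.* n) ℕ.+ n ℕ.* n ℕ.+ n ≤⟨ ℕ.m≤m+n _ (n ℕ.* n) ⟩
  n ℕ.* (n ℕ.* n) ℕ.+ n ℕ.* n ℕ.+ n ℕ.+ n ℕ.* n ≡⟨ expand n ⟩
  n ℕ.* (N ℕ.* N) ≤⟨ cancelled ⟩
  n ℕ.* (m ℕ.^ 3 ℕ.* m ℕ.^ 3) ℕ.+ m ℕ.^ 5 ∎)
  where
  open ℕ.≤-Reasoning
  expand : ∀ n → n ℕ.* (n ℕ.* n) ℕ.+ n ℕ.* n ℕ.+ n ℕ.+ n ℕ.* n ≡ n ℕ.* ((1 ℕ.+ n) ℕ.* (1 ℕ.+ n))
  expand = ℕ-Solver.solve-∀
  m⁵≤ : ∀ m → m ℕ.^ 5 ℕ.≤ m ℕ.^ 3 ℕ.* m ℕ.^ 3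
  m⁵≤ zero = ℕ.z≤n
  m⁵≤ m@(suc _) = subst (m ℕ.^ 5 ℕ.≤_) (ℕ.^-distribˡ-+-* m 3 3) (ℕ.^-monoʳ-≤ m (ℕ.n≤1+n 5))
  lhs : ∀ n N → (n ℕ.* (n ℕ.* (N ℕ.* N))) ℕ.* (n ℕ.* (n ℕ.* (N ℕ.* N))) ≡ (n ℕ.* n ℕ.* n ℕ.* N ℕ.* N) ℕ.* (n ℕ.* (N ℕ.* N))
  lhs = ℕ-Solver.solve-∀
  rhs : ∀ n N m → (n ℕ.* m) ℕ.* ((n ℕ.* ((m ℕ.* (m ℕ.* (m ℕ.* 1))) ℕ.* N)) ℕ.* ((n ℕ.* m) ℕ.* (N ℕ.* (n ℕ.* m ℕ.+ 1)))) ≡ (n ℕ.* n ℕ.* n ℕ.* N ℕ.* N) ℕ.* (n ℕ.* ((m ℕ.* (m ℕ.* (m ℕ.* 1))) ℕ.* (m ℕ.* (m ℕ.* (m ℕ.* 1)))) ℕ.+ (m ℕ.* (m ℕ.* (m ℕ.* (m ℕ.* (m ℕ.* 1))))))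
  rhs = ℕ-Solver.solve-∀
  cancelled : n ℕ.* (N ℕ.* N) ℕ.≤ n ℕ.* (m ℕ.^ 3 ℕ.* m ℕ.^ 3) ℕ.+ m ℕ.^ 5
  cancelled = ℕ.*-cancelˡ-≤ (n ℕ.* n ℕ.* n ℕ.* N ℕ.* N) (subst₂ ℕ._≤_ (lhs n N) (rhs n N m)
    (ℕ.≤-trans le (ℕ.*-monoʳ-≤ (n ℕ.* m) (ℕ.*-monoˡ-≤ ((n ℕ.* m) ℕ.* (N ℕ.* (n ℕ.* m ℕ.+ 1))) e≤))))

-- Sums of two and of three k-th powers in a finite field.

module PowerSums {q} (F : Field q) (k : ℕ) (1≤k : 1 ℕ.≤ k) where

  open import Data.Integer using (_+_; _*_; -_; _-_; _≤_)
  open import Data.Integer.Properties using (module ≤-Reasoning)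
  open Field F
  open FieldProperties F
  open Powers F k 1≤k

  ∑sq : (Fin q → ℤ) → ℤ
  ∑sq f = ∑ (λ z → f z * f z)

  ∑sq-nonNeg : ∀ f → 0ℤ ≤ ∑sq f
  ∑sq-nonNeg f = ∑-nonNeg _ (λ z → sq-nonNeg (f z))

  pairing : (Fin q → ℤ) → (Fin q → ℤ) → ℤ
  pairing f b = ∑ (λ u → b u * conv χ f u)

  -- Cauchy–Schwarz twice: in s against χ, then in t against f.
  mixing : ∀ f b → ((N - 1ℤ) * pairing f b) * ((N - 1ℤ) * pairing f b) ≤ ∑sq χ * (∑sq f * (∑sq χ * (N * ∑sq b)))
  mixing f b = begin
    T * T ≡⟨ cong₂ _*_ T≡ T≡ ⟩
    ∑ (λ s → χ s * G s) * ∑ (λ s → χ s * G s) ≤⟨ cauchy-schwarz χ G ⟩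
    ∑sq χ * ∑sq G ≤⟨ *-mono (∑sq-nonNeg χ) (∑-mono _ _ (λ s → cauchy-schwarz f (line s))) ⟩
    ∑sq χ * ∑ (λ s → ∑sq f * ∑sq (line s)) ≡⟨ cong (∑sq χ *_) (trans (sym (*-∑ (∑sq f) (λ s → ∑sq (line s)))) (cong (∑sq f *_) ∑∑-line²)) ⟩
    ∑sq χ * (∑sq f * (∑sq χ * D)) ≤⟨ *-mono (∑sq-nonNeg χ) (*-mono (∑sq-nonNeg f) (*-mono (∑sq-nonNeg χ) D≤)) ⟩
    ∑sq χ * (∑sq f * (∑sq χ * (N * ∑sq b))) ∎
    where
    open Lines b
    open ≤-Reasoning
    T = (N - 1ℤ) * pairing f b
    G = λ s → ∑ (λ t → f t * line s t)
    L = λ t → ∑ (λ x → χ x * b (x ⊕ t))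
    swap : ∀ a b c → a * (b * c) ≡ b * (a * c)
    swap = solve-∀
    -- The factor `N - 1` in `T` is what the averaging over slopes costs; afterwards the sums over
    -- `s` and `t` are exchanged.
    T≡ : T ≡ ∑ (λ s → χ s * G s)
    T≡ = begin-equality
      (N - 1ℤ) * pairing f b ≡⟨ cong ((N - 1ℤ) *_) (∑-conv χ f b) ⟨
      (N - 1ℤ) * ∑ (λ t → f t * L t) ≡⟨ *-∑ (N - 1ℤ) (λ t → f t * L t) ⟩
      ∑ (λ t → (N - 1ℤ) * (f t * L t)) ≡⟨ ∑-cong (λ t → trans (swap (N - 1ℤ) (f t) (L t)) (cong (f t *_) (sym (∑-χ-line t)))) ⟩
      ∑ (λ t → f t * ∑ (λ s → χ s * line s t)) ≡⟨ ∑-swap-* f χ (λ t s → line s t) ⟩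
      ∑ (λ s → χ s * G s) ∎
    D≤ : D ≤ N * ∑sq b
    D≤ = ℤ.i-j≤i (N * ∑sq b) B² ⦃ ℤ.nonNegative (sq-nonNeg (∑ b)) ⦄

  module _ (f : Fin q → ℤ) (f-inv : Invariant f) {a : Fin q} (a≢0 : a ≢ 0#) where

    -- The spike at 0 cancels the contribution of y = 0 to ∑_y conv χ f (a yᵏ).
    test : Fin q → ℤ
    test u = χ (inv a ⊗ u) - δ u 0#

    -- The pairing isolates one value of the convolution: the rescaled `χ` sums it over the orbit
    -- `a yᵏ`, constant for `y ≠ 0`, and subtracts its total, which is 0 because `∑ χ = 0`.
    pairing-test : pairing f test ≡ (N - 1ℤ) * conv χ f a
    pairing-test = begin
      ∑ (λ u → test u * C u) ≡⟨ ∑-cong (λ u → split (χ (inv a ⊗ u)) (δ u 0#) (C u)) ⟩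
      ∑ (λ u → χ (inv a ⊗ u) * C u - δ u 0# * C u) ≡⟨ ∑-- (λ u → χ (inv a ⊗ u) * C u) (λ u → δ u 0# * C u) ⟩
      ∑ (λ u → χ (inv a ⊗ u) * C u) - ∑ (λ u → δ u 0# * C u) ≡⟨ cong₂ _-_ first (∑-δ C 0#) ⟩
      (C 0# + (N - 1ℤ) * C a - 0ℤ) - C 0# ≡⟨ tidy (C 0#) ((N - 1ℤ) * C a) ⟩
      (N - 1ℤ) * C a ∎
      where
      open ≡-Reasoning
      C = conv χ f
      split : ∀ x d c → (x - d) * c ≡ x * c - d * c
      split = solve-∀
      tidy : ∀ c x → (c + x - 0ℤ) - c ≡ x
      tidy = solve-∀
      first : ∑ (λ u → χ (inv a ⊗ u) * C u) ≡ C 0# + (N - 1ℤ) * C a - 0ℤ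
      first = begin
        ∑ (λ u → χ (inv a ⊗ u) * C u) ≡⟨ ∑-scale a≢0 (λ u → χ (inv a ⊗ u) * C u) ⟨
        ∑ (λ u → χ (inv a ⊗ (a ⊗ u)) * C (a ⊗ u)) ≡⟨ ∑-cong (λ u → cong (λ z → χ z * C (a ⊗ u)) (inv-cancelˡ a≢0 u)) ⟩
        ∑ (λ u → χ u * C (a ⊗ u)) ≡⟨ ∑-χ-* (λ u → C (a ⊗ u)) ⟩
        ∑ (λ y → C (a ⊗ y ^ k)) - ∑ (λ u → C (a ⊗ u)) ≡⟨ cong₂ _-_ (∑-orbit (conv-invariant χ-invariant f-inv) a) (trans (∑-scale a≢0 C) (trans (∑-of-conv χ f) (trans (cong (_* ∑ f) ∑χ≡0) (ℤ.*-zeroˡ (∑ f))))) ⟩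
        C 0# + (N - 1ℤ) * C a - 0ℤ ∎

    -- The spike costs exactly 1, since `χ 0 = 0` removes the cross term.
    ∑sq-test : ∑sq test ≡ ∑sq χ + 1ℤ
    ∑sq-test = begin
      ∑ (λ u → test u * test u) ≡⟨ ∑-cong (λ u → split (χ (inv a ⊗ u)) (δ u 0#)) ⟩
      ∑ (λ u → χ (inv a ⊗ u) * χ (inv a ⊗ u) + δ u 0# * (δ u 0# - (+ 2) * χ (inv a ⊗ u))) ≡⟨ ∑-+ (λ u → χ (inv a ⊗ u) * χ (inv a ⊗ u)) (λ u → δ u 0# * (δ u 0# - (+ 2) * χ (inv a ⊗ u))) ⟩
      ∑ (λ u → χ (inv a ⊗ u) * χ (inv a ⊗ u)) + ∑ (λ u → δ u 0# * (δ u 0# - (+ 2) * χ (inv a ⊗ u))) ≡⟨ cong₂ _+_ (∑-scale (inv-nonZero a≢0) (λ u → χ u * χ u)) (∑-δ (λ u → δ u 0# - (+ 2) * χ (inv a ⊗ u)) 0#) ⟩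
      ∑sq χ + (δ 0# 0# - (+ 2) * χ (inv a ⊗ 0#)) ≡⟨ cong₂ (λ d x → ∑sq χ + (d - (+ 2) * x)) (δ-refl 0#) (trans (cong χ (zeroʳ (inv a))) χ0≡0) ⟩
      ∑sq χ + 1ℤ ∎
      where
      open ≡-Reasoning
      split : ∀ x d → (x - d) * (x - d) ≡ x * x + d * (d - (+ 2) * x)
      split = solve-∀

  n : ℕ
  n = q ∸ 1

  q≡1+n : q ≡ suc n
  q≡1+n = sym (ℕ.m+[n∸m]≡n 1≤q)

  N-1≡n : N - 1ℤ ≡ + n
  N-1≡n = cong (λ z → + z - 1ℤ) q≡1+n

  1≤n : 1 ℕ.≤ n
  1≤n with n in eq
  ... | suc _ = ℕ.s≤s ℕ.z≤n
  ... | zero = ⊥-elim (0≢1 (toℕ-injective (trans (z 0#) (sym (z 1#)))))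
    where
    z : ∀ x → toℕ x ≡ 0
    z x = ℕ.n<1⇒n≡0 (subst (toℕ x ℕ.<_) (trans q≡1+n (cong suc eq)) (toℕ<n x))

  instance
    n≢0 : ℕ.NonZero n
    n≢0 = ℕ.>-nonZero 1≤n

  m′ : ℕ
  m′ = ∣ m ∣

  m-nonNeg : 0ℤ ≤ m
  m-nonNeg = ℤ.*-cancelˡ-≤-pos 0ℤ m (+ n) ⦃ ℤ.positive (ℤ.+<+ 1≤n) ⦄ (begin
    + n * 0ℤ ≡⟨ ℤ.*-zeroʳ (+ n) ⟩
    0ℤ ≤⟨ ∑sq-nonNeg χ ⟩
    ∑sq χ ≡⟨ ∑χ² ⟩
    (N - 1ℤ) * m ≡⟨ cong (_* m) N-1≡n ⟩
    + n * m ∎)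
    where open ≤-Reasoning

  ∑sqχ≡ : ∑sq χ ≡ + (n ℕ.* m′)
  ∑sqχ≡ = trans ∑χ² (trans (cong₂ _*_ N-1≡n (sym (ℤ.0≤i⇒+∣i∣≡i m-nonNeg))) (sym (ℤ.pos-* n m′)))

  ∣mixing∣ : ∀ f b → (n ℕ.* ∣ pairing f b ∣) ℕ.* (n ℕ.* ∣ pairing f b ∣) ℕ.≤ (n ℕ.* m′) ℕ.* (∣ ∑sq f ∣ ℕ.* ((n ℕ.* m′) ℕ.* (q ℕ.* ∣ ∑sq b ∣)))
  ∣mixing∣ f b = subst₂ ℕ._≤_ lhs rhs (abs-mono (sq-nonNeg T) (mixing f b))
    where
    T = (N - 1ℤ) * pairing f b
    ∣T∣ : ∣ T ∣ ≡ n ℕ.* ∣ pairing f b ∣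
    ∣T∣ = trans (ℤ.abs-* (N - 1ℤ) (pairing f b)) (cong (λ z → ∣ z ∣ ℕ.* ∣ pairing f b ∣) N-1≡n)
    lhs : ∣ T * T ∣ ≡ (n ℕ.* ∣ pairing f b ∣) ℕ.* (n ℕ.* ∣ pairing f b ∣)
    lhs = trans (ℤ.abs-* T T) (cong₂ ℕ._*_ ∣T∣ ∣T∣)
    X = ∑sq χ
    rhs : ∣ X * (∑sq f * (X * (N * ∑sq b))) ∣ ≡ (n ℕ.* m′) ℕ.* (∣ ∑sq f ∣ ℕ.* ((n ℕ.* m′) ℕ.* (q ℕ.* ∣ ∑sq b ∣)))
    rhs = trans (ℤ.abs-* X (∑sq f * (X * (N * ∑sq b)))) (cong₂ ℕ._*_ (cong ∣_∣ ∑sqχ≡)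
      (trans (ℤ.abs-* (∑sq f) (X * (N * ∑sq b))) (cong (∣ ∑sq f ∣ ℕ.*_)
      (trans (ℤ.abs-* X (N * ∑sq b)) (cong₂ ℕ._*_ (cong ∣_∣ ∑sqχ≡) (ℤ.abs-* N (∑sq b)))))))

  conv-bound : ∀ f → Invariant f → ∀ {a} → a ≢ 0# → (n ℕ.* (n ℕ.* ∣ conv χ f a ∣)) ℕ.* (n ℕ.* (n ℕ.* ∣ conv χ f a ∣)) ℕ.≤ (n ℕ.* m′) ℕ.* (∣ ∑sq f ∣ ℕ.* ((n ℕ.* m′) ℕ.* (q ℕ.* (n ℕ.* m′ ℕ.+ 1))))
  conv-bound f f-inv {a} a≢0 = subst₂ (λ u v → (n ℕ.* u) ℕ.* (n ℕ.* u) ℕ.≤ (n ℕ.* m′) ℕ.* (∣ ∑sq f ∣ ℕ.* ((n ℕ.* m′) ℕ.* (q ℕ.* v)))) p≡ t≡ (∣mixing∣ f (test f f-inv a≢0))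
    where
    p≡ : ∣ pairing f (test f f-inv a≢0) ∣ ≡ n ℕ.* ∣ conv χ f a ∣
    p≡ = trans (cong ∣_∣ (pairing-test f f-inv a≢0)) (trans (ℤ.abs-* (N - 1ℤ) (conv χ f a)) (cong (λ z → ∣ z ∣ ℕ.* ∣ conv χ f a ∣) N-1≡n))
    t≡ : ∣ ∑sq (test f f-inv a≢0) ∣ ≡ n ℕ.* m′ ℕ.+ 1
    t≡ = cong ∣_∣ (trans (∑sq-test f f-inv a≢0) (cong (_+ 1ℤ) ∑sqχ≡))

  energy : ∣ ∑sq (conv χ χ) ∣ ℕ.≤ n ℕ.* (m′ ℕ.^ 3 ℕ.* q)
  energy = energy-bound n q m′ e (subst (λ z → (n ℕ.* e) ℕ.* (n ℕ.* e) ℕ.≤ (n ℕ.* m′) ℕ.* (z ℕ.* ((n ℕ.* m′) ℕ.* (q ℕ.* e)))) (cong ∣_∣ ∑sqχ≡) (∣mixing∣ χ (conv χ χ)))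
    where e = ∣ ∑sq (conv χ χ) ∣

  conv-χ : ∀ g u → conv χ g u ≡ ∑ (λ y → g (u ⊕ ⊖ (y ^ k))) - ∑ g
  conv-χ g u = trans (∑-χ-* (λ x → g (u ⊕ ⊖ x))) (cong (λ z → ∑ (λ y → g (u ⊕ ⊖ (y ^ k))) - z) (∑-reindex g reflect reflect involutive involutive))
    where
    reflect : Fin q → Fin q
    reflect x = u ⊕ ⊖ x
    involutive : ∀ x → u ⊕ ⊖ (u ⊕ ⊖ x) ≡ x
    involutive x = solve 2 (λ u x → u :+ :- (u :+ :- x) := x) refl u x

  -- The shape `- (+ c)` is reproduced with `q c` in place of `c`, so the lemma can be iterated:
  -- `c = 1` serves two powers and `c = q` serves three.
  conv-χ-const : ∀ g → ∑ g ≡ 0ℤ → ∀ u c → (∀ y → g (u ⊕ ⊖ (y ^ k)) ≡ - (+ c)) → conv χ g u ≡ - (+ (q ℕ.* c))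
  conv-χ-const g ∑g≡0 u c const = begin
    conv χ g u ≡⟨ conv-χ g u ⟩
    ∑ (λ y → g (u ⊕ ⊖ (y ^ k))) - ∑ g ≡⟨ cong₂ _-_ (trans (∑-cong const) (∑-const q (- (+ c)))) ∑g≡0 ⟩
    N * - (+ c) - 0ℤ ≡⟨ ℤ.+-identityʳ (N * - (+ c)) ⟩
    N * - (+ c) ≡⟨ ℤ.neg-distribʳ-* N (+ c) ⟨
    - (N * + c) ≡⟨ cong -_ (sym (ℤ.pos-* q c)) ⟩
    - (+ (q ℕ.* c)) ∎
    where open ≡-Reasoning

  χ-nonPower : ∀ {z} → (∀ y → z ≢ y ^ k) → χ z ≡ - (+ 1)
  χ-nonPower z≢ = cong (_- 1ℤ) (∑-zero _ (λ y → δ-≢ (z≢ y)))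

  χχ-nonSum : ∀ {u} → (∀ x y → u ≢ x ^ k ⊕ y ^ k) → conv χ χ u ≡ - (+ q)
  χχ-nonSum {u} u≢ = trans (conv-χ-const χ ∑χ≡0 u 1 (λ x → χ-nonPower (λ y eq → u≢ y x (trans (sym (⊖-cancelʳ u (x ^ k))) (cong (_⊕ x ^ k) eq))))) (cong (λ z → - (+ z)) (ℕ.*-identityʳ q))

  χχχ-nonSum : ∀ {u} → (∀ x y z → u ≢ x ^ k ⊕ y ^ k ⊕ z ^ k) → conv χ (conv χ χ) u ≡ - (+ (q ℕ.* q))
  χχχ-nonSum {u} u≢ = conv-χ-const (conv χ χ) (trans (∑-of-conv χ χ) (cong₂ _*_ ∑χ≡0 ∑χ≡0)) u q (λ z → χχ-nonSum (λ x y eq → u≢ x y z (trans (sym (⊖-cancelʳ u (z ^ k))) (cong (_⊕ z ^ k) eq))))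

  d : ℕ
  d = gcd k n

  1≤d : 1 ℕ.≤ d
  1≤d = ℕ.n≢0⇒n>0 (gcd[m,n]≢0 k n (inj₂ (ℕ.≢-nonZero⁻¹ n)))

  -- The k-th roots of unity of the field are d-th roots of unity, hence roots of a polynomial of
  -- degree `d`.
  κ1≤d : κ 1# ≤ + d
  κ1≤d = ℤ.≤-trans (∑-mono _ _ pointwise) (#roots-of-unity d 1≤d)
    where
    pointwise : ∀ y → δ 1# (y ^ k) ≤ δ (y ^ d) 1#
    pointwise y with 1# ≟ y ^ k
    ... | yes eq = ℤ.≤-reflexive (trans (trans (cong (δ 1#) (sym eq)) (δ-refl 1#)) (sym (trans (cong (λ z → δ z 1#) (^≡1⇒^gcd≡1 1≤k (sym eq))) (δ-refl 1#))))
    ... | no neq = ℤ.≤-trans (ℤ.≤-reflexive (δ-≢ neq)) (δ-nonNeg (y ^ d) 1#)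

  m′≤d-1 : m′ ℕ.≤ d ∸ 1
  m′≤d-1 = ℤ.drop‿+≤+ (begin
    + m′ ≡⟨ ℤ.0≤i⇒+∣i∣≡i m-nonNeg ⟩
    κ 1# - 1ℤ ≤⟨ ℤ.+-monoˡ-≤ (- 1ℤ) κ1≤d ⟩
    + d - 1ℤ ≡⟨ cong (λ z → + z - 1ℤ) (sym (ℕ.m+[n∸m]≡n 1≤d)) ⟩
    + (d ∸ 1) ∎)
    where open ≤-Reasoning

  m′<n : suc m′ ℕ.≤ n
  m′<n = ℕ.≤-trans (ℕ.s≤s m′≤d-1) (subst (ℕ._≤ n) (sym (ℕ.m+[n∸m]≡n 1≤d)) (gcd[m,n]≤n k n))

  <q⇒≤n : ∀ {x} → x ℕ.< q → x ℕ.≤ n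
  <q⇒≤n x<q = ℕ.≤-pred (subst (_ ℕ.<_) q≡1+n x<q)

  sum-of-two-powers : (d ∸ 1) ℕ.^ 4 ℕ.< q → ∀ a → ∃ λ x → ∃ λ y → a ≡ x ^ k ⊕ y ^ k
  sum-of-two-powers bound a with any? (λ x → any? (λ y → a ≟ x ^ k ⊕ y ^ k))
  ... | yes found = found
  ... | no ¬sum = ⊥-elim (two-power-bound n q m′ q≡1+n m′<n (ℕ.≤-trans (ℕ.^-monoˡ-≤ 4 m′≤d-1) (<q⇒≤n bound))
    (subst₂ (λ u v → (n ℕ.* (n ℕ.* u)) ℕ.* (n ℕ.* (n ℕ.* u)) ℕ.≤ (n ℕ.* m′) ℕ.* (v ℕ.* ((n ℕ.* m′) ℕ.* (q ℕ.* (n ℕ.* m′ ℕ.+ 1)))))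
      (trans (cong ∣_∣ (χχ-nonSum (λ x y eq → ¬sum (x , y , eq)))) (ℤ.∣-i∣≡∣i∣ (+ q))) (cong ∣_∣ ∑sqχ≡) (conv-bound χ χ-invariant a≢0)))
    where
    -- The test function is rescaled by `inv a`, so 0 has to be treated apart; it is a sum of two
    -- zeros.
    a≢0 : a ≢ 0#
    a≢0 refl = ¬sum (0# , 0# , sym (trans (cong₂ _⊕_ (0^ 1≤k) (0^ 1≤k)) (+-identityˡ 0#)))

  sum-of-three-powers : (d ∸ 1) ℕ.^ 3 ℕ.< q → ∀ {a} → a ≢ 0# → ∃ λ x → ∃ λ y → ∃ λ z → a ≡ x ^ k ⊕ y ^ k ⊕ z ^ k
  sum-of-three-powers bound {a} a≢0 with any? (λ x → any? (λ y → any? (λ z → a ≟ x ^ k ⊕ y ^ k ⊕ z ^ k)))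
  ... | yes found = found
  ... | no ¬sum = ⊥-elim (three-power-bound n q m′ ∣ ∑sq (conv χ χ) ∣ q≡1+n 1≤n (ℕ.≤-trans (ℕ.^-monoˡ-≤ 3 m′≤d-1) (<q⇒≤n bound)) energy
    (subst (λ u → (n ℕ.* (n ℕ.* u)) ℕ.* (n ℕ.* (n ℕ.* u)) ℕ.≤ (n ℕ.* m′) ℕ.* (∣ ∑sq (conv χ χ) ∣ ℕ.* ((n ℕ.* m′) ℕ.* (q ℕ.* (n ℕ.* m′ ℕ.+ 1)))))
      (trans (cong ∣_∣ (χχχ-nonSum (λ x y z eq → ¬sum (x , y , z , eq)))) (ℤ.∣-i∣≡∣i∣ (+ (q ℕ.* q)))) (conv-bound (conv χ χ) (conv-invariant χ-invariant χ-invariant) a≢0)))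

-- Matrices over F and conjugation by transvections.

toFiniteField : ∀ {q} → Field q → FiniteField 0ℓ 0ℓ q
toFiniteField F = record
  { commRing = commutativeRing ; 0≉1 = 0≢1 ; inverse = inverse
  ; toFin = id ; fromFin = id ; toFin-cong = id ; from∘to = λ _ → refl ; to∘from = λ _ → refl }
  where open Field F

module MatrixAlgebra {q} (F : Field q) where

  open Field F
  open FieldProperties F
  open Matrices (toFiniteField F) public
  open ≡-Reasoning

  -- Entries of the identity matrix that reduce on constructors, which `identity`, defined through
  -- `_≟_`, does not do for variable indices under `suc`.
  Δ : ∀ {n} → Fin n → Fin n → Fin q
  Δ zero zero = 1#
  Δ zero (suc _) = 0#
  Δ (suc _) zero = 0#
  Δ (suc i) (suc j) = Δ i j

  Δ-refl : ∀ {n} (i : Fin n) → Δ i i ≡ 1#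
  Δ-refl zero = refl
  Δ-refl (suc i) = Δ-refl i

  Δ-≢ : ∀ {n} {i j : Fin n} → i ≢ j → Δ i j ≡ 0#
  Δ-≢ {i = zero} {zero} i≢j = ⊥-elim (i≢j refl)
  Δ-≢ {i = zero} {suc j} i≢j = refl
  Δ-≢ {i = suc i} {zero} i≢j = refl
  Δ-≢ {i = suc i} {suc j} i≢j = Δ-≢ (i≢j ∘ cong suc)

  Δ-sym : ∀ {n} (i j : Fin n) → Δ i j ≡ Δ j i
  Δ-sym zero zero = refl
  Δ-sym zero (suc j) = refl
  Δ-sym (suc i) zero = refl
  Δ-sym (suc i) (suc j) = Δ-sym i j

  identity≡Δ : ∀ {n} (i j : Fin n) → identity i j ≡ Δ i j
  identity≡Δ i j with i ≟ j
  ... | yes refl = sym (Δ-refl i)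
  ... | no i≢j = sym (Δ-≢ i≢j)

  Σ#-Δ : ∀ {n} (j : Fin n) (f : Fin n → Fin q) → Σ# (λ t → Δ t j ⊗ f t) ≡ f j
  Σ#-Δ zero f = trans (cong₂ _⊕_ (*-identityˡ (f zero)) (Σ#-zero _ (λ t → zeroˡ (f (suc t))))) (+-identityʳ (f zero))
  Σ#-Δ (suc j) f = trans (cong₂ _⊕_ (zeroˡ (f zero)) (Σ#-Δ j (f ∘ suc))) (+-identityˡ (f (suc j)))

  ≈ₘ-sym : ∀ {n} {A B : Mat n} → A ≈ₘ B → B ≈ₘ A
  ≈ₘ-sym A≈B i j = sym (A≈B i j)

  ≈ₘ-trans : ∀ {n} {A B C : Mat n} → A ≈ₘ B → B ≈ₘ C → A ≈ₘ C
  ≈ₘ-trans A≈B B≈C i j = trans (A≈B i j) (B≈C i j)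

  *ₘ-cong : ∀ {n} {A A′ B B′ : Mat n} → A ≈ₘ A′ → B ≈ₘ B′ → (A *ₘ B) ≈ₘ (A′ *ₘ B′)
  *ₘ-cong A≈A′ B≈B′ i j = Σ#-cong (λ t → cong₂ _⊗_ (A≈A′ i t) (B≈B′ t j))

  SumOfPowers : ∀ {n} → ℕ → Mat n → Set
  SumOfPowers {n} k M = ∃[ A ] ∃[ B ] (M ≈ₘ ((A ^ₘ k) +ₘ (B ^ₘ k)))

  -- conj i j c M = (1 + c Eᵢⱼ) M (1 - c Eᵢⱼ)
  addRow subCol conj : ∀ {n} → Fin n → Fin n → Fin q → Mat n → Mat n
  addRow i j c M a b = M a b ⊕ Δ a i ⊗ (c ⊗ M j b)
  subCol i j c M a b = M a b ⊕ ⊖ (Δ b j ⊗ (c ⊗ M a i))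
  conj i j c M = subCol i j c (addRow i j c M)

  addRow-cong : ∀ {n} i j c {A B : Mat n} → A ≈ₘ B → addRow i j c A ≈ₘ addRow i j c B
  addRow-cong i j c A≈B a b = cong₂ (λ u v → u ⊕ Δ a i ⊗ (c ⊗ v)) (A≈B a b) (A≈B j b)

  subCol-cong : ∀ {n} i j c {A B : Mat n} → A ≈ₘ B → subCol i j c A ≈ₘ subCol i j c B
  subCol-cong i j c A≈B a b = cong₂ (λ u v → u ⊕ ⊖ (Δ b j ⊗ (c ⊗ v))) (A≈B a b) (A≈B a i)

  conj-cong : ∀ {n} i j c {A B : Mat n} → A ≈ₘ B → conj i j c A ≈ₘ conj i j c B
  conj-cong i j c A≈B = subCol-cong i j c (addRow-cong i j c A≈B)

  addRow-*ₘ : ∀ {n} i j c (A B : Mat n) → (addRow i j c A *ₘ B) ≈ₘ addRow i j c (A *ₘ B)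
  addRow-*ₘ i j c A B a b = begin
    Σ# (λ t → (A a t ⊕ Δ a i ⊗ (c ⊗ A j t)) ⊗ B t b) ≡⟨ Σ#-cong (λ t → lem (A a t) (Δ a i) c (A j t) (B t b)) ⟩
    Σ# (λ t → A a t ⊗ B t b ⊕ (Δ a i ⊗ c) ⊗ (A j t ⊗ B t b)) ≡⟨ Σ#-⊕ (λ t → A a t ⊗ B t b) (λ t → (Δ a i ⊗ c) ⊗ (A j t ⊗ B t b)) ⟩
    (A *ₘ B) a b ⊕ Σ# (λ t → (Δ a i ⊗ c) ⊗ (A j t ⊗ B t b)) ≡⟨ cong ((A *ₘ B) a b ⊕_) (sym (⊗-Σ# (Δ a i ⊗ c) (λ t → A j t ⊗ B t b))) ⟩
    (A *ₘ B) a b ⊕ (Δ a i ⊗ c) ⊗ (A *ₘ B) j b ≡⟨ cong ((A *ₘ B) a b ⊕_) (*-assoc (Δ a i) c ((A *ₘ B) j b)) ⟩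
    addRow i j c (A *ₘ B) a b ∎
    where
    lem : ∀ x d c y z → (x ⊕ d ⊗ (c ⊗ y)) ⊗ z ≡ x ⊗ z ⊕ (d ⊗ c) ⊗ (y ⊗ z)
    lem = solve 5 (λ x d c y z → (x :+ d :* (c :* y)) :* z := x :* z :+ (d :* c) :* (y :* z)) refl

  *ₘ-subCol : ∀ {n} i j c (A B : Mat n) → (A *ₘ subCol i j c B) ≈ₘ subCol i j c (A *ₘ B)
  *ₘ-subCol i j c A B a b = begin
    Σ# (λ t → A a t ⊗ (B t b ⊕ ⊖ (Δ b j ⊗ (c ⊗ B t i)))) ≡⟨ Σ#-cong (λ t → lem (A a t) (Δ b j) c (B t b) (B t i)) ⟩
    Σ# (λ t → A a t ⊗ B t b ⊕ (⊖ (Δ b j ⊗ c)) ⊗ (A a t ⊗ B t i)) ≡⟨ Σ#-⊕ (λ t → A a t ⊗ B t b) (λ t → (⊖ (Δ b j ⊗ c)) ⊗ (A a t ⊗ B t i)) ⟩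
    (A *ₘ B) a b ⊕ Σ# (λ t → (⊖ (Δ b j ⊗ c)) ⊗ (A a t ⊗ B t i)) ≡⟨ cong ((A *ₘ B) a b ⊕_) (sym (⊗-Σ# (⊖ (Δ b j ⊗ c)) (λ t → A a t ⊗ B t i))) ⟩
    (A *ₘ B) a b ⊕ (⊖ (Δ b j ⊗ c)) ⊗ (A *ₘ B) a i ≡⟨ lem′ ((A *ₘ B) a b) (Δ b j) c ((A *ₘ B) a i) ⟩
    subCol i j c (A *ₘ B) a b ∎
    where
    lem : ∀ x d c y z → x ⊗ (y ⊕ ⊖ (d ⊗ (c ⊗ z))) ≡ x ⊗ y ⊕ (⊖ (d ⊗ c)) ⊗ (x ⊗ z)
    lem = solve 5 (λ x d c y z → x :* (y :+ :- (d :* (c :* z))) := x :* y :+ (:- (d :* c)) :* (x :* z)) refl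
    lem′ : ∀ x d c y → x ⊕ (⊖ (d ⊗ c)) ⊗ y ≡ x ⊕ ⊖ (d ⊗ (c ⊗ y))
    lem′ = solve 4 (λ x d c y → x :+ (:- (d :* c)) :* y := x :+ :- (d :* (c :* y))) refl

  -- The two inner factors are `1 - c Eᵢⱼ` and `1 + c Eᵢⱼ`, and they cancel because `Eᵢⱼ² = 0` for
  -- `i ≢ j`. This makes `conj` multiplicative.
  subCol-*ₘ-addRow : ∀ {n} {i j : Fin n} → i ≢ j → ∀ c (A B : Mat n) → (subCol i j c A *ₘ addRow i j c B) ≈ₘ (A *ₘ B)
  subCol-*ₘ-addRow {n} {i} {j} i≢j c A B a b = begin
    Σ# (λ t → (A a t ⊕ ⊖ (Δ t j ⊗ (c ⊗ A a i))) ⊗ (B t b ⊕ Δ t i ⊗ (c ⊗ B j b))) ≡⟨ Σ#-cong (λ t → lem (A a t) (Δ t j) c (A a i) (B t b) (Δ t i) (B j b)) ⟩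
    Σ# (λ t → A a t ⊗ B t b ⊕ (Δ t i ⊗ (A a t ⊗ (c ⊗ B j b)) ⊕ Δ t j ⊗ (⊖ (c ⊗ A a i ⊗ (B t b ⊕ Δ t i ⊗ (c ⊗ B j b)))))) ≡⟨ Σ#-⊕ (λ t → A a t ⊗ B t b) (λ t → Δ t i ⊗ (A a t ⊗ (c ⊗ B j b)) ⊕ Δ t j ⊗ (⊖ (c ⊗ A a i ⊗ (B t b ⊕ Δ t i ⊗ (c ⊗ B j b))))) ⟩
    (A *ₘ B) a b ⊕ Σ# (λ t → Δ t i ⊗ (A a t ⊗ (c ⊗ B j b)) ⊕ Δ t j ⊗ (⊖ (c ⊗ A a i ⊗ (B t b ⊕ Δ t i ⊗ (c ⊗ B j b))))) ≡⟨ cong ((A *ₘ B) a b ⊕_) (trans (Σ#-⊕ (λ t → Δ t i ⊗ (A a t ⊗ (c ⊗ B j b))) (λ t → Δ t j ⊗ (⊖ (c ⊗ A a i ⊗ (B t b ⊕ Δ t i ⊗ (c ⊗ B j b)))))) (cong₂ _⊕_ (Σ#-Δ i (λ t → A a t ⊗ (c ⊗ B j b))) (Σ#-Δ j (λ t → ⊖ (c ⊗ A a i ⊗ (B t b ⊕ Δ t i ⊗ (c ⊗ B j b))))))) ⟩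
    (A *ₘ B) a b ⊕ (A a i ⊗ (c ⊗ B j b) ⊕ ⊖ (c ⊗ A a i ⊗ (B j b ⊕ Δ j i ⊗ (c ⊗ B j b)))) ≡⟨ cong (λ d → (A *ₘ B) a b ⊕ (A a i ⊗ (c ⊗ B j b) ⊕ ⊖ (c ⊗ A a i ⊗ (B j b ⊕ d ⊗ (c ⊗ B j b))))) (Δ-≢ (i≢j ∘ sym)) ⟩
    (A *ₘ B) a b ⊕ (A a i ⊗ (c ⊗ B j b) ⊕ ⊖ (c ⊗ A a i ⊗ (B j b ⊕ 0# ⊗ (c ⊗ B j b)))) ≡⟨ lem′ ((A *ₘ B) a b) (A a i) c (B j b) ⟩
    (A *ₘ B) a b ∎
    where
    lem : ∀ x d c y z e w → (x ⊕ ⊖ (d ⊗ (c ⊗ y))) ⊗ (z ⊕ e ⊗ (c ⊗ w)) ≡ x ⊗ z ⊕ (e ⊗ (x ⊗ (c ⊗ w)) ⊕ d ⊗ (⊖ (c ⊗ y ⊗ (z ⊕ e ⊗ (c ⊗ w)))))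
    lem = solve 7 (λ x d c y z e w → (x :+ :- (d :* (c :* y))) :* (z :+ e :* (c :* w)) := x :* z :+ (e :* (x :* (c :* w)) :+ d :* (:- (c :* y :* (z :+ e :* (c :* w)))))) refl
    lem′ : ∀ s x c y → s ⊕ (x ⊗ (c ⊗ y) ⊕ ⊖ (c ⊗ x ⊗ (y ⊕ 0# ⊗ (c ⊗ y)))) ≡ s
    lem′ = solve 4 (λ s x c y → s :+ (x :* (c :* y) :+ :- (c :* x :* (y :+ con 0ℤ :* (c :* y)))) := s) refl

  conj-*ₘ : ∀ {n} {i j : Fin n} → i ≢ j → ∀ c (A B : Mat n) → (conj i j c A *ₘ conj i j c B) ≈ₘ conj i j c (A *ₘ B)
  conj-*ₘ {i = i} {j} i≢j c A B = ≈ₘ-trans (*ₘ-subCol i j c (conj i j c A) (addRow i j c B))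
    (subCol-cong i j c (≈ₘ-trans (subCol-*ₘ-addRow i≢j c (addRow i j c A) B) (addRow-*ₘ i j c A B)))

  conj-identity : ∀ {n} {i j : Fin n} → i ≢ j → ∀ c → conj i j c identity ≈ₘ identity
  conj-identity {n} {i} {j} i≢j c a b = begin
    conj i j c identity a b ≡⟨ conj-cong i j c identity≡Δ a b ⟩
    (Δ a b ⊕ Δ a i ⊗ (c ⊗ Δ j b)) ⊕ ⊖ (Δ b j ⊗ (c ⊗ (Δ a i ⊕ Δ a i ⊗ (c ⊗ Δ j i)))) ≡⟨ cong₂ (λ u v → (Δ a b ⊕ Δ a i ⊗ (c ⊗ u)) ⊕ ⊖ (Δ b j ⊗ (c ⊗ (Δ a i ⊕ Δ a i ⊗ (c ⊗ v))))) (Δ-sym j b) (Δ-≢ (i≢j ∘ sym)) ⟩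
    (Δ a b ⊕ Δ a i ⊗ (c ⊗ Δ b j)) ⊕ ⊖ (Δ b j ⊗ (c ⊗ (Δ a i ⊕ Δ a i ⊗ (c ⊗ 0#)))) ≡⟨ lem (Δ a b) (Δ a i) c (Δ b j) ⟩
    Δ a b ≡⟨ identity≡Δ a b ⟨
    identity a b ∎
    where
    lem : ∀ x y c z → (x ⊕ y ⊗ (c ⊗ z)) ⊕ ⊖ (z ⊗ (c ⊗ (y ⊕ y ⊗ (c ⊗ 0#)))) ≡ x
    lem = solve 4 (λ x y c z → (x :+ y :* (c :* z)) :+ :- (z :* (c :* (y :+ y :* (c :* con 0ℤ)))) := x) refl

  conj-^ₘ : ∀ {n} {i j : Fin n} → i ≢ j → ∀ c (A : Mat n) k → (conj i j c A ^ₘ k) ≈ₘ conj i j c (A ^ₘ k)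
  conj-^ₘ i≢j c A zero = ≈ₘ-sym (conj-identity i≢j c)
  conj-^ₘ {i = i} {j} i≢j c A (suc k) = ≈ₘ-trans (*ₘ-cong (λ _ _ → refl) (conj-^ₘ i≢j c A k)) (conj-*ₘ i≢j c A (A ^ₘ k))

  conj-+ₘ : ∀ {n} i j c (A B : Mat n) → conj i j c (A +ₘ B) ≈ₘ (conj i j c A +ₘ conj i j c B)
  conj-+ₘ i j c A B a b = lem (A a b) (B a b) (Δ a i) c (A j b) (B j b) (Δ b j) (A a i) (B a i) (A j i) (B j i)
    where
    lem : ∀ x y d c u v e s t p r → ((x ⊕ y) ⊕ d ⊗ (c ⊗ (u ⊕ v))) ⊕ ⊖ (e ⊗ (c ⊗ ((s ⊕ t) ⊕ d ⊗ (c ⊗ (p ⊕ r))))) ≡ ((x ⊕ d ⊗ (c ⊗ u)) ⊕ ⊖ (e ⊗ (c ⊗ (s ⊕ d ⊗ (c ⊗ p))))) ⊕ ((y ⊕ d ⊗ (c ⊗ v)) ⊕ ⊖ (e ⊗ (c ⊗ (t ⊕ d ⊗ (c ⊗ r)))))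
    lem = solve 11 (λ x y d c u v e s t p r → ((x :+ y) :+ d :* (c :* (u :+ v))) :+ :- (e :* (c :* ((s :+ t) :+ d :* (c :* (p :+ r))))) := ((x :+ d :* (c :* u)) :+ :- (e :* (c :* (s :+ d :* (c :* p))))) :+ ((y :+ d :* (c :* v)) :+ :- (e :* (c :* (t :+ d :* (c :* r)))))) refl

  conj-inverse : ∀ {n} {i j : Fin n} → i ≢ j → ∀ c (M : Mat n) → conj i j (⊖ c) (conj i j c M) ≈ₘ M
  conj-inverse {n} {i} {j} i≢j c M a b = begin
    conj i j (⊖ c) (conj i j c M) a b ≡⟨ cong₂ (λ d e → body (Δ a i) d (Δ b j) e) (Δ-≢ {i = j} {i} (i≢j ∘ sym)) (Δ-≢ i≢j) ⟩
    body (Δ a i) 0# (Δ b j) 0# ≡⟨ lem (M a b) (Δ a i) c (M j b) (Δ b j) (M a i) (M j i) ⟩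
    M a b ∎
    where
    -- The doubly conjugated entry with its Kronecker symbols as variables. Only `ji` and `ij` have
    -- to be known, both being 0 as `i ≢ j`; the identity then holds for arbitrary values of the
    -- other two, so no case distinction on `a` and `b` is needed.
    body : (ai ji bj ij : Fin q) → Fin q
    body ai ji bj ij = (N a b ai bj ⊕ ai ⊗ (⊖ c ⊗ N j b ji bj)) ⊕ ⊖ (bj ⊗ (⊖ c ⊗ (N a i ai ij ⊕ ai ⊗ (⊖ c ⊗ N j i ji ij))))
      where
      N : (u v : Fin n) (ui vj : Fin q) → Fin q
      N u v ui vj = (M u v ⊕ ui ⊗ (c ⊗ M j v)) ⊕ ⊖ (vj ⊗ (c ⊗ (M u i ⊕ ui ⊗ (c ⊗ M j i))))
    lem : ∀ x d c u e s p →
      (((x ⊕ d ⊗ (c ⊗ u)) ⊕ ⊖ (e ⊗ (c ⊗ (s ⊕ d ⊗ (c ⊗ p))))) ⊕ d ⊗ (⊖ c ⊗ ((u ⊕ 0# ⊗ (c ⊗ u)) ⊕ ⊖ (e ⊗ (c ⊗ (p ⊕ 0# ⊗ (c ⊗ p))))))) ⊕ ⊖ (e ⊗ (⊖ c ⊗ (((s ⊕ d ⊗ (c ⊗ p)) ⊕ ⊖ (0# ⊗ (c ⊗ (s ⊕ d ⊗ (c ⊗ p))))) ⊕ d ⊗ (⊖ c ⊗ ((p ⊕ 0# ⊗ (c ⊗ p)) ⊕ ⊖ (0# ⊗ (c ⊗ (p ⊕ 0# ⊗ (c ⊗ p)))))))))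
      ≡ x
    lem = solve 7 (λ x d c u e s p →
      (((x :+ d :* (c :* u)) :+ :- (e :* (c :* (s :+ d :* (c :* p))))) :+ d :* (:- c :* ((u :+ con 0ℤ :* (c :* u)) :+ :- (e :* (c :* (p :+ con 0ℤ :* (c :* p))))))) :+ :- (e :* (:- c :* (((s :+ d :* (c :* p)) :+ :- (con 0ℤ :* (c :* (s :+ d :* (c :* p))))) :+ d :* (:- c :* ((p :+ con 0ℤ :* (c :* p)) :+ :- (con 0ℤ :* (c :* (p :+ con 0ℤ :* (c :* p)))))))))
      := x) refl

  SumOfPowers-conj : ∀ {n k} {i j : Fin n} → i ≢ j → ∀ c (M : Mat n) → SumOfPowers k (conj i j c M) → SumOfPowers k M
  SumOfPowers-conj {k = k} {i} {j} i≢j c M (A , B , eq) = conj i j (⊖ c) A , conj i j (⊖ c) B , λ a b → begin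
    M a b ≡⟨ conj-inverse i≢j c M a b ⟨
    conj i j (⊖ c) (conj i j c M) a b ≡⟨ conj-cong i j (⊖ c) eq a b ⟩
    conj i j (⊖ c) ((A ^ₘ k) +ₘ (B ^ₘ k)) a b ≡⟨ conj-+ₘ i j (⊖ c) (A ^ₘ k) (B ^ₘ k) a b ⟩
    conj i j (⊖ c) (A ^ₘ k) a b ⊕ conj i j (⊖ c) (B ^ₘ k) a b ≡⟨ cong₂ _⊕_ (sym (conj-^ₘ i≢j (⊖ c) A k a b)) (sym (conj-^ₘ i≢j (⊖ c) B k a b)) ⟩
    (conj i j (⊖ c) A ^ₘ k) a b ⊕ (conj i j (⊖ c) B ^ₘ k) a b ∎

-- Conjugating a non-scalar matrix to a prescribed diagonal.

module PrescribedDiagonal {q} (F : Field q) where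

  open Field F
  open FieldProperties F
  open MatrixAlgebra F
  open ≡-Reasoning

  Transvection : ℕ → Set
  Transvection n = Σ (Fin n × Fin n × Fin q) λ (i , j , _) → i ≢ j

  apply : ∀ {n} → List (Transvection n) → Mat n → Mat n
  apply [] M = M
  apply (((i , j , c) , _) ∷ ts) M = apply ts (conj i j c M)

  apply-++ : ∀ {n} (ts us : List (Transvection n)) M → apply (ts ++ us) M ≡ apply us (apply ts M)
  apply-++ [] us M = refl
  apply-++ (((i , j , c) , _) ∷ ts) us M = apply-++ ts us (conj i j c M)

  SumOfPowers-apply : ∀ {n k} (ts : List (Transvection n)) M → SumOfPowers k (apply ts M) → SumOfPowers k M
  SumOfPowers-apply [] M s = s
  SumOfPowers-apply {k = k} (((i , j , c) , i≢j) ∷ ts) M s = SumOfPowers-conj {k = k} i≢j c M (SumOfPowers-apply {k = k} ts (conj i j c M) s)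

  trace : ∀ {n} → Mat n → Fin q
  trace M = Σ# (λ a → M a a)

  trace-conj : ∀ {n} {i j : Fin n} → i ≢ j → ∀ c (M : Mat n) → trace (conj i j c M) ≡ trace M
  trace-conj {i = i} {j} i≢j c M = begin
    Σ# (λ a → (M a a ⊕ Δ a i ⊗ (c ⊗ M j a)) ⊕ ⊖ (Δ a j ⊗ (c ⊗ (M a i ⊕ Δ a i ⊗ (c ⊗ M j i))))) ≡⟨ Σ#-cong (λ a → lem (M a a) (Δ a i) (Δ a j) (c ⊗ M j a) (c ⊗ (M a i ⊕ Δ a i ⊗ (c ⊗ M j i)))) ⟩
    Σ# (λ a → M a a ⊕ (Δ a i ⊗ (c ⊗ M j a) ⊕ Δ a j ⊗ (⊖ (c ⊗ (M a i ⊕ Δ a i ⊗ (c ⊗ M j i)))))) ≡⟨ Σ#-⊕ (λ a → M a a) (λ a → Δ a i ⊗ (c ⊗ M j a) ⊕ Δ a j ⊗ (⊖ (c ⊗ (M a i ⊕ Δ a i ⊗ (c ⊗ M j i))))) ⟩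
    trace M ⊕ Σ# (λ a → Δ a i ⊗ (c ⊗ M j a) ⊕ Δ a j ⊗ (⊖ (c ⊗ (M a i ⊕ Δ a i ⊗ (c ⊗ M j i))))) ≡⟨ cong (trace M ⊕_) (trans (Σ#-⊕ (λ a → Δ a i ⊗ (c ⊗ M j a)) (λ a → Δ a j ⊗ (⊖ (c ⊗ (M a i ⊕ Δ a i ⊗ (c ⊗ M j i)))))) (cong₂ _⊕_ (Σ#-Δ i (λ a → c ⊗ M j a)) (Σ#-Δ j (λ a → ⊖ (c ⊗ (M a i ⊕ Δ a i ⊗ (c ⊗ M j i))))))) ⟩
    trace M ⊕ (c ⊗ M j i ⊕ ⊖ (c ⊗ (M j i ⊕ Δ j i ⊗ (c ⊗ M j i)))) ≡⟨ cong (λ d → trace M ⊕ (c ⊗ M j i ⊕ ⊖ (c ⊗ (M j i ⊕ d ⊗ (c ⊗ M j i))))) (Δ-≢ (i≢j ∘ sym)) ⟩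
    trace M ⊕ (c ⊗ M j i ⊕ ⊖ (c ⊗ (M j i ⊕ 0# ⊗ (c ⊗ M j i)))) ≡⟨ lem′ (trace M) c (M j i) ⟩
    trace M ∎
    where
    lem : ∀ x d e y z → (x ⊕ d ⊗ y) ⊕ ⊖ (e ⊗ z) ≡ x ⊕ (d ⊗ y ⊕ e ⊗ (⊖ z))
    lem = solve 5 (λ x d e y z → (x :+ d :* y) :+ :- (e :* z) := x :+ (d :* y :+ e :* (:- z))) refl
    lem′ : ∀ s c x → s ⊕ (c ⊗ x ⊕ ⊖ (c ⊗ (x ⊕ 0# ⊗ (c ⊗ x)))) ≡ s
    lem′ = solve 3 (λ s c x → s :+ (c :* x :+ :- (c :* (x :+ con 0ℤ :* (c :* x)))) := s) refl

  trace-apply : ∀ {n} (ts : List (Transvection n)) M → trace (apply ts M) ≡ trace M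
  trace-apply [] M = refl
  trace-apply (((i , j , c) , i≢j) ∷ ts) M = trans (trace-apply ts (conj i j c M)) (trace-conj i≢j c M)

  module Entries {n} (i j : Fin n) (c : Fin q) (M : Mat n) where

    fixed : ∀ {a b} → a ≢ i → b ≢ j → conj i j c M a b ≡ M a b
    fixed {a} {b} a≢i b≢j = trans (cong₂ (λ d e → (M a b ⊕ d ⊗ (c ⊗ M j b)) ⊕ ⊖ (e ⊗ (c ⊗ (M a i ⊕ d ⊗ (c ⊗ M j i))))) (Δ-≢ a≢i) (Δ-≢ b≢j))
      (solve 3 (λ x y z → (x :+ con 0ℤ :* y) :+ :- (con 0ℤ :* z) := x) refl (M a b) (c ⊗ M j b) (c ⊗ (M a i ⊕ 0# ⊗ (c ⊗ M j i))))

    inRow : ∀ {b} → b ≢ j → conj i j c M i b ≡ M i b ⊕ c ⊗ M j b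
    inRow {b} b≢j = trans (cong₂ (λ d e → (M i b ⊕ d ⊗ (c ⊗ M j b)) ⊕ ⊖ (e ⊗ (c ⊗ (M i i ⊕ d ⊗ (c ⊗ M j i))))) (Δ-refl i) (Δ-≢ b≢j))
      (solve 3 (λ x y z → (x :+ con 1ℤ :* y) :+ :- (con 0ℤ :* z) := x :+ y) refl (M i b) (c ⊗ M j b) (c ⊗ (M i i ⊕ 1# ⊗ (c ⊗ M j i))))

    inCol : ∀ {a} → a ≢ i → conj i j c M a j ≡ M a j ⊕ ⊖ (c ⊗ M a i)
    inCol {a} a≢i = trans (cong₂ (λ d e → (M a j ⊕ d ⊗ (c ⊗ M j j)) ⊕ ⊖ (e ⊗ (c ⊗ (M a i ⊕ d ⊗ (c ⊗ M j i))))) (Δ-≢ a≢i) (Δ-refl j))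
      (solve 5 (λ x y c z w → (x :+ con 0ℤ :* y) :+ :- (con 1ℤ :* (c :* (z :+ con 0ℤ :* w))) := x :+ :- (c :* z)) refl (M a j) (c ⊗ M j j) c (M a i) (c ⊗ M j i))

    corner : conj i j c M i j ≡ (M i j ⊕ c ⊗ M j j) ⊕ ⊖ (c ⊗ (M i i ⊕ c ⊗ M j i))
    corner = trans (cong₂ (λ d e → (M i j ⊕ d ⊗ (c ⊗ M j j)) ⊕ ⊖ (e ⊗ (c ⊗ (M i i ⊕ d ⊗ (c ⊗ M j i))))) (Δ-refl i) (Δ-refl j))
      (solve 5 (λ x y c z w → (x :+ con 1ℤ :* y) :+ :- (con 1ℤ :* (c :* (z :+ con 1ℤ :* w))) := (x :+ y) :+ :- (c :* (z :+ w))) refl (M i j) (c ⊗ M j j) c (M i i) (c ⊗ M j i))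

  minor : ∀ {n} → Mat (suc n) → Mat n
  minor M a b = M (suc a) (suc b)

  lift : ∀ {n} → Transvection n → Transvection (suc n)
  lift ((i , j , c) , i≢j) = (suc i , suc j , c) , i≢j ∘ suc-injective

  apply-lift-minor : ∀ {n} (ts : List (Transvection n)) M → minor (apply (map lift ts) M) ≡ apply ts (minor M)
  apply-lift-minor [] M = refl
  apply-lift-minor (((i , j , c) , _) ∷ ts) M = apply-lift-minor ts (conj (suc i) (suc j) c M)

  apply-lift-00 : ∀ {n} (ts : List (Transvection n)) M → apply (map lift ts) M zero zero ≡ M zero zero
  apply-lift-00 [] M = refl
  apply-lift-00 (((i , j , c) , _) ∷ ts) M = trans (apply-lift-00 ts (conj (suc i) (suc j) c M)) (Entries.fixed (suc i) (suc j) c M (λ ()) (λ ()))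

  -- The form of being non-scalar that can be handed on to the minor. Size 1 asks for nothing,
  -- because there the trace already determines the entry.
  Pivot : ∀ n → Mat (suc n) → Set
  Pivot zero M = ⊤
  Pivot (suc n) M = ∃ λ j → M (suc j) zero ≢ 0#

  solve-⊕ : ∀ {u} → u ≢ 0# → ∀ x y → x ⊕ ((y ⊕ ⊖ x) ⊗ inv u) ⊗ u ≡ y
  solve-⊕ {u} u≢0 x y = begin
    x ⊕ ((y ⊕ ⊖ x) ⊗ inv u) ⊗ u ≡⟨ cong (x ⊕_) (trans (*-assoc _ _ _) (cong ((y ⊕ ⊖ x) ⊗_) (inv-inverseˡ u≢0))) ⟩
    x ⊕ (y ⊕ ⊖ x) ⊗ 1# ≡⟨ solve 2 (λ x y → x :+ (y :+ :- x) :* con 1ℤ := y) refl x y ⟩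
    y ∎

  solve-⊖ : ∀ {u} → u ≢ 0# → ∀ x y → x ⊕ ⊖ (((x ⊕ ⊖ y) ⊗ inv u) ⊗ u) ≡ y
  solve-⊖ {u} u≢0 x y = begin
    x ⊕ ⊖ (((x ⊕ ⊖ y) ⊗ inv u) ⊗ u) ≡⟨ cong (λ z → x ⊕ ⊖ z) (trans (*-assoc _ _ _) (cong ((x ⊕ ⊖ y) ⊗_) (inv-inverseˡ u≢0))) ⟩
    x ⊕ ⊖ ((x ⊕ ⊖ y) ⊗ 1#) ≡⟨ solve 2 (λ x y → x :+ :- ((x :+ :- y) :* con 1ℤ) := y) refl x y ⟩
    y ∎

  1≢0 : 1# ≢ 0#
  1≢0 = 0≢1 ∘ sym

  Step : ∀ {n} → Mat (2 ℕ.+ n) → Fin q → Set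
  Step {n} M c₀ = ∃ λ ts → apply ts M zero zero ≡ c₀ × Pivot n (minor (apply ts M))

  prepend : ∀ {n} (t : Transvection (2 ℕ.+ n)) (M : Mat (2 ℕ.+ n)) {c₀} → Step (apply (t ∷ []) M) c₀ → Step M c₀
  prepend t M (ts , rest) = t ∷ ts , rest

  setCorner : ∀ {n} (M : Mat (suc n)) (j : Fin n) → M (suc j) zero ≢ 0# → ∀ c₀ → ∃ λ c → conj zero (suc j) c M zero zero ≡ c₀
  setCorner M j u≢0 c₀ = _ , trans (Entries.inRow zero (suc j) _ M (λ ())) (solve-⊕ u≢0 (M zero zero) c₀)

  -- The first transvection subtracts a multiple of column 0 from column 1 and so makes the entry in
  -- row `j + 2` of column 1 equal to 1: this is the pivot of the minor. The second changes only row
  -- 0 and column `j + 2`, so it can set the corner without touching that entry.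
  step-below : ∀ {n} (M : Mat (3 ℕ.+ n)) (j : Fin (suc n)) → M (suc (suc j)) zero ≢ 0# → ∀ c₀ → Step M c₀
  step-below M j u≢0 c₀ =
    ((zero , suc zero , c) , λ ()) ∷ ((zero , suc (suc j) , c′) , λ ()) ∷ []
    , corner , j , (λ eq → 1≢0 (trans (sym entry) eq))
    where
    u = M (suc (suc j)) zero
    c = (M (suc (suc j)) (suc zero) ⊕ ⊖ 1#) ⊗ inv u
    M₁ = conj zero (suc zero) c M
    u₁≢0 : M₁ (suc (suc j)) zero ≢ 0#
    u₁≢0 eq = u≢0 (trans (sym (Entries.fixed zero (suc zero) c M (λ ()) (λ ()))) eq)
    c′ = proj₁ (setCorner M₁ (suc j) u₁≢0 c₀)
    corner = proj₂ (setCorner M₁ (suc j) u₁≢0 c₀)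
    entry : conj zero (suc (suc j)) c′ M₁ (suc (suc j)) (suc zero) ≡ 1#
    entry = trans (Entries.fixed zero (suc (suc j)) c′ M₁ (λ ()) (λ ())) (trans (Entries.inCol zero (suc zero) c M (λ ())) (solve-⊖ u≢0 (M (suc (suc j)) (suc zero)) 1#))

  step : ∀ n (M : Mat (2 ℕ.+ n)) → Pivot (suc n) M → ∀ c₀ → Step M c₀
  step zero M (j , u≢0) c₀ = ((zero , suc j , proj₁ s) , λ ()) ∷ [] , proj₂ s , tt
    where s = setCorner M j u≢0 c₀
  step (suc n) M (suc j , u≢0) c₀ = step-below M j u≢0 c₀
  -- A pivot in row 1 lies beside the corner of the minor, not below it. Adding a multiple of row 1
  -- to row 2 first creates a pivot in row 2.
  step (suc n) M (zero , u≢0) c₀ = prepend t M (step-below M₁ zero (λ eq → 1≢0 (trans (sym entry) eq)) c₀)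
    where
    c = (1# ⊕ ⊖ M (suc (suc zero)) zero) ⊗ inv (M (suc zero) zero)
    t : Transvection (3 ℕ.+ n)
    t = (suc (suc zero) , suc zero , c) , λ ()
    M₁ = apply (t ∷ []) M
    entry : M₁ (suc (suc zero)) zero ≡ 1#
    entry = trans (Entries.inRow (suc (suc zero)) (suc zero) c M (λ ())) (solve-⊕ u≢0 (M (suc (suc zero)) zero) 1#)

  -- The corner is fixed first; the transvections of the minor, lifted by one index, do not move it.
  -- Conjugation preserves the trace, so the hypothesis on the trace passes to the minor and forces
  -- the last entry.
  prescribeDiagonal : ∀ n (M : Mat (suc n)) → Pivot n M → (c : Fin (suc n) → Fin q) → Σ# c ≡ trace M →
    ∃ λ ts → ∀ i → apply ts M i i ≡ c i
  prescribeDiagonal zero M _ c eq = [] , λ { zero → trans (sym (+-identityʳ _)) (trans (sym eq) (+-identityʳ _)) }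
  prescribeDiagonal (suc n) M pivot c eq with step n M pivot (c zero)
  ... | ts , 00≡c₀ , pivot′ with prescribeDiagonal n (minor (apply ts M)) pivot′ (c ∘ suc) tail-trace
    where
    tail-trace : Σ# (c ∘ suc) ≡ trace (minor (apply ts M))
    tail-trace = begin
      Σ# (c ∘ suc) ≡⟨ drop (c zero) (Σ# (c ∘ suc)) ⟩
      ⊖ c zero ⊕ Σ# c ≡⟨ cong (⊖ c zero ⊕_) (trans eq (sym (trace-apply ts M))) ⟩
      ⊖ c zero ⊕ trace (apply ts M) ≡⟨ cong (λ z → ⊖ z ⊕ trace (apply ts M)) (sym 00≡c₀) ⟩
      ⊖ apply ts M zero zero ⊕ trace (apply ts M) ≡⟨ drop (apply ts M zero zero) (trace (minor (apply ts M))) ⟨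
      trace (minor (apply ts M)) ∎
      where
      drop : ∀ x y → y ≡ ⊖ x ⊕ (x ⊕ y)
      drop = solve 2 (λ x y → y := :- x :+ (x :+ y)) refl
  ... | us , diag = ts ++ map lift us , λ
    { zero → trans (cong (λ N → N zero zero) (apply-++ ts (map lift us) M)) (trans (apply-lift-00 us (apply ts M)) 00≡c₀)
    ; (suc i) → trans (cong (λ N → N (suc i) (suc i)) (apply-++ ts (map lift us) M)) (trans (cong (λ N → N i i) (apply-lift-minor us (apply ts M))) (diag i)) }

  -- Apart from an entry in the first column, a matrix can fail to be scalar through its diagonal,
  -- its first row, or another off-diagonal entry. In each case a conjugation carries the defect
  -- into the first column.
  pivot-or-scalar : ∀ n (M : Mat (2 ℕ.+ n)) → (∃ λ ts → Pivot (suc n) (apply ts M)) ⊎ (∀ a b → M a b ≡ Δ a b ⊗ M zero zero)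
  pivot-or-scalar n M with any? (λ j → ¬? (M (suc j) zero ≟ 0#))
  ... | yes p = inj₁ ([] , p)
  ... | no ¬col with any? (λ b → ¬? (M (suc b) (suc b) ≟ M zero zero))
  -- The first transvection clears the entry at `(zero , suc b)`; after it the second one puts
  -- exactly the difference `w` of the two diagonal entries into the first column.
  ...   | yes (b , neq) = inj₁ (((zero , suc b , c) , λ ()) ∷ ((suc b , zero , 1#) , λ ()) ∷ [] , b , λ eq → w≢0 (trans (sym entry) eq))
    where
    col0 : ∀ j → M (suc j) zero ≡ 0#
    col0 j = decidable-stable (M (suc j) zero ≟ 0#) (λ neq → ¬col (j , neq))
    w = M zero zero ⊕ ⊖ M (suc b) (suc b)
    w≢0 : w ≢ 0#
    w≢0 eq = neq (sym (x⊖y≡0⇒x≡y eq))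
    c = M zero (suc b) ⊗ inv w
    M₁ = conj zero (suc b) c M
    M₁0b : M₁ zero (suc b) ≡ 0#
    M₁0b = begin
      M₁ zero (suc b) ≡⟨ Entries.corner zero (suc b) c M ⟩
      (M zero (suc b) ⊕ c ⊗ M (suc b) (suc b)) ⊕ ⊖ (c ⊗ (M zero zero ⊕ c ⊗ M (suc b) zero)) ≡⟨ cong (λ z → (M zero (suc b) ⊕ c ⊗ M (suc b) (suc b)) ⊕ ⊖ (c ⊗ (M zero zero ⊕ c ⊗ z))) (col0 b) ⟩
      (M zero (suc b) ⊕ c ⊗ M (suc b) (suc b)) ⊕ ⊖ (c ⊗ (M zero zero ⊕ c ⊗ 0#)) ≡⟨ solve 4 (λ x c y z → (x :+ c :* y) :+ :- (c :* (z :+ c :* con 0ℤ)) := x :+ :- (c :* (z :+ :- y))) refl (M zero (suc b)) c (M (suc b) (suc b)) (M zero zero) ⟩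
      M zero (suc b) ⊕ ⊖ (c ⊗ w) ≡⟨ cong (λ z → M zero (suc b) ⊕ ⊖ z) (trans (*-assoc _ _ _) (trans (cong (M zero (suc b) ⊗_) (inv-inverseˡ w≢0)) (*-identityʳ _))) ⟩
      M zero (suc b) ⊕ ⊖ M zero (suc b) ≡⟨ -‿inverseʳ _ ⟩
      0# ∎
    M₁b0 : M₁ (suc b) zero ≡ 0#
    M₁b0 = trans (Entries.fixed zero (suc b) c M (λ ()) (λ ())) (col0 b)
    M₁00 : M₁ zero zero ≡ M zero zero
    M₁00 = trans (Entries.inRow zero (suc b) c M (λ ())) (trans (cong (λ z → M zero zero ⊕ c ⊗ z) (col0 b)) (trans (cong (M zero zero ⊕_) (zeroʳ c)) (+-identityʳ _)))
    M₁bb : M₁ (suc b) (suc b) ≡ M (suc b) (suc b)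
    M₁bb = trans (Entries.inCol zero (suc b) c M (λ ())) (trans (cong (λ z → M (suc b) (suc b) ⊕ ⊖ (c ⊗ z)) (col0 b)) (solve 2 (λ x c → x :+ :- (c :* con 0ℤ) := x) refl (M (suc b) (suc b)) c))
    entry : conj (suc b) zero 1# M₁ (suc b) zero ≡ w
    entry = begin
      conj (suc b) zero 1# M₁ (suc b) zero ≡⟨ Entries.corner (suc b) zero 1# M₁ ⟩
      (M₁ (suc b) zero ⊕ 1# ⊗ M₁ zero zero) ⊕ ⊖ (1# ⊗ (M₁ (suc b) (suc b) ⊕ 1# ⊗ M₁ zero (suc b))) ≡⟨ cong₂ (λ x y → (x ⊕ 1# ⊗ M₁ zero zero) ⊕ ⊖ (1# ⊗ (M₁ (suc b) (suc b) ⊕ 1# ⊗ y))) M₁b0 M₁0b ⟩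
      (0# ⊕ 1# ⊗ M₁ zero zero) ⊕ ⊖ (1# ⊗ (M₁ (suc b) (suc b) ⊕ 1# ⊗ 0#)) ≡⟨ solve 2 (λ x y → (con 0ℤ :+ con 1ℤ :* x) :+ :- (con 1ℤ :* (y :+ con 1ℤ :* con 0ℤ)) := x :+ :- y) refl (M₁ zero zero) (M₁ (suc b) (suc b)) ⟩
      M₁ zero zero ⊕ ⊖ M₁ (suc b) (suc b) ≡⟨ cong₂ (λ x y → x ⊕ ⊖ y) M₁00 M₁bb ⟩
      w ∎
  ...   | no ¬diag with any? (λ b → ¬? (M zero (suc b) ≟ 0#))
  -- The diagonal is constant by now, so its entries cancel and the new entry in the first column is
  -- minus `M zero (suc b)`.
  ...     | yes (b , neq) = inj₁ (((suc b , zero , 1#) , λ ()) ∷ [] , b , λ eq → neq (begin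
      M zero (suc b) ≡⟨ solve 2 (λ x y → y := :- ((con 0ℤ :+ con 1ℤ :* x) :+ :- (con 1ℤ :* (x :+ con 1ℤ :* y)))) refl (M zero zero) (M zero (suc b)) ⟩
      ⊖ ((0# ⊕ 1# ⊗ M zero zero) ⊕ ⊖ (1# ⊗ (M zero zero ⊕ 1# ⊗ M zero (suc b)))) ≡⟨ cong₂ (λ x y → ⊖ ((x ⊕ 1# ⊗ M zero zero) ⊕ ⊖ (1# ⊗ (y ⊕ 1# ⊗ M zero (suc b))))) (sym (col0 b)) (sym (diag b)) ⟩
      ⊖ ((M (suc b) zero ⊕ 1# ⊗ M zero zero) ⊕ ⊖ (1# ⊗ (M (suc b) (suc b) ⊕ 1# ⊗ M zero (suc b)))) ≡⟨ cong ⊖_ (trans (sym (Entries.corner (suc b) zero 1# M)) eq) ⟩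
      ⊖ 0# ≡⟨ solve 0 (:- con 0ℤ := con 0ℤ) refl ⟩
      0# ∎))
    where
    col0 : ∀ j → M (suc j) zero ≡ 0#
    col0 j = decidable-stable (M (suc j) zero ≟ 0#) (λ neq → ¬col (j , neq))
    diag : ∀ j → M (suc j) (suc j) ≡ M zero zero
    diag j = decidable-stable (M (suc j) (suc j) ≟ M zero zero) (λ neq → ¬diag (j , neq))
  ...     | no ¬row with any? (λ a → any? (λ b → ¬? (a ≟ b) ×-dec ¬? (M (suc a) (suc b) ≟ 0#)))
  -- Column `suc b` is subtracted from column 0; row `suc a` is untouched by the row operation since
  -- `a ≢ b`.
  ...       | yes (a , b , a≢b , neq) = inj₁ (((suc b , zero , 1#) , λ ()) ∷ [] , a , λ eq → neq (begin
      M (suc a) (suc b) ≡⟨ solve 1 (λ x → x := :- (con 0ℤ :+ :- (con 1ℤ :* x))) refl (M (suc a) (suc b)) ⟩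
      ⊖ (0# ⊕ ⊖ (1# ⊗ M (suc a) (suc b))) ≡⟨ cong (λ z → ⊖ (z ⊕ ⊖ (1# ⊗ M (suc a) (suc b)))) (sym (col0 a)) ⟩
      ⊖ (M (suc a) zero ⊕ ⊖ (1# ⊗ M (suc a) (suc b))) ≡⟨ cong ⊖_ (trans (sym (Entries.inCol (suc b) zero 1# M (λ e → a≢b (suc-injective e)))) eq) ⟩
      ⊖ 0# ≡⟨ solve 0 (:- con 0ℤ := con 0ℤ) refl ⟩
      0# ∎))
    where
    col0 : ∀ j → M (suc j) zero ≡ 0#
    col0 j = decidable-stable (M (suc j) zero ≟ 0#) (λ neq → ¬col (j , neq))
  ...       | no ¬off = inj₂ scalar
    where
    scalar : ∀ a b → M a b ≡ Δ a b ⊗ M zero zero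
    scalar zero zero = sym (*-identityˡ _)
    scalar zero (suc b) = trans (decidable-stable (M zero (suc b) ≟ 0#) (λ neq → ¬row (b , neq))) (sym (zeroˡ _))
    scalar (suc a) zero = trans (decidable-stable (M (suc a) zero ≟ 0#) (λ neq → ¬col (a , neq))) (sym (zeroˡ _))
    scalar (suc a) (suc b) with a ≟ b
    ... | yes refl = trans (decidable-stable (M (suc a) (suc a) ≟ M zero zero) (λ neq → ¬diag (a , neq))) (trans (sym (*-identityˡ _)) (cong (_⊗ M zero zero) (sym (Δ-refl a))))
    ... | no a≢b = trans (decidable-stable (M (suc a) (suc b) ≟ 0#) (λ neq → ¬off (a , b , a≢b , neq))) (trans (sym (zeroˡ _)) (cong (_⊗ M zero zero) (sym (Δ-≢ a≢b))))

-- k-th roots of triangular matrices.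

module TriangularRoots {q} (F : Field q) where

  open import Data.Fin using (_<_)
  open Field F
  open FieldProperties F
  open MatrixAlgebra F
  open ≡-Reasoning

  Lower Upper : ∀ {n} → Mat n → Set
  Lower A = ∀ i j → i < j → A i j ≡ 0#
  Upper A = ∀ i j → j < i → A i j ≡ 0#

  lower-* : ∀ {n} {A B : Mat n} → Lower A → Lower B → Lower (A *ₘ B)
  lower-* {A = A} {B} lA lB i j i<j = Σ#-zero _ term
    where
    term : ∀ t → A i t ⊗ B t j ≡ 0#
    term t with <-cmp i t
    ... | tri< i<t _ _ = trans (cong (_⊗ B t j) (lA i t i<t)) (zeroˡ _)
    ... | tri≈ _ refl _ = trans (cong (A i i ⊗_) (lB i j i<j)) (zeroʳ _)
    ... | tri> _ _ t<i = trans (cong (A i t ⊗_) (lB t j (ℕ.<-trans t<i i<j))) (zeroʳ _)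

  lower-*-diag : ∀ {n} {A B : Mat n} → Lower A → Lower B → ∀ i → (A *ₘ B) i i ≡ A i i ⊗ B i i
  lower-*-diag {A = A} {B} lA lB i = trans (Σ#-cong term) (Σ#-Δ i (λ t → A i t ⊗ B t i))
    where
    term : ∀ t → A i t ⊗ B t i ≡ Δ t i ⊗ (A i t ⊗ B t i)
    term t with <-cmp i t
    ... | tri< i<t _ _ = trans p (sym (trans (cong (Δ t i ⊗_) p) (zeroʳ _)))
      where p = trans (cong (_⊗ B t i) (lA i t i<t)) (zeroˡ _)
    ... | tri≈ _ refl _ = trans (sym (*-identityˡ _)) (cong (_⊗ (A i i ⊗ B i i)) (sym (Δ-refl i)))
    ... | tri> _ _ t<i = trans p (sym (trans (cong (Δ t i ⊗_) p) (zeroʳ _)))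
      where p = trans (cong (A i t ⊗_) (lB t i t<i)) (zeroʳ _)

  forward-substitution : ∀ {n} (T : Mat n) → Lower T → (∀ i → T i i ≢ 0#) → (v : Fin n → Fin q) →
    ∃ λ (w : Fin n → Fin q) → ∀ i → Σ# (λ t → T i t ⊗ w t) ≡ v i
  forward-substitution {zero} T _ _ v = (λ ()) , λ ()
  forward-substitution {suc n} T lT diag v = w , eq
    where
    w₀ = inv (T zero zero) ⊗ v zero
    rest = forward-substitution (λ i j → T (suc i) (suc j)) (λ i j i<j → lT (suc i) (suc j) (s≤s i<j)) (diag ∘ suc) (λ i → v (suc i) ⊕ ⊖ (T (suc i) zero ⊗ w₀))
    w : Fin (suc n) → Fin q
    w zero = w₀
    w (suc i) = proj₁ rest i
    eq : ∀ i → Σ# (λ t → T i t ⊗ w t) ≡ v i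
    eq zero = trans (cong₂ _⊕_ (inv-cancelʳ (diag zero) (v zero)) (Σ#-zero _ (λ t → trans (cong (_⊗ w (suc t)) (lT zero (suc t) (s≤s z≤n))) (zeroˡ _)))) (+-identityʳ _)
    eq (suc i) = trans (cong (T (suc i) zero ⊗ w₀ ⊕_) (proj₂ rest i)) (solve 2 (λ x y → x :+ (y :+ :- x) := y) refl (T (suc i) zero ⊗ w₀) (v (suc i)))

  -- geometric k x y = xᵏ⁻¹ + xᵏ⁻² y + … + yᵏ⁻¹
  geometric : ℕ → Fin q → Fin q → Fin q
  geometric zero x y = 0#
  geometric (suc k) x y = x ^ k ⊕ y ⊗ geometric k x y

  geometric-telescopes : ∀ k x y → geometric k x y ⊗ (x ⊕ ⊖ y) ≡ x ^ k ⊕ ⊖ (y ^ k)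
  geometric-telescopes zero x y = solve 2 (λ x y → con 0ℤ :* (x :+ :- y) := con 1ℤ :+ :- con 1ℤ) refl x y
  geometric-telescopes (suc k) x y = begin
    (x ^ k ⊕ y ⊗ g) ⊗ (x ⊕ ⊖ y) ≡⟨ solve 4 (λ x y a g → (a :+ y :* g) :* (x :+ :- y) := a :* (x :+ :- y) :+ y :* (g :* (x :+ :- y))) refl x y (x ^ k) g ⟩
    x ^ k ⊗ (x ⊕ ⊖ y) ⊕ y ⊗ (g ⊗ (x ⊕ ⊖ y)) ≡⟨ cong (λ z → x ^ k ⊗ (x ⊕ ⊖ y) ⊕ y ⊗ z) (geometric-telescopes k x y) ⟩
    x ^ k ⊗ (x ⊕ ⊖ y) ⊕ y ⊗ (x ^ k ⊕ ⊖ (y ^ k)) ≡⟨ solve 4 (λ x y a b → a :* (x :+ :- y) :+ y :* (a :+ :- b) := x :* a :+ :- (y :* b)) refl x y (x ^ k) (y ^ k) ⟩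
    x ^ suc k ⊕ ⊖ (y ^ suc k) ∎
    where g = geometric k x y

  -- At equal arguments the geometric sum is the derivative of the power function; through this
  -- factor the condition `p ∤ k` enters.
  geometric-diagonal : ∀ k x → geometric (suc k) x x ≡ (suc k · 1#) ⊗ x ^ k
  geometric-diagonal zero x = solve 1 (λ x → con 1ℤ :+ x :* con 0ℤ := (con 1ℤ :+ con 0ℤ) :* con 1ℤ) refl x
  geometric-diagonal (suc k) x = begin
    x ^ suc k ⊕ x ⊗ geometric (suc k) x x ≡⟨ cong (λ z → x ^ suc k ⊕ x ⊗ z) (geometric-diagonal k x) ⟩
    x ⊗ x ^ k ⊕ x ⊗ ((suc k · 1#) ⊗ x ^ k) ≡⟨ solve 3 (λ x a s → x :* a :+ x :* (s :* a) := (con 1ℤ :+ s) :* (x :* a)) refl x (x ^ k) (suc k · 1#) ⟩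
    (1# ⊕ suc k · 1#) ⊗ (x ⊗ x ^ k) ∎

  -- `geometric` with a matrix as second argument. It is the operator that carries the column `w` of
  -- a block matrix to the corresponding column of its power, which makes the equation for `w`
  -- linear.
  geometricₘ : ∀ {n} → Fin q → Mat n → ℕ → Mat n
  geometricₘ x X zero i j = 0#
  geometricₘ x X (suc m) i j = Δ i j ⊗ x ^ m ⊕ (X *ₘ geometricₘ x X m) i j

  module BlockPower {n} (x : Fin q) (w : Fin n → Fin q) (X′ : Mat n) where

    block : Mat (suc n)
    block zero zero = x
    block zero (suc j) = 0#
    block (suc i) zero = w i
    block (suc i) (suc j) = X′ i j

    block^-00 : ∀ m → (block ^ₘ m) zero zero ≡ x ^ m
    block^-00 zero = identity≡Δ {suc n} zero zero
    block^-00 (suc m) = trans (cong₂ _⊕_ (cong (x ⊗_) (block^-00 m)) (Σ#-zero {n} (λ t → 0# ⊗ (block ^ₘ m) (suc t) zero) (λ t → zeroˡ _))) (+-identityʳ _)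

    block^-0s : ∀ m j → (block ^ₘ m) zero (suc j) ≡ 0#
    block^-0s zero j = identity≡Δ zero (suc j)
    block^-0s (suc m) j = trans (cong₂ _⊕_ (trans (cong (x ⊗_) (block^-0s m j)) (zeroʳ x)) (Σ#-zero {n} (λ t → 0# ⊗ (block ^ₘ m) (suc t) (suc j)) (λ t → zeroˡ _))) (+-identityʳ _)

    block^-ss : ∀ m i j → (block ^ₘ m) (suc i) (suc j) ≡ (X′ ^ₘ m) i j
    block^-ss zero i j = trans (identity≡Δ (suc i) (suc j)) (sym (identity≡Δ i j))
    block^-ss (suc m) i j = trans (cong₂ _⊕_ (trans (cong (w i ⊗_) (block^-0s m j)) (zeroʳ (w i))) (Σ#-cong (λ t → cong (X′ i t ⊗_) (block^-ss m t j)))) (+-identityˡ _)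

    block^-s0 : ∀ m i → (block ^ₘ m) (suc i) zero ≡ Σ# (λ u → geometricₘ x X′ m i u ⊗ w u)
    block^-s0 zero i = trans (identity≡Δ (suc i) zero) (sym (Σ#-zero _ (λ u → zeroˡ (w u))))
    block^-s0 (suc m) i = begin
      w i ⊗ (block ^ₘ m) zero zero ⊕ Σ# (λ t → X′ i t ⊗ (block ^ₘ m) (suc t) zero) ≡⟨ cong₂ _⊕_ (cong (w i ⊗_) (block^-00 m)) (Σ#-cong (λ t → cong (X′ i t ⊗_) (block^-s0 m t))) ⟩
      w i ⊗ x ^ m ⊕ Σ# (λ t → X′ i t ⊗ Σ# (λ u → geometricₘ x X′ m t u ⊗ w u)) ≡⟨ cong₂ _⊕_ (trans (*-comm (w i) (x ^ m)) (sym (Σ#-Δ i (λ u → x ^ m ⊗ w u)))) (Σ#-cong (λ t → ⊗-Σ# (X′ i t) (λ u → geometricₘ x X′ m t u ⊗ w u))) ⟩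
      Σ# (λ u → Δ u i ⊗ (x ^ m ⊗ w u)) ⊕ Σ# (λ t → Σ# (λ u → X′ i t ⊗ (geometricₘ x X′ m t u ⊗ w u))) ≡⟨ cong₂ _⊕_ (Σ#-cong (λ u → trans (sym (*-assoc _ _ _)) (cong (λ z → z ⊗ x ^ m ⊗ w u) (Δ-sym u i)))) (trans (Σ#-swap (λ t u → X′ i t ⊗ (geometricₘ x X′ m t u ⊗ w u))) (Σ#-cong (λ u → trans (Σ#-cong (λ t → sym (*-assoc (X′ i t) (geometricₘ x X′ m t u) (w u)))) (sym (Σ#-⊗ (w u) (λ t → X′ i t ⊗ geometricₘ x X′ m t u)))))) ⟩
      Σ# (λ u → Δ i u ⊗ x ^ m ⊗ w u) ⊕ Σ# (λ u → (X′ *ₘ geometricₘ x X′ m) i u ⊗ w u) ≡⟨ Σ#-⊕ (λ u → Δ i u ⊗ x ^ m ⊗ w u) (λ u → (X′ *ₘ geometricₘ x X′ m) i u ⊗ w u) ⟨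
      Σ# (λ u → Δ i u ⊗ x ^ m ⊗ w u ⊕ (X′ *ₘ geometricₘ x X′ m) i u ⊗ w u) ≡⟨ Σ#-cong (λ u → sym (distribʳ (w u) _ _)) ⟩
      Σ# (λ u → geometricₘ x X′ (suc m) i u ⊗ w u) ∎

  module _ {n} (x : Fin q) (X′ : Mat n) (lX′ : Lower X′) where

    lower-geometric : ∀ m → Lower (geometricₘ x X′ m)
    lower-geometric zero i j _ = refl
    lower-geometric (suc m) i j i<j = trans (cong₂ _⊕_ (trans (cong (_⊗ x ^ m) (Δ-≢ {i = i} {j} (λ { refl → ℕ.<-irrefl refl i<j }))) (zeroˡ _)) (lower-* lX′ (lower-geometric m) i j i<j)) (+-identityˡ 0#)

    diag-geometric : ∀ m i → geometricₘ x X′ m i i ≡ geometric m x (X′ i i)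
    diag-geometric zero i = refl
    diag-geometric (suc m) i = cong₂ _⊕_ (trans (cong (_⊗ x ^ m) (Δ-refl i)) (*-identityˡ _)) (trans (lower-*-diag lX′ (lower-geometric m) i) (cong (X′ i i ⊗_) (diag-geometric m i)))

  -- The first column of X is found by solving a triangular system whose diagonal is geometric k x₀ xᵢ.
  lower-root : ∀ k {n} (L : Mat n) (x : Fin n → Fin q) → Lower L → (∀ i → L i i ≡ x i ^ k) → (∀ i j → i ≢ j → geometric k (x i) (x j) ≢ 0#) →
    ∃ λ (X : Mat n) → Lower X × (∀ i → X i i ≡ x i) × ((X ^ₘ k) ≈ₘ L)
  lower-root k {zero} L x _ _ _ = (λ ()) , (λ ()) , (λ ()) , λ ()
  lower-root k {suc n} L x lL dL g≢0 = block , lX , dX , powers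
    where
    L′ : Mat n
    L′ i j = L (suc i) (suc j)
    rec = lower-root k L′ (x ∘ suc) (λ i j i<j → lL (suc i) (suc j) (s≤s i<j)) (dL ∘ suc) (λ i j i≢j → g≢0 (suc i) (suc j) (λ { refl → i≢j refl }))
    X′ = proj₁ rec
    lX′ = proj₁ (proj₂ rec)
    dX′ = proj₁ (proj₂ (proj₂ rec))
    pX′ = proj₂ (proj₂ (proj₂ rec))
    system : ∃ λ (w : Fin n → Fin q) → ∀ i → Σ# (λ t → geometricₘ (x zero) X′ k i t ⊗ w t) ≡ L (suc i) zero
    system = forward-substitution _ (lower-geometric (x zero) X′ lX′ k)
      (λ i eq → g≢0 zero (suc i) (λ ()) (trans (cong (geometric k (x zero)) (sym (dX′ i))) (trans (sym (diag-geometric (x zero) X′ lX′ k i)) eq)))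
      (λ i → L (suc i) zero)
    w = proj₁ system
    open BlockPower (x zero) w X′
    lX : Lower block
    lX zero (suc j) _ = refl
    lX (suc i) (suc j) (s≤s i<j) = lX′ i j i<j
    dX : ∀ i → block i i ≡ x i
    dX zero = refl
    dX (suc i) = dX′ i
    powers : (block ^ₘ k) ≈ₘ L
    powers zero zero = trans (block^-00 k) (sym (dL zero))
    powers zero (suc j) = trans (block^-0s k j) (sym (lL zero (suc j) (s≤s z≤n)))
    powers (suc i) zero = trans (block^-s0 k i) (proj₂ system i)
    powers (suc i) (suc j) = trans (block^-ss k i j) (pX′ i j)

  -- Conjugation by the permutation that reverses the indices; it exchanges upper and lower
  -- triangular matrices and respects powers.
  flip : ∀ {n} → Mat n → Mat n
  flip A i j = A (opposite i) (opposite j)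

  flip-* : ∀ {n} (A B : Mat n) → (flip A *ₘ flip B) ≈ₘ flip (A *ₘ B)
  flip-* A B i j = sym (Σ#-permute (λ t → A (opposite i) t ⊗ B t (opposite j)) (permutation opposite opposite opposite-involutive opposite-involutive))

  flip-^ : ∀ {n} (A : Mat n) k → (flip A ^ₘ k) ≈ₘ flip (A ^ₘ k)
  flip-^ A zero i j = trans (identity≡Δ i j) (trans (Δ-opposite i j) (sym (identity≡Δ (opposite i) (opposite j))))
    where
    Δ-opposite : ∀ {n} (i j : Fin n) → Δ i j ≡ Δ (opposite i) (opposite j)
    Δ-opposite i j with i ≟ j
    ... | yes refl = trans (Δ-refl i) (sym (Δ-refl (opposite i)))
    ... | no i≢j = trans (Δ-≢ i≢j) (sym (Δ-≢ (λ eq → i≢j (trans (sym (opposite-involutive i)) (trans (cong opposite eq) (opposite-involutive j))))))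
  flip-^ A (suc k) = ≈ₘ-trans (*ₘ-cong (λ _ _ → refl) (flip-^ A k)) (flip-* A (A ^ₘ k))

  opposite-< : ∀ {n} {i j : Fin n} → i < j → opposite j < opposite i
  opposite-< {n} {i} {j} i<j = subst₂ ℕ._<_ (sym (opposite-prop j)) (sym (opposite-prop i)) (ℕ.∸-monoʳ-< (s≤s i<j) (toℕ<n j))

  upper-root : ∀ k {n} (U : Mat n) (x : Fin n → Fin q) → Upper U → (∀ i → U i i ≡ x i ^ k) → (∀ i j → i ≢ j → geometric k (x i) (x j) ≢ 0#) →
    ∃ λ (X : Mat n) → (X ^ₘ k) ≈ₘ U
  upper-root k {n} U x uU dU g≢0 = flip X , λ i j → trans (flip-^ X k i j) (trans (pX (opposite i) (opposite j)) (cong₂ U (opposite-involutive i) (opposite-involutive j)))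
    where
    rec = lower-root k (flip U) (x ∘ opposite) (λ i j i<j → uU (opposite i) (opposite j) (opposite-< i<j)) (dU ∘ opposite)
      (λ i j i≢j → g≢0 (opposite i) (opposite j) (λ eq → i≢j (trans (sym (opposite-involutive i)) (trans (cong opposite eq) (opposite-involutive j)))))
    X = proj₁ rec
    pX = proj₂ (proj₂ (proj₂ rec))

  lower+upper : ∀ k {n} (M : Mat n) (x y : Fin n → Fin q) → (∀ i → M i i ≡ x i ^ k ⊕ y i ^ k) →
    (∀ i j → i ≢ j → geometric k (x i) (x j) ≢ 0#) → (∀ i j → i ≢ j → geometric k (y i) (y j) ≢ 0#) → SumOfPowers k M
  lower+upper k {n} M x y dM gx gy = proj₁ l , proj₁ u , λ i j → trans (split i j) (cong₂ _⊕_ (sym (proj₂ (proj₂ (proj₂ l)) i j)) (sym (proj₂ u i j)))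
    where
    L U : Mat n
    L i j with <-cmp i j
    ... | tri< _ _ _ = 0#
    ... | tri≈ _ _ _ = x i ^ k
    ... | tri> _ _ _ = M i j
    U i j with <-cmp i j
    ... | tri< _ _ _ = M i j
    ... | tri≈ _ _ _ = y i ^ k
    ... | tri> _ _ _ = 0#
    split : ∀ i j → M i j ≡ L i j ⊕ U i j
    split i j with <-cmp i j
    ... | tri< _ _ _ = sym (+-identityˡ _)
    ... | tri≈ _ refl _ = dM i
    ... | tri> _ _ _ = sym (+-identityʳ _)
    lL : Lower L
    lL i j i<j with <-cmp i j
    ... | tri< _ _ _ = refl
    ... | tri≈ i≮j _ _ = ⊥-elim (i≮j i<j)
    ... | tri> i≮j _ _ = ⊥-elim (i≮j i<j)
    uU : Upper U
    uU i j j<i with <-cmp i j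
    ... | tri< _ _ j≮i = ⊥-elim (j≮i j<i)
    ... | tri≈ _ _ j≮i = ⊥-elim (j≮i j<i)
    ... | tri> _ _ _ = refl
    dL : ∀ i → L i i ≡ x i ^ k
    dL i with <-cmp i i
    ... | tri< _ i≢i _ = ⊥-elim (i≢i refl)
    ... | tri≈ _ _ _ = refl
    ... | tri> _ i≢i _ = ⊥-elim (i≢i refl)
    dU : ∀ i → U i i ≡ y i ^ k
    dU i with <-cmp i i
    ... | tri< _ i≢i _ = ⊥-elim (i≢i refl)
    ... | tri≈ _ _ _ = refl
    ... | tri> _ i≢i _ = ⊥-elim (i≢i refl)
    l = lower-root k L x lL dL gx
    u = upper-root k U y uU dU gy

-- Non-scalar matrices.

cube<q : ∀ d q → 1 ℕ.≤ d → (d ∸ 1) ℕ.^ 6 ℕ.+ 6 ℕ.* d ℕ.≤ q ℕ.^ 2 → (d ∸ 1) ℕ.^ 3 ℕ.< q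
cube<q d q 1≤d bound = ℕ.≰⇒> λ q≤ → ℕ.<-irrefl refl (begin-strict
  q ℕ.^ 2 ≤⟨ ℕ.^-monoˡ-≤ 2 q≤ ⟩
  ((d ∸ 1) ℕ.^ 3) ℕ.^ 2 ≡⟨ ℕ.^-*-assoc (d ∸ 1) 3 2 ⟩
  (d ∸ 1) ℕ.^ 6 <⟨ ℕ.m<m+n ((d ∸ 1) ℕ.^ 6) (ℕ.≤-trans 1≤d (ℕ.m≤n*m d 6)) ⟩
  (d ∸ 1) ℕ.^ 6 ℕ.+ 6 ℕ.* d ≤⟨ bound ⟩
  q ℕ.^ 2 ∎)
  where open ℕ.≤-Reasoning

-- Rules out `d = q - 1`, the case in which 1 is the only non-zero k-th power. It rests on
-- `(n + 1)² = (n - 1)² + 4 n`, compared term by term.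
many-powers : ∀ n → 1 ℕ.≤ n → ¬ (n ∸ 1) ℕ.^ 6 ℕ.+ 6 ℕ.* n ℕ.≤ (suc n) ℕ.^ 2
many-powers (suc zero) _ (s≤s (s≤s (s≤s (s≤s ()))))
many-powers n@(suc (suc j)) _ bound = ℕ.<-irrefl refl (begin-strict
  (suc n) ℕ.^ 2 ≡⟨ expand j ⟩
  suc j ℕ.^ 2 ℕ.+ (4 ℕ.* j ℕ.+ 8) <⟨ ℕ.+-mono-≤-< (ℕ.^-monoʳ-≤ (suc j) (s≤s (s≤s (z≤n {4})))) smaller ⟩
  suc j ℕ.^ 6 ℕ.+ 6 ℕ.* n ≤⟨ bound ⟩
  (suc n) ℕ.^ 2 ∎)
  where
  open ℕ.≤-Reasoning
  expand : ∀ j → (3 ℕ.+ j) ℕ.* ((3 ℕ.+ j) ℕ.* 1) ≡ (1 ℕ.+ j) ℕ.* ((1 ℕ.+ j) ℕ.* 1) ℕ.+ (4 ℕ.* j ℕ.+ 8)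
  expand = ℕ-Solver.solve-∀
  twelve : ∀ j → 6 ℕ.* (2 ℕ.+ j) ≡ (4 ℕ.* j ℕ.+ 8) ℕ.+ (4 ℕ.+ 2 ℕ.* j)
  twelve = ℕ-Solver.solve-∀
  smaller : 4 ℕ.* j ℕ.+ 8 ℕ.< 6 ℕ.* n
  smaller = subst (4 ℕ.* j ℕ.+ 8 ℕ.<_) (sym (twelve j)) (ℕ.m<m+n (4 ℕ.* j ℕ.+ 8) (s≤s z≤n))

module NonScalar {q} (F : Field q) (k : ℕ) (1≤k : 1 ℕ.≤ k)
  (bound : (gcd k (q ∸ 1) ∸ 1) ℕ.^ 6 ℕ.+ 6 ℕ.* gcd k (q ∸ 1) ℕ.≤ q ℕ.^ 2) where

  open Field F
  open FieldProperties F
  open MatrixAlgebra F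
  open PrescribedDiagonal F
  open TriangularRoots F
  open Powers F k 1≤k using (κ)
  open PowerSums F k 1≤k using (n; q≡1+n; 1≤n; n≢0; d; 1≤d; κ1≤d; sum-of-three-powers; N-1≡n)

  -- Otherwise 1 would have all `n = q - 1` non-zero elements as k-th roots, and `κ 1# ≤ d ≤ n`
  -- would give `d = n`, against `bound`.
  nonTrivialPower : ∃ λ y → y ≢ 0# × y ^ k ≢ 1#
  nonTrivialPower with any? (λ y → ¬? (y ≟ 0#) ×-dec ¬? (y ^ k ≟ 1#))
  ... | yes found = found
  ... | no none = ⊥-elim (many-powers n 1≤n (subst₂ (λ u v → (u ∸ 1) ℕ.^ 6 ℕ.+ 6 ℕ.* u ℕ.≤ v ℕ.^ 2) d≡n q≡1+n bound))
    where
    allOnes : ∀ y → y ≢ 0# → y ^ k ≡ 1#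
    allOnes y y≢0 = decidable-stable (y ^ k ≟ 1#) (λ neq → none (y , y≢0 , neq))
    pointwise : ∀ y → δ 1# (y ^ k) ≡ 1ℤ ℤ.- δ y 0# ℤ.* 1ℤ
    pointwise y with y ≟ 0#
    ... | yes refl = trans (δ-≢ (λ eq → 0≢1 (trans (sym (0^ 1≤k)) (sym eq)))) (cong (λ z → 1ℤ ℤ.- z ℤ.* 1ℤ) (sym (δ-refl 0#)))
    ... | no y≢0 = trans (trans (cong (δ 1#) (allOnes y y≢0)) (δ-refl 1#)) (cong (λ z → 1ℤ ℤ.- z ℤ.* 1ℤ) (sym (δ-≢ y≢0)))
    κ1≡n : κ 1# ≡ + n
    κ1≡n = begin
      κ 1# ≡⟨ ∑-cong pointwise ⟩
      ∑ (λ y → 1ℤ ℤ.- δ y 0# ℤ.* 1ℤ) ≡⟨ ∑-- {q} (λ _ → 1ℤ) (λ y → δ y 0# ℤ.* 1ℤ) ⟩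
      ∑ {q} (λ _ → 1ℤ) ℤ.- ∑ (λ y → δ y 0# ℤ.* 1ℤ) ≡⟨ cong₂ ℤ._-_ (trans (∑-const q 1ℤ) (ℤ.*-identityʳ (+ q))) (∑-δ (λ _ → 1ℤ) 0#) ⟩
      + q ℤ.- 1ℤ ≡⟨ N-1≡n ⟩
      + n ∎
      where open ≡-Reasoning
    d≡n : d ≡ n
    d≡n = ℕ.≤-antisym (gcd[m,n]≤n k n) (ℤ.drop‿+≤+ (subst (ℤ._≤ + d) κ1≡n κ1≤d))

  powerAvoiding : ∀ t → ∃ λ y → y ≢ 0# × y ^ k ≢ t
  powerAvoiding t with t ≟ 1#
  ... | yes refl = nonTrivialPower
  ... | no t≢1 = 1# , (λ eq → 0≢1 (sym eq)) , λ eq → t≢1 (trans (sym eq) (1^ k))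

  -- The non-zero base comes first because it will occupy a diagonal place that must not vanish.
  three-powers : ∀ {a} → a ≢ 0# → ∃ λ x → ∃ λ y → ∃ λ z → x ≢ 0# × a ≡ x ^ k ⊕ y ^ k ⊕ z ^ k
  three-powers {a} a≢0 = arrange (sum-of-three-powers (cube<q d q 1≤d bound) a≢0)
    where
    arrange : (∃ λ x → ∃ λ y → ∃ λ z → a ≡ x ^ k ⊕ y ^ k ⊕ z ^ k) → ∃ λ x → ∃ λ y → ∃ λ z → x ≢ 0# × a ≡ x ^ k ⊕ y ^ k ⊕ z ^ k
    arrange (x , y , z , eq) with x ≟ 0# | y ≟ 0# | z ≟ 0#
    ... | no x≢0 | _ | _ = x , y , z , x≢0 , eq
    ... | yes _ | no y≢0 | _ = y , x , z , y≢0 , trans eq (cong (_⊕ z ^ k) (+-comm (x ^ k) (y ^ k)))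
    ... | yes _ | yes _ | no z≢0 = z , x , y , z≢0 , trans eq (trans (+-comm (x ^ k ⊕ y ^ k) (z ^ k)) (sym (+-assoc (z ^ k) (x ^ k) (y ^ k))))
    ... | yes refl | yes refl | yes refl = ⊥-elim (a≢0 (trans eq (trans (cong (λ z → z ⊕ z ⊕ z) (0^ 1≤k)) (trans (cong (_⊕ 0#) (+-identityˡ 0#)) (+-identityˡ 0#)))))

  -- A function of the power alone, so that equal k-th powers get equal roots.
  root : Fin q → Fin q
  root a with any? (λ y → y ^ k ≟ a)
  ... | yes (y , _) = y
  ... | no _ = 0#

  root-^ : ∀ x → root (x ^ k) ^ k ≡ x ^ k
  root-^ x with any? (λ y → y ^ k ≟ x ^ k)
  ... | yes (_ , eq) = eq
  ... | no none = ⊥-elim (none (x , refl))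

  root-nonZero : ∀ {x} → x ≢ 0# → root (x ^ k) ≢ 0#
  root-nonZero {x} x≢0 eq = ^-nonZero x≢0 k (trans (sym (root-^ x)) (trans (cong (_^ k) eq) (0^ 1≤k)))

  module _ (k·1≢0 : k · 1# ≢ 0#) where

    -- For `x ≠ y` telescoping turns a zero into `xᵏ = yᵏ`; for `x = y` the value is `k xᵏ⁻¹`. The
    -- first hypothesis excludes distinct roots of one power and is met by taking all diagonal
    -- entries from `root`.
    geometric-nonZero : ∀ {x y} → (x ^ k ≡ y ^ k → x ≡ y) → x ≢ 0# ⊎ y ≢ 0# → geometric k x y ≢ 0#
    geometric-nonZero {x} {y} inj nz g≡0 with x ≟ y
    ... | no x≢y = x≢y (inj (x⊖y≡0⇒x≡y (trans (sym (geometric-telescopes k x y)) (trans (cong (_⊗ (x ⊕ ⊖ y)) g≡0) (zeroˡ _)))))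
    ... | yes refl = diagonal k 1≤k k·1≢0 g≡0
      where
      x≢0 : x ≢ 0#
      x≢0 = Sum.[ id , id ]′ nz
      diagonal : ∀ k → 1 ℕ.≤ k → k · 1# ≢ 0# → geometric k x x ≢ 0#
      diagonal (suc k) _ k·1≢0 eq = ⊗-nonZero k·1≢0 (^-nonZero x≢0 k) (trans (sym (geometric-diagonal k x)) eq)

    -- Only entry 1 of the diagonals may vanish, since nilpotent blocks of size ≥ 2 need not be k-th powers.
    diagonal : ∀ {n} → Fin q → Fin q → Fin (2 ℕ.+ n) → Fin q
    diagonal x y zero = x
    diagonal x y (suc zero) = y
    diagonal x y (suc (suc i)) = 1#

    diagonal-nonZero : ∀ {n x y} → x ≢ 0# → (i j : Fin (2 ℕ.+ n)) → i ≢ j → diagonal x y i ≢ 0# ⊎ diagonal x y j ≢ 0#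
    diagonal-nonZero x≢0 zero j i≢j = inj₁ x≢0
    diagonal-nonZero x≢0 (suc (suc i)) j i≢j = inj₁ (λ eq → 0≢1 (sym eq))
    diagonal-nonZero x≢0 (suc zero) zero i≢j = inj₂ x≢0
    diagonal-nonZero x≢0 (suc zero) (suc zero) i≢j = ⊥-elim (i≢j refl)
    diagonal-nonZero x≢0 (suc zero) (suc (suc j)) i≢j = inj₂ (λ eq → 0≢1 (sym eq))

    SumOfPowers-diagonal : ∀ {n} (M : Mat (2 ℕ.+ n)) {x y x′ y′} → x ≢ 0# → x′ ≢ 0# →
      (∀ i → M i i ≡ diagonal x y i ^ k ⊕ diagonal x′ y′ i ^ k) → SumOfPowers k M
    SumOfPowers-diagonal M {x} {y} {x′} {y′} x≢0 x′≢0 diag = lower+upper k M (canonical ∘ diagonal x y) (canonical ∘ diagonal x′ y′)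
      (λ i → trans (diag i) (cong₂ _⊕_ (sym (root-^ (diagonal x y i))) (sym (root-^ (diagonal x′ y′ i)))))
      (good (diagonal x y) (diagonal-nonZero x≢0)) (good (diagonal x′ y′) (diagonal-nonZero x′≢0))
      where
      canonical : Fin q → Fin q
      canonical x = root (x ^ k)
      good : ∀ {n} (a : Fin n → Fin q) → (∀ i j → i ≢ j → a i ≢ 0# ⊎ a j ≢ 0#) → ∀ i j → i ≢ j → geometric k (canonical (a i)) (canonical (a j)) ≢ 0#
      good a nz i j i≢j = geometric-nonZero (λ eq → cong root (trans (sym (root-^ (a i))) (trans eq (root-^ (a j))))) (Sum.map root-nonZero root-nonZero (nz i j i≢j))

    -- All places after the first two are filled with `1 + 1`, in total `R`, and the first two must
    -- supply `T = trace M - R` with `x` and `x′` non-zero. Choosing `xᵏ ≠ T` keeps `T - xᵏ`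
    -- non-zero, so three powers represent it with a non-zero one among them.
    SumOfPowers-pivot : ∀ n (M : Mat (2 ℕ.+ n)) → Pivot (suc n) M → SumOfPowers k M
    SumOfPowers-pivot n M pivot = SumOfPowers-apply {k = k} (proj₁ p) M (SumOfPowers-diagonal (apply (proj₁ p) M) x≢0 x′≢0 (proj₂ p))
      where
      R = Σ# {n} (λ _ → 1# ^ k ⊕ 1# ^ k)
      T = trace M ⊕ ⊖ R
      avoid = powerAvoiding T
      x = proj₁ avoid
      x≢0 = proj₁ (proj₂ avoid)
      rest = three-powers {T ⊕ ⊖ (x ^ k)} (λ eq → proj₂ (proj₂ avoid) (sym (x⊖y≡0⇒x≡y eq)))
      x′ = proj₁ rest
      y = proj₁ (proj₂ rest)
      y′ = proj₁ (proj₂ (proj₂ rest))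
      x′≢0 = proj₁ (proj₂ (proj₂ (proj₂ rest)))
      sum≡ : T ⊕ ⊖ (x ^ k) ≡ x′ ^ k ⊕ y ^ k ⊕ y′ ^ k
      sum≡ = proj₂ (proj₂ (proj₂ (proj₂ rest)))
      c : Fin (2 ℕ.+ n) → Fin q
      c i = diagonal x y i ^ k ⊕ diagonal x′ y′ i ^ k
      Σc≡trace : Σ# c ≡ trace M
      Σc≡trace = begin
        (x ^ k ⊕ x′ ^ k) ⊕ ((y ^ k ⊕ y′ ^ k) ⊕ R) ≡⟨ solve 5 (λ a b c d r → (a :+ b) :+ ((c :+ d) :+ r) := (b :+ c :+ d) :+ a :+ r) refl (x ^ k) (x′ ^ k) (y ^ k) (y′ ^ k) R ⟩
        (x′ ^ k ⊕ y ^ k ⊕ y′ ^ k) ⊕ x ^ k ⊕ R ≡⟨ cong (λ z → z ⊕ x ^ k ⊕ R) (sym sum≡) ⟩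
        (trace M ⊕ ⊖ R ⊕ ⊖ (x ^ k)) ⊕ x ^ k ⊕ R ≡⟨ solve 3 (λ t r a → (t :+ :- r :+ :- a) :+ a :+ r := t) refl (trace M) R (x ^ k) ⟩
        trace M ∎
        where open ≡-Reasoning
      p = prescribeDiagonal (suc n) M pivot c Σc≡trace

-- Transport of a field given up to `≈` to `Fin q` with propositional equality.

module Normalisation {c ℓ q} (G : FiniteField c ℓ q) where

  open FiniteField G renaming (sym to ≈-sym; trans to ≈-trans) hiding (zero; refl)

  rawRing′ : RawRing 0ℓ 0ℓ
  rawRing′ = record
    { Carrier = Fin q ; _≈_ = _≡_
    ; _+_ = λ x y → toFin (fromFin x + fromFin y) ; _*_ = λ x y → toFin (fromFin x * fromFin y)
    ; -_ = λ x → toFin (- fromFin x) ; 0# = toFin 0# ; 1# = toFin 1# }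

  fromFin-injective : ∀ {x y} → fromFin x ≈ fromFin y → x ≡ y
  fromFin-injective {x} {y} eq = trans (sym (to∘from x)) (trans (toFin-cong eq) (to∘from y))

  -- The operations on `Fin q` are defined so that `from∘to` alone makes `fromFin` a homomorphism;
  -- by injectivity the ring laws are then inherited.
  isRingMonomorphism : IsRingMonomorphism rawRing′ (CommutativeRing.rawRing commRing) fromFin
  isRingMonomorphism = record
    { isRingHomomorphism = record
      { isSemiringHomomorphism = record
        { isNearSemiringHomomorphism = record
          { +-isMonoidHomomorphism = record
            { isMagmaHomomorphism = record
              { isRelHomomorphism = record { cong = λ eq → reflexive (cong fromFin eq) }
              ; homo = λ _ _ → from∘to _ }
            ; ε-homo = from∘to _ }
          ; *-homo = λ _ _ → from∘to _ }
        ; 1#-homo = from∘to _ }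
      ; -‿homo = λ _ → from∘to _ }
    ; injective = fromFin-injective }

  normalise : Field q
  normalise = record
    { _⊕_ = _ ; _⊗_ = _ ; ⊖_ = _ ; 0# = _ ; 1# = _
    ; isCommutativeRing = RingMonomorphism.isCommutativeRing isRingMonomorphism (CommutativeRing.isCommutativeRing commRing)
    ; 0≢1 = λ eq → 0≉1 (≈-trans (≈-sym (from∘to 0#)) (≈-trans (reflexive (cong fromFin eq)) (from∘to 1#)))
    ; inverse = λ x x≢0 → let (y , xy≈1) = inverse (fromFin x) (λ eq → x≢0 (trans (sym (to∘from x)) (toFin-cong eq)))
        in toFin y , toFin-cong (≈-trans (*-congˡ (from∘to y)) xy≈1) }

  module M = Matrices G
  open MatrixAlgebra normalise

  fromFin-identity : ∀ {n} (i j : Fin n) → fromFin (identity i j) ≈ M.identity i j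
  fromFin-identity i j with i ≟ j
  ... | yes _ = from∘to 1#
  ... | no _ = from∘to 0#

  fromFin-Σ : ∀ {n} (f g : Fin n → Fin q) (h : Fin n → Carrier) → (∀ t → fromFin (g t) ≈ h t) →
    fromFin (FieldProperties.Σ# normalise (λ t → Field._⊗_ normalise (f t) (g t))) ≈ foldr _+_ 0# (λ t → fromFin (f t) * h t)
  fromFin-Σ {zero} f g h eq = from∘to 0#
  fromFin-Σ {suc n} f g h eq = ≈-trans (from∘to _) (+-cong (≈-trans (from∘to _) (*-congˡ (eq zero))) (fromFin-Σ (f ∘ suc) (g ∘ suc) (h ∘ suc) (eq ∘ suc)))

  fromFin-^ₘ : ∀ {n} (A : Mat n) k i j → fromFin ((A ^ₘ k) i j) ≈ ((λ i j → fromFin (A i j)) M.^ₘ k) i j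
  fromFin-^ₘ A zero i j = fromFin-identity i j
  fromFin-^ₘ A (suc k) i j = fromFin-Σ (A i) (λ t → (A ^ₘ k) t j) (λ t → ((λ i j → fromFin (A i j)) M.^ₘ k) t j) (λ t → fromFin-^ₘ A k t j)

  SumOfPowers-fromFin : ∀ {n} k (M : M.Mat n) → SumOfPowers k (λ i j → toFin (M i j)) → ∃[ A ] ∃[ B ] (M M.≈ₘ ((A M.^ₘ k) M.+ₘ (B M.^ₘ k)))
  SumOfPowers-fromFin k M (A , B , eq) = (λ i j → fromFin (A i j)) , (λ i j → fromFin (B i j)) , λ i j →
    ≈-trans (≈-sym (from∘to (M i j))) (≈-trans (reflexive (cong fromFin (eq i j))) (≈-trans (from∘to _) (+-cong (fromFin-^ₘ A k i j) (fromFin-^ₘ B k i j))))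

-- The characteristic, and non-surjective maps on a finite set.

module Characteristic {q} (F : Field q) where

  open Field F
  open FieldProperties F
  open import Algebra.Properties.Semiring.Sum (CommutativeRing.semiring commutativeRing) using (sum-replicate)
  open ≡-Reasoning

  -- The translation by 1 permutes the field, so it leaves the sum of all elements unchanged,
  -- although it adds 1 to each of the `q` terms.
  q·1≡0 : q · 1# ≡ 0#
  q·1≡0 = begin
    q · 1# ≡⟨ ⊕-cancelʳ (q · 1#) S ⟨
    (q · 1# ⊕ S) ⊕ ⊖ S ≡⟨ cong (_⊕ ⊖ S) shift ⟩
    S ⊕ ⊖ S ≡⟨ -‿inverseʳ S ⟩
    0# ∎
    where
    S = Σ# {q} id
    shift : q · 1# ⊕ S ≡ S
    shift = begin
      q · 1# ⊕ S ≡⟨ +-comm _ _ ⟩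
      S ⊕ q · 1# ≡⟨ cong (S ⊕_) (sym (sum-replicate q)) ⟩
      S ⊕ Σ# {q} (λ _ → 1#) ≡⟨ Σ#-⊕ id (λ _ → 1#) ⟨
      Σ# {q} (λ x → x ⊕ 1#) ≡⟨ Σ#-permute id (permutation (_⊕ 1#) (_⊕ ⊖ 1#) (λ x → ⊖-cancelʳ x 1#) (λ x → ⊕-cancelʳ x 1#)) ⟨
      S ∎

  -- If `p · 1#` were non-zero, so would be its powers, among them `q · 1#`.
  p·1≡0 : ∀ p l → q ≡ p ℕ.^ l → p · 1# ≡ 0#
  p·1≡0 p l refl with p · 1# ≟ 0#
  ... | yes eq = eq
  ... | no neq = ⊥-elim (nonZero l q·1≡0)
    where
    nonZero : ∀ l → (p ℕ.^ l) · 1# ≢ 0#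
    nonZero zero eq = 0≢1 (sym (trans (sym (+-identityʳ 1#)) eq))
    nonZero (suc l) eq = ⊗-nonZero neq (nonZero l) (trans (sym (·1-homo-⊗ p (p ℕ.^ l))) eq)

  k·1≢0 : ∀ {p k} → Coprime p k → p · 1# ≡ 0# → k · 1# ≢ 0#
  k·1≢0 {p} {k} coprime p·1 k·1 = go (coprime-Bézout coprime)
    where
    multiple : ∀ x {a} → a · 1# ≡ 0# → (x ℕ.* a) · 1# ≡ 0#
    multiple x {a} a·1 = trans (·1-homo-⊗ x a) (trans (cong ((x · 1#) ⊗_) a·1) (zeroʳ _))
    contra : ∀ {u v} → u · 1# ≡ 0# → v · 1# ≡ 0# → 1 ℕ.+ u ≢ v
    contra {u} u·1 v·1 refl = 0≢1 (begin
      0# ≡⟨ v·1 ⟨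
      1# ⊕ u · 1# ≡⟨ cong (1# ⊕_) u·1 ⟩
      1# ⊕ 0# ≡⟨ +-identityʳ 1# ⟩
      1# ∎)
    go : ¬ Bézout.Identity.Identity 1 p k
    go (Bézout.+- x y eq) = contra (multiple y k·1) (multiple x p·1) eq
    go (Bézout.-+ x y eq) = contra (multiple x p·1) (multiple y k·1) eq

prime∤⇒coprime : ∀ {p k} → Prime p → ¬ (p ∣ k) → Coprime p k
prime∤⇒coprime pr p∤k (d∣p , d∣k) with prime⇒irreducible pr d∣p
... | inj₁ d≡1 = d≡1
... | inj₂ refl = ⊥-elim (p∤k d∣k)

-- If `g` were onto, it would have an injective section `s`. This chooses only one preimage of the
-- common value, so it misses `x` or `y`; adding the missed point would inject `Fin (suc n)` into
-- `Fin n`.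
missedValue : ∀ {n} (g : Fin n → Fin n) {x y} → x ≢ y → g x ≡ g y → ∃ λ c → ∀ z → g z ≢ c
missedValue {n} g {x} {y} x≢y gx≡gy with any? (λ c → all? (λ z → ¬? (g z ≟ c)))
... | yes found = found
... | no none = ⊥-elim (noCollision (pigeonhole (ℕ.n<1+n n) f))
  where
  preimage : ∀ c → ∃ λ z → g z ≡ c
  preimage c with any? (λ z → g z ≟ c)
  ... | yes found = found
  ... | no ¬found = ⊥-elim (none (c , λ z eq → ¬found (z , eq)))
  s = proj₁ ∘ preimage
  gs : ∀ c → g (s c) ≡ c
  gs = proj₂ ∘ preimage
  unhit : ∃ λ z → ∀ c → s c ≢ z
  unhit with s (g x) ≟ x
  ... | no neq = x , λ c sc≡x → neq (trans (cong s (trans (cong g (sym sc≡x)) (gs c))) sc≡x)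
  ... | yes eq = y , λ c sc≡y → x≢y (trans (sym eq) (trans (cong s (trans gx≡gy (trans (cong g (sym sc≡y)) (gs c)))) sc≡y))
  f : Fin (suc n) → Fin n
  f zero = proj₁ unhit
  f (suc c) = s c
  noCollision : ¬ (∃ λ i → ∃ λ j → i Fin.< j × f i ≡ f j)
  noCollision (zero , suc c , _ , eq) = proj₂ unhit c (sym eq)
  noCollision (suc c , suc c′ , s≤s c<c′ , eq) = ℕ.<-irrefl (cong Fin.toℕ (trans (sym (gs c)) (trans (cong g eq) (gs c′)))) c<c′

-- Tools for extension fields: ring laws, coding of tuples, matrix representations.

module _ {A : Set} {_+_ _*_ : A → A → A} { -_ : A → A} {0# 1# : A} where

  isCommutativeRing-≡ : (∀ x y z → (x + y) + z ≡ x + (y + z)) → (∀ x y → x + y ≡ y + x) → (∀ x → 0# + x ≡ x) → (∀ x → (- x) + x ≡ 0#) →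
    (∀ x y z → (x * y) * z ≡ x * (y * z)) → (∀ x y → x * y ≡ y * x) → (∀ x → 1# * x ≡ x) → (∀ x y z → x * (y + z) ≡ (x * y) + (x * z)) →
    IsCommutativeRing _≡_ _+_ _*_ -_ 0# 1#
  isCommutativeRing-≡ +-assoc +-comm +-idˡ -‿invˡ *-assoc *-comm *-idˡ distribˡ = record
    { isRing = record
      { +-isAbelianGroup = record
        { isGroup = record
          { isMonoid = record
            { isSemigroup = record
              { isMagma = record { isEquivalence = ≡.isEquivalence ; ∙-cong = cong₂ _+_ }
              ; assoc = +-assoc }
            ; identity = +-idˡ , λ x → trans (+-comm x 0#) (+-idˡ x) }
          ; inverse = -‿invˡ , λ x → trans (+-comm x (- x)) (-‿invˡ x)
          ; ⁻¹-cong = cong -_ }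
        ; comm = +-comm }
      ; *-cong = cong₂ _*_
      ; *-assoc = *-assoc
      ; *-identity = *-idˡ , λ x → trans (*-comm x 1#) (*-idˡ x)
      ; distrib = distribˡ , λ x y z → trans (*-comm (y + z) x) (trans (distribˡ x y z) (cong₂ _+_ (*-comm x y) (*-comm x z))) }
    ; *-comm = *-comm }

-- The trailing `zero : Fin 1` matches the unfolding of `q ℕ.^ 2` to `q ℕ.* (q ℕ.* 1)`.
encode₂ : ∀ {q} → Fin q × Fin q → Fin (q ℕ.^ 2)
encode₂ (x , y) = combine x (combine y zero)

decode₂ : ∀ {q} → Fin (q ℕ.^ 2) → Fin q × Fin q
decode₂ {q} i = let (x , r) = remQuot {q} (q ℕ.* 1) i in x , proj₁ (remQuot {q} 1 r)

decode∘encode₂ : ∀ {q} (p : Fin q × Fin q) → decode₂ (encode₂ p) ≡ p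
decode∘encode₂ {q} (x , y) = trans (cong (λ (x′ , r) → x′ , proj₁ (remQuot {q} 1 r)) (remQuot-combine {q} {q ℕ.* 1} x (combine y zero))) (cong (λ p → x , proj₁ p) (remQuot-combine {q} {1} y zero))

encode∘decode₂ : ∀ {q} (i : Fin (q ℕ.^ 2)) → encode₂ (decode₂ {q} i) ≡ i
encode∘decode₂ {q} i = trans (cong (combine (proj₁ p)) (trans (cong (combine (proj₁ (remQuot {q} 1 (proj₂ p)))) (onlyZero _)) (combine-remQuot {q} 1 (proj₂ p)))) (combine-remQuot {q} (q ℕ.* 1) i)
  where
  p = remQuot {q} (q ℕ.* 1) i
  onlyZero : (j : Fin 1) → zero ≡ j
  onlyZero zero = refl

encode₃ : ∀ {q} → Fin q × Fin q × Fin q → Fin (q ℕ.^ 3)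
encode₃ (x , yz) = combine x (encode₂ yz)

decode₃ : ∀ {q} → Fin (q ℕ.^ 3) → Fin q × Fin q × Fin q
decode₃ {q} i = let (x , r) = remQuot {q} (q ℕ.^ 2) i in x , decode₂ r

decode∘encode₃ : ∀ {q} (p : Fin q × Fin q × Fin q) → decode₃ (encode₃ p) ≡ p
decode∘encode₃ {q} (x , yz) = trans (cong (λ (x′ , r) → x′ , decode₂ r) (remQuot-combine {q} {q ℕ.^ 2} x (encode₂ yz))) (cong (x ,_) (decode∘encode₂ yz))

encode∘decode₃ : ∀ {q} (i : Fin (q ℕ.^ 3)) → encode₃ (decode₃ {q} i) ≡ i
encode∘decode₃ {q} i = trans (cong (combine (proj₁ (remQuot {q} (q ℕ.^ 2) i))) (encode∘decode₂ {q} (proj₂ (remQuot {q} (q ℕ.^ 2) i)))) (combine-remQuot {q} (q ℕ.^ 2) i)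

module Representation {q Q} (F : Field q) (E : Field Q) {m : ℕ}
  (ψ : Fin Q → Matrices.Mat (toFiniteField F) m)
  (ψ-⊕ : ∀ x y i j → ψ (Field._⊕_ E x y) i j ≡ Field._⊕_ F (ψ x i j) (ψ y i j))
  (ψ-⊗ : ∀ x y i j → ψ (Field._⊗_ E x y) i j ≡ Matrices._*ₘ_ (toFiniteField F) (ψ x) (ψ y) i j)
  (ψ-1 : ∀ i j → ψ (Field.1# E) i j ≡ MatrixAlgebra.Δ F i j) where

  open MatrixAlgebra F
  open Field E

  ψ-^ : ∀ x k → ψ (x ^ k) ≈ₘ (ψ x ^ₘ k)
  ψ-^ x zero i j = trans (ψ-1 i j) (sym (identity≡Δ i j))
  ψ-^ x (suc k) = ≈ₘ-trans (ψ-⊗ x (x ^ k)) (*ₘ-cong (λ _ _ → refl) (ψ-^ x k))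

  SumOfPowers-ψ : ∀ k → 1 ℕ.≤ k → (gcd k (Q ∸ 1) ∸ 1) ℕ.^ 4 ℕ.< Q → ∀ a → SumOfPowers k (ψ a)
  SumOfPowers-ψ k 1≤k bound a = let (x , y , eq) = PowerSums.sum-of-two-powers E k 1≤k bound a in
    ψ x , ψ y , λ i j → trans (cong (λ z → ψ z i j) eq) (trans (ψ-⊕ (x ^ k) (y ^ k) i j) (cong₂ (Field._⊕_ F) (ψ-^ x k i j) (ψ-^ y k i j)))

-- The quadratic extension and scalar matrices of size 2.

module QuadraticExtension {q} (F : Field q) where

  open Field F
  open FieldProperties F
  open MatrixAlgebra F
  open ≡-Reasoning

  rootless : ∃ λ c → ∀ x → x ⊗ x ⊕ ⊖ x ≢ c
  rootless = missedValue (λ x → x ⊗ x ⊕ ⊖ x) 0≢1 (solve 0 (con 0ℤ :* con 0ℤ :+ :- con 0ℤ := con 1ℤ :* con 1ℤ :+ :- con 1ℤ) refl)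

  c : Fin q
  c = proj₁ rootless

  -- (a , b) stands for a + b x in F[x] / (x² - x - c).
  product : ∀ {A : Set} (_+_ _*_ : A → A → A) → A → A × A → A × A → A × A
  product _+_ _*_ c (a₀ , a₁) (b₀ , b₁) = ((a₀ * b₀) + (c * (a₁ * b₁))) , (((a₀ * b₁) + (a₁ * b₀)) + (a₁ * b₁))

  K : Set
  K = Fin q × Fin q

  _+ₖ_ _*ₖ_ : K → K → K
  (a₀ , a₁) +ₖ (b₀ , b₁) = a₀ ⊕ b₀ , a₁ ⊕ b₁
  _*ₖ_ = product _⊕_ _⊗_ c

  -- Since `product` is generic in its carrier, the same formula is evaluated on solver polynomials,
  -- and each ring law becomes one identity per coordinate.
  isCommutativeRingₖ : IsCommutativeRing _≡_ _+ₖ_ _*ₖ_ (λ (a₀ , a₁) → ⊖ a₀ , ⊖ a₁) (0# , 0#) (1# , 0#)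
  isCommutativeRingₖ = isCommutativeRing-≡
    (λ _ _ _ → cong₂ _,_ (+-assoc _ _ _) (+-assoc _ _ _))
    (λ _ _ → cong₂ _,_ (+-comm _ _) (+-comm _ _))
    (λ _ → cong₂ _,_ (+-identityˡ _) (+-identityˡ _))
    (λ _ → cong₂ _,_ (-‿inverseˡ _) (-‿inverseˡ _))
    (λ (a₀ , a₁) (b₀ , b₁) (d₀ , d₁) → cong₂ _,_
      (solve 7 (λ c a₀ a₁ b₀ b₁ d₀ d₁ → proj₁ (product _:+_ _:*_ c (product _:+_ _:*_ c (a₀ , a₁) (b₀ , b₁)) (d₀ , d₁)) := proj₁ (product _:+_ _:*_ c (a₀ , a₁) (product _:+_ _:*_ c (b₀ , b₁) (d₀ , d₁)))) refl c a₀ a₁ b₀ b₁ d₀ d₁)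
      (solve 7 (λ c a₀ a₁ b₀ b₁ d₀ d₁ → proj₂ (product _:+_ _:*_ c (product _:+_ _:*_ c (a₀ , a₁) (b₀ , b₁)) (d₀ , d₁)) := proj₂ (product _:+_ _:*_ c (a₀ , a₁) (product _:+_ _:*_ c (b₀ , b₁) (d₀ , d₁)))) refl c a₀ a₁ b₀ b₁ d₀ d₁))
    (λ (a₀ , a₁) (b₀ , b₁) → cong₂ _,_
      (solve 5 (λ c a₀ a₁ b₀ b₁ → proj₁ (product _:+_ _:*_ c (a₀ , a₁) (b₀ , b₁)) := proj₁ (product _:+_ _:*_ c (b₀ , b₁) (a₀ , a₁))) refl c a₀ a₁ b₀ b₁)
      (solve 5 (λ c a₀ a₁ b₀ b₁ → proj₂ (product _:+_ _:*_ c (a₀ , a₁) (b₀ , b₁)) := proj₂ (product _:+_ _:*_ c (b₀ , b₁) (a₀ , a₁))) refl c a₀ a₁ b₀ b₁))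
    (λ (a₀ , a₁) → cong₂ _,_
      (solve 3 (λ c a₀ a₁ → proj₁ (product _:+_ _:*_ c (con 1ℤ , con 0ℤ) (a₀ , a₁)) := a₀) refl c a₀ a₁)
      (solve 3 (λ c a₀ a₁ → proj₂ (product _:+_ _:*_ c (con 1ℤ , con 0ℤ) (a₀ , a₁)) := a₁) refl c a₀ a₁))
    (λ (a₀ , a₁) (b₀ , b₁) (d₀ , d₁) → cong₂ _,_
      (solve 7 (λ c a₀ a₁ b₀ b₁ d₀ d₁ → proj₁ (product _:+_ _:*_ c (a₀ , a₁) (b₀ :+ d₀ , b₁ :+ d₁)) := proj₁ (product _:+_ _:*_ c (a₀ , a₁) (b₀ , b₁)) :+ proj₁ (product _:+_ _:*_ c (a₀ , a₁) (d₀ , d₁))) refl c a₀ a₁ b₀ b₁ d₀ d₁)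
      (solve 7 (λ c a₀ a₁ b₀ b₁ d₀ d₁ → proj₂ (product _:+_ _:*_ c (a₀ , a₁) (b₀ :+ d₀ , b₁ :+ d₁)) := proj₂ (product _:+_ _:*_ c (a₀ , a₁) (b₀ , b₁)) :+ proj₂ (product _:+_ _:*_ c (a₀ , a₁) (d₀ , d₁))) refl c a₀ a₁ b₀ b₁ d₀ d₁))

  -- The product of `a₀ + a₁ x` with its conjugate `a₀ + a₁ (1 - x)`, as the roots of `x² - x - c`
  -- add up to 1.
  norm : K → Fin q
  norm (a₀ , a₁) = a₀ ⊗ (a₀ ⊕ a₁) ⊕ ⊖ (c ⊗ (a₁ ⊗ a₁))

  -- For `a₁ ≠ 0` let `r = - a₀ / a₁` be the zero of the linear polynomial. The norm is
  -- `a₁² (r² - r - c)`, and `c` is a missed value.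
  norm-nonZero : ∀ x → x ≢ (0# , 0#) → norm x ≢ 0#
  norm-nonZero (a₀ , a₁) x≢0 N≡0 with a₁ ≟ 0#
  ... | yes refl = ⊗-nonZero a₀≢0 a₀≢0 (trans (solve 2 (λ a c → a :* a := a :* (a :+ con 0ℤ) :+ :- (c :* (con 0ℤ :* con 0ℤ))) refl a₀ c) N≡0)
    where
    a₀≢0 : a₀ ≢ 0#
    a₀≢0 refl = x≢0 refl
  ... | no a₁≢0 = proj₂ rootless r (sym (x⊖y≡0⇒x≡y (⊗-cancelˡ (⊗-nonZero a₁≢0 a₁≢0) (begin
    (a₁ ⊗ a₁) ⊗ (c ⊕ ⊖ (r ⊗ r ⊕ ⊖ r)) ≡⟨ solve 3 (λ a r c → (a :* a) :* (c :+ :- (r :* r :+ :- r)) := :- ((:- (a :* r)) :* (:- (a :* r) :+ a) :+ :- (c :* (a :* a)))) refl a₁ r c ⟩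
    ⊖ ((⊖ (a₁ ⊗ r)) ⊗ (⊖ (a₁ ⊗ r) ⊕ a₁) ⊕ ⊖ (c ⊗ (a₁ ⊗ a₁))) ≡⟨ cong (λ z → ⊖ (z ⊗ (z ⊕ a₁) ⊕ ⊖ (c ⊗ (a₁ ⊗ a₁)))) -a₁r≡a₀ ⟩
    ⊖ norm (a₀ , a₁) ≡⟨ cong ⊖_ N≡0 ⟩
    ⊖ 0# ≡⟨ solve 1 (λ z → :- con 0ℤ := z :* con 0ℤ) refl (a₁ ⊗ a₁) ⟩
    (a₁ ⊗ a₁) ⊗ 0# ∎))))
    where
    r = ⊖ (inv a₁ ⊗ a₀)
    -a₁r≡a₀ : ⊖ (a₁ ⊗ r) ≡ a₀
    -a₁r≡a₀ = trans (solve 2 (λ a z → :- (a :* :- z) := a :* z) refl a₁ (inv a₁ ⊗ a₀)) (inv-cancelʳ a₁≢0 a₀)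

  inverseₖ : ∀ x → x ≢ (0# , 0#) → ∃ λ y → x *ₖ y ≡ (1# , 0#)
  inverseₖ x@(a₀ , a₁) x≢0 = (i ⊗ (a₀ ⊕ a₁) , i ⊗ (⊖ a₁)) , cong₂ _,_
    (trans (solve 4 (λ c a₀ a₁ i → proj₁ (product _:+_ _:*_ c (a₀ , a₁) (i :* (a₀ :+ a₁) , i :* (:- a₁))) := (a₀ :* (a₀ :+ a₁) :+ :- (c :* (a₁ :* a₁))) :* i) refl c a₀ a₁ i) (inv-inverseʳ (norm-nonZero x x≢0)))
    (solve 4 (λ c a₀ a₁ i → proj₂ (product _:+_ _:*_ c (a₀ , a₁) (i :* (a₀ :+ a₁) , i :* (:- a₁))) := con 0ℤ) refl c a₀ a₁ i)
    where i = inv (norm x)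

  extension : FiniteField 0ℓ 0ℓ (q ℕ.^ 2)
  extension = record
    { commRing = record { isCommutativeRing = isCommutativeRingₖ }
    ; 0≉1 = λ eq → 0≢1 (cong proj₁ eq)
    ; inverse = inverseₖ
    ; toFin = encode₂ ; fromFin = decode₂ ; toFin-cong = cong encode₂
    ; from∘to = decode∘encode₂ ; to∘from = encode∘decode₂ {q} }

  open Normalisation extension using (normalise)

  -- The columns are the images of the basis `1 , x` under multiplication by `a₀ + a₁ x`.
  φ : K → Mat 2
  φ (a₀ , a₁) zero zero = a₀
  φ (a₀ , a₁) zero (suc zero) = c ⊗ a₁
  φ (a₀ , a₁) (suc zero) zero = a₁
  φ (a₀ , a₁) (suc zero) (suc zero) = a₀ ⊕ a₁

  φ-+ : ∀ x y → φ (x +ₖ y) ≈ₘ (φ x +ₘ φ y)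
  φ-+ x y zero zero = refl
  φ-+ (a₀ , a₁) (b₀ , b₁) zero (suc zero) = distribˡ c a₁ b₁
  φ-+ x y (suc zero) zero = refl
  φ-+ (a₀ , a₁) (b₀ , b₁) (suc zero) (suc zero) = solve 4 (λ a b c d → (a :+ c) :+ (b :+ d) := (a :+ b) :+ (c :+ d)) refl a₀ a₁ b₀ b₁

  φ-* : ∀ x y → φ (x *ₖ y) ≈ₘ (φ x *ₘ φ y)
  φ-* (a₀ , a₁) (b₀ , b₁) zero zero = solve 5 (λ c a₀ a₁ b₀ b₁ → proj₁ (product _:+_ _:*_ c (a₀ , a₁) (b₀ , b₁)) := a₀ :* b₀ :+ ((c :* a₁) :* b₁ :+ con 0ℤ)) refl c a₀ a₁ b₀ b₁
  φ-* (a₀ , a₁) (b₀ , b₁) zero (suc zero) = solve 5 (λ c a₀ a₁ b₀ b₁ → c :* proj₂ (product _:+_ _:*_ c (a₀ , a₁) (b₀ , b₁)) := a₀ :* (c :* b₁) :+ ((c :* a₁) :* (b₀ :+ b₁) :+ con 0ℤ)) refl c a₀ a₁ b₀ b₁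
  φ-* (a₀ , a₁) (b₀ , b₁) (suc zero) zero = solve 5 (λ c a₀ a₁ b₀ b₁ → proj₂ (product _:+_ _:*_ c (a₀ , a₁) (b₀ , b₁)) := a₁ :* b₀ :+ ((a₀ :+ a₁) :* b₁ :+ con 0ℤ)) refl c a₀ a₁ b₀ b₁
  φ-* (a₀ , a₁) (b₀ , b₁) (suc zero) (suc zero) = solve 5 (λ c a₀ a₁ b₀ b₁ → proj₁ (product _:+_ _:*_ c (a₀ , a₁) (b₀ , b₁)) :+ proj₂ (product _:+_ _:*_ c (a₀ , a₁) (b₀ , b₁)) := a₁ :* (c :* b₁) :+ ((a₀ :+ a₁) :* (b₀ :+ b₁) :+ con 0ℤ)) refl c a₀ a₁ b₀ b₁

  φ-scalar : ∀ a i j → φ (a , 0#) i j ≡ Δ i j ⊗ a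
  φ-scalar a zero zero = sym (*-identityˡ a)
  φ-scalar a zero (suc zero) = trans (zeroʳ c) (sym (zeroˡ a))
  φ-scalar a (suc zero) zero = sym (zeroˡ a)
  φ-scalar a (suc zero) (suc zero) = trans (+-identityʳ a) (sym (*-identityˡ a))

  SumOfPowers-scalar : ∀ k → 1 ℕ.≤ k → (gcd k (q ℕ.^ 2 ∸ 1) ∸ 1) ℕ.^ 4 ℕ.< q ℕ.^ 2 → ∀ a → SumOfPowers {2} k (λ i j → Δ i j ⊗ a)
  SumOfPowers-scalar k 1≤k bound a = let (A , B , eq) = SumOfPowers-ψ k 1≤k bound (encode₂ (a , 0#)) in
    A , B , λ i j → trans (sym (trans (cong (λ z → φ z i j) (decode∘encode₂ (a , 0#))) (φ-scalar a i j))) (eq i j)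
    where
    open Representation F normalise (φ ∘ decode₂)
      (λ x y i j → trans (cong (λ z → φ z i j) (decode∘encode₂ (decode₂ x +ₖ decode₂ y))) (φ-+ (decode₂ x) (decode₂ y) i j))
      (λ x y i j → trans (cong (λ z → φ z i j) (decode∘encode₂ (decode₂ x *ₖ decode₂ y))) (φ-* (decode₂ x) (decode₂ y) i j))
      (λ i j → trans (cong (λ z → φ z i j) (decode∘encode₂ (1# , 0#))) (trans (φ-scalar 1# i j) (*-identityʳ (Δ i j))))

-- The cubic extension and scalar matrices of size 3.

module CubicExtension {q} (F : Field q) where

  open Field F
  open FieldProperties F
  open MatrixAlgebra F
  open ≡-Reasoning

  rootless : ∃ λ c → ∀ x → x ⊗ x ⊗ x ⊕ ⊖ x ≢ c
  rootless = missedValue (λ x → x ⊗ x ⊗ x ⊕ ⊖ x) 0≢1 (solve 0 (con 0ℤ :* con 0ℤ :* con 0ℤ :+ :- con 0ℤ := con 1ℤ :* con 1ℤ :* con 1ℤ :+ :- con 1ℤ) refl)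

  c : Fin q
  c = proj₁ rootless

  -- (a₀ , a₁ , a₂) stands for a₀ + a₁ x + a₂ x² in F[x] / (x³ - x - c).
  product : ∀ {A : Set} (_+_ _*_ : A → A → A) → A → A × A × A → A × A × A → A × A × A
  product _+_ _*_ c (a₀ , a₁ , a₂) (b₀ , b₁ , b₂) =
    ((a₀ * b₀) + (c * s)) , ((((a₀ * b₁) + (a₁ * b₀)) + s) + (c * (a₂ * b₂))) , ((((a₀ * b₂) + (a₁ * b₁)) + (a₂ * b₀)) + (a₂ * b₂))
    where s = (a₁ * b₂) + (a₂ * b₁)

  K : Set
  K = Fin q × Fin q × Fin q

  0ₖ 1ₖ : K
  0ₖ = 0# , 0# , 0#
  1ₖ = 1# , 0# , 0#

  _+ₖ_ _*ₖ_ : K → K → K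
  (a₀ , a₁ , a₂) +ₖ (b₀ , b₁ , b₂) = a₀ ⊕ b₀ , a₁ ⊕ b₁ , a₂ ⊕ b₂
  _*ₖ_ = product _⊕_ _⊗_ c

  ≡₃ : ∀ {x y z x′ y′ z′ : Fin q} → x ≡ x′ → y ≡ y′ → z ≡ z′ → (x , y , z) ≡ (x′ , y′ , z′)
  ≡₃ refl refl refl = refl

  isCommutativeRingₖ : IsCommutativeRing _≡_ _+ₖ_ _*ₖ_ (λ (a₀ , a₁ , a₂) → ⊖ a₀ , ⊖ a₁ , ⊖ a₂) 0ₖ 1ₖ
  isCommutativeRingₖ = isCommutativeRing-≡
    (λ _ _ _ → ≡₃ (+-assoc _ _ _) (+-assoc _ _ _) (+-assoc _ _ _))
    (λ _ _ → ≡₃ (+-comm _ _) (+-comm _ _) (+-comm _ _))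
    (λ _ → ≡₃ (+-identityˡ _) (+-identityˡ _) (+-identityˡ _))
    (λ _ → ≡₃ (-‿inverseˡ _) (-‿inverseˡ _) (-‿inverseˡ _))
    (λ (a₀ , a₁ , a₂) (b₀ , b₁ , b₂) (d₀ , d₁ , d₂) → ≡₃
      (solve 10 (λ c a₀ a₁ a₂ b₀ b₁ b₂ d₀ d₁ d₂ → proj₁ (product _:+_ _:*_ c (product _:+_ _:*_ c (a₀ , a₁ , a₂) (b₀ , b₁ , b₂)) (d₀ , d₁ , d₂)) := proj₁ (product _:+_ _:*_ c (a₀ , a₁ , a₂) (product _:+_ _:*_ c (b₀ , b₁ , b₂) (d₀ , d₁ , d₂)))) refl c a₀ a₁ a₂ b₀ b₁ b₂ d₀ d₁ d₂)
      (solve 10 (λ c a₀ a₁ a₂ b₀ b₁ b₂ d₀ d₁ d₂ → proj₁ (proj₂ (product _:+_ _:*_ c (product _:+_ _:*_ c (a₀ , a₁ , a₂) (b₀ , b₁ , b₂)) (d₀ , d₁ , d₂))) := proj₁ (proj₂ (product _:+_ _:*_ c (a₀ , a₁ , a₂) (product _:+_ _:*_ c (b₀ , b₁ , b₂) (d₀ , d₁ , d₂))))) refl c a₀ a₁ a₂ b₀ b₁ b₂ d₀ d₁ d₂)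
      (solve 10 (λ c a₀ a₁ a₂ b₀ b₁ b₂ d₀ d₁ d₂ → proj₂ (proj₂ (product _:+_ _:*_ c (product _:+_ _:*_ c (a₀ , a₁ , a₂) (b₀ , b₁ , b₂)) (d₀ , d₁ , d₂))) := proj₂ (proj₂ (product _:+_ _:*_ c (a₀ , a₁ , a₂) (product _:+_ _:*_ c (b₀ , b₁ , b₂) (d₀ , d₁ , d₂))))) refl c a₀ a₁ a₂ b₀ b₁ b₂ d₀ d₁ d₂))
    (λ (a₀ , a₁ , a₂) (b₀ , b₁ , b₂) → ≡₃
      (solve 7 (λ c a₀ a₁ a₂ b₀ b₁ b₂ → proj₁ (product _:+_ _:*_ c (a₀ , a₁ , a₂) (b₀ , b₁ , b₂)) := proj₁ (product _:+_ _:*_ c (b₀ , b₁ , b₂) (a₀ , a₁ , a₂))) refl c a₀ a₁ a₂ b₀ b₁ b₂)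
      (solve 7 (λ c a₀ a₁ a₂ b₀ b₁ b₂ → proj₁ (proj₂ (product _:+_ _:*_ c (a₀ , a₁ , a₂) (b₀ , b₁ , b₂))) := proj₁ (proj₂ (product _:+_ _:*_ c (b₀ , b₁ , b₂) (a₀ , a₁ , a₂)))) refl c a₀ a₁ a₂ b₀ b₁ b₂)
      (solve 7 (λ c a₀ a₁ a₂ b₀ b₁ b₂ → proj₂ (proj₂ (product _:+_ _:*_ c (a₀ , a₁ , a₂) (b₀ , b₁ , b₂))) := proj₂ (proj₂ (product _:+_ _:*_ c (b₀ , b₁ , b₂) (a₀ , a₁ , a₂)))) refl c a₀ a₁ a₂ b₀ b₁ b₂))
    (λ (a₀ , a₁ , a₂) → ≡₃
      (solve 4 (λ c a₀ a₁ a₂ → proj₁ (product _:+_ _:*_ c (con 1ℤ , con 0ℤ , con 0ℤ) (a₀ , a₁ , a₂)) := a₀) refl c a₀ a₁ a₂)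
      (solve 4 (λ c a₀ a₁ a₂ → proj₁ (proj₂ (product _:+_ _:*_ c (con 1ℤ , con 0ℤ , con 0ℤ) (a₀ , a₁ , a₂))) := a₁) refl c a₀ a₁ a₂)
      (solve 4 (λ c a₀ a₁ a₂ → proj₂ (proj₂ (product _:+_ _:*_ c (con 1ℤ , con 0ℤ , con 0ℤ) (a₀ , a₁ , a₂))) := a₂) refl c a₀ a₁ a₂))
    (λ (a₀ , a₁ , a₂) (b₀ , b₁ , b₂) (d₀ , d₁ , d₂) → ≡₃
      (solve 10 (λ c a₀ a₁ a₂ b₀ b₁ b₂ d₀ d₁ d₂ → proj₁ (product _:+_ _:*_ c (a₀ , a₁ , a₂) (b₀ :+ d₀ , b₁ :+ d₁ , b₂ :+ d₂)) := proj₁ (product _:+_ _:*_ c (a₀ , a₁ , a₂) (b₀ , b₁ , b₂)) :+ proj₁ (product _:+_ _:*_ c (a₀ , a₁ , a₂) (d₀ , d₁ , d₂))) refl c a₀ a₁ a₂ b₀ b₁ b₂ d₀ d₁ d₂)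
      (solve 10 (λ c a₀ a₁ a₂ b₀ b₁ b₂ d₀ d₁ d₂ → proj₁ (proj₂ (product _:+_ _:*_ c (a₀ , a₁ , a₂) (b₀ :+ d₀ , b₁ :+ d₁ , b₂ :+ d₂))) := proj₁ (proj₂ (product _:+_ _:*_ c (a₀ , a₁ , a₂) (b₀ , b₁ , b₂))) :+ proj₁ (proj₂ (product _:+_ _:*_ c (a₀ , a₁ , a₂) (d₀ , d₁ , d₂)))) refl c a₀ a₁ a₂ b₀ b₁ b₂ d₀ d₁ d₂)
      (solve 10 (λ c a₀ a₁ a₂ b₀ b₁ b₂ d₀ d₁ d₂ → proj₂ (proj₂ (product _:+_ _:*_ c (a₀ , a₁ , a₂) (b₀ :+ d₀ , b₁ :+ d₁ , b₂ :+ d₂))) := proj₂ (proj₂ (product _:+_ _:*_ c (a₀ , a₁ , a₂) (b₀ , b₁ , b₂))) :+ proj₂ (proj₂ (product _:+_ _:*_ c (a₀ , a₁ , a₂) (d₀ , d₁ , d₂)))) refl c a₀ a₁ a₂ b₀ b₁ b₂ d₀ d₁ d₂))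

  open IsCommutativeRing isCommutativeRingₖ using () renaming (*-assoc to *ₖ-assoc; *-comm to *ₖ-comm)

  -- Inverses are obtained by lowering the degree of the element, not from the norm, which here
  -- would be a cubic form in three variables.
  Unit : K → Set
  Unit x = ∃ λ y → x *ₖ y ≡ 1ₖ

  -- Permits multiplication by any convenient `h` that reduces `x` to an element of lower degree.
  unit-factor : ∀ h {x} → Unit (h *ₖ x) → Unit x
  unit-factor h {x} (y , eq) = h *ₖ y , trans (sym (*ₖ-assoc x h y)) (trans (cong (_*ₖ y) (*ₖ-comm x h)) eq)

  unit-constant : ∀ {a} → a ≢ 0# → Unit (a , 0# , 0#)
  unit-constant {a} a≢0 = (inv a , 0# , 0#) , trans (≡₃
      (solve 3 (λ c a i → proj₁ (product _:+_ _:*_ c (a , con 0ℤ , con 0ℤ) (i , con 0ℤ , con 0ℤ)) := a :* i) refl c a (inv a))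
      (solve 3 (λ c a i → proj₁ (proj₂ (product _:+_ _:*_ c (a , con 0ℤ , con 0ℤ) (i , con 0ℤ , con 0ℤ))) := con 0ℤ) refl c a (inv a))
      (solve 3 (λ c a i → proj₂ (proj₂ (product _:+_ _:*_ c (a , con 0ℤ , con 0ℤ) (i , con 0ℤ , con 0ℤ))) := con 0ℤ) refl c a (inv a)))
    (cong (λ z → z , 0# , 0#) (inv-inverseʳ a≢0))

  -- (x - r) (x² + r x + r² - 1) = c - (r³ - r).
  unit-linear : ∀ {a b} → b ≢ 0# → Unit (a , b , 0#)
  unit-linear {a} {b} b≢0 = unit-factor (r ⊗ r ⊕ ⊖ 1# , r , 1#) (subst Unit (sym eq) (unit-constant (⊗-nonZero b≢0 (λ z → proj₂ rootless r (sym (x⊖y≡0⇒x≡y z))))))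
    where
    r = ⊖ (inv b ⊗ a)
    a≡ : a ≡ ⊖ (b ⊗ r)
    a≡ = sym (trans (solve 2 (λ b z → :- (b :* :- z) := b :* z) refl b (inv b ⊗ a)) (inv-cancelʳ b≢0 a))
    eq : (r ⊗ r ⊕ ⊖ 1# , r , 1#) *ₖ (a , b , 0#) ≡ (b ⊗ (c ⊕ ⊖ (r ⊗ r ⊗ r ⊕ ⊖ r)) , 0# , 0#)
    eq = trans (cong (λ z → (r ⊗ r ⊕ ⊖ 1# , r , 1#) *ₖ (z , b , 0#)) a≡) (≡₃
      (solve 3 (λ c b r → proj₁ (product _:+_ _:*_ c (r :* r :+ :- con 1ℤ , r , con 1ℤ) (:- (b :* r) , b , con 0ℤ)) := b :* (c :+ :- (r :* r :* r :+ :- r))) refl c b r)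
      (solve 3 (λ c b r → proj₁ (proj₂ (product _:+_ _:*_ c (r :* r :+ :- con 1ℤ , r , con 1ℤ) (:- (b :* r) , b , con 0ℤ))) := con 0ℤ) refl c b r)
      (solve 3 (λ c b r → proj₂ (proj₂ (product _:+_ _:*_ c (r :* r :+ :- con 1ℤ , r , con 1ℤ) (:- (b :* r) , b , con 0ℤ))) := con 0ℤ) refl c b r))

  -- With a₁ = u a₂, the product (x - u) (a₂ x² + a₁ x + a₀) has degree at most 1, and it vanishes only if u is a root.
  unit-quadratic : ∀ {a₀ a₁ a₂} → a₂ ≢ 0# → Unit (a₀ , a₁ , a₂)
  unit-quadratic {a₀} {a₁} {a₂} a₂≢0 = unit-factor (⊖ u , 1# , 0#) (subst Unit (sym eq) lowDegree)
    where
    u = inv a₂ ⊗ a₁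
    a₁≡ : a₁ ≡ a₂ ⊗ u
    a₁≡ = sym (inv-cancelʳ a₂≢0 a₁)
    e₀ = c ⊗ a₂ ⊕ ⊖ (u ⊗ a₀)
    e₁ = (a₂ ⊕ a₀) ⊕ ⊖ (u ⊗ (a₂ ⊗ u))
    eq : (⊖ u , 1# , 0#) *ₖ (a₀ , a₁ , a₂) ≡ (e₀ , e₁ , 0#)
    eq = trans (cong (λ z → (⊖ u , 1# , 0#) *ₖ (a₀ , z , a₂)) a₁≡) (≡₃
      (solve 4 (λ c u a₀ a₂ → proj₁ (product _:+_ _:*_ c (:- u , con 1ℤ , con 0ℤ) (a₀ , a₂ :* u , a₂)) := c :* a₂ :+ :- (u :* a₀)) refl c u a₀ a₂)
      (solve 4 (λ c u a₀ a₂ → proj₁ (proj₂ (product _:+_ _:*_ c (:- u , con 1ℤ , con 0ℤ) (a₀ , a₂ :* u , a₂))) := (a₂ :+ a₀) :+ :- (u :* (a₂ :* u))) refl c u a₀ a₂)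
      (solve 4 (λ c u a₀ a₂ → proj₂ (proj₂ (product _:+_ _:*_ c (:- u , con 1ℤ , con 0ℤ) (a₀ , a₂ :* u , a₂))) := con 0ℤ) refl c u a₀ a₂))
    lowDegree : Unit (e₀ , e₁ , 0#)
    lowDegree with e₁ ≟ 0#
    ... | no e₁≢0 = unit-linear e₁≢0
    ... | yes e₁≡0 = subst (λ z → Unit (e₀ , z , 0#)) (sym e₁≡0) (unit-constant e₀≢0)
      where
      e₀≢0 : e₀ ≢ 0#
      e₀≢0 e₀≡0 = proj₂ rootless u (sym (x⊖y≡0⇒x≡y (⊗-cancelˡ a₂≢0 (begin
        a₂ ⊗ (c ⊕ ⊖ (u ⊗ u ⊗ u ⊕ ⊖ u)) ≡⟨ solve 4 (λ c u a₀ a₂ → a₂ :* (c :+ :- (u :* u :* u :+ :- u)) := (c :* a₂ :+ :- (u :* a₀)) :+ u :* ((a₂ :+ a₀) :+ :- (u :* (a₂ :* u)))) refl c u a₀ a₂ ⟩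
        e₀ ⊕ u ⊗ e₁ ≡⟨ cong₂ (λ y z → y ⊕ u ⊗ z) e₀≡0 e₁≡0 ⟩
        0# ⊕ u ⊗ 0# ≡⟨ solve 2 (λ u a → con 0ℤ :+ u :* con 0ℤ := a :* con 0ℤ) refl u a₂ ⟩
        a₂ ⊗ 0# ∎))))

  inverseₖ : ∀ x → x ≢ 0ₖ → Unit x
  inverseₖ (a₀ , a₁ , a₂) x≢0 with a₂ ≟ 0# | a₁ ≟ 0# | a₀ ≟ 0#
  ... | no a₂≢0 | _ | _ = unit-quadratic a₂≢0
  ... | yes refl | no a₁≢0 | _ = unit-linear a₁≢0
  ... | yes refl | yes refl | no a₀≢0 = unit-constant a₀≢0
  ... | yes refl | yes refl | yes refl = ⊥-elim (x≢0 refl)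

  extension : FiniteField 0ℓ 0ℓ (q ℕ.^ 3)
  extension = record
    { commRing = record { isCommutativeRing = isCommutativeRingₖ }
    ; 0≉1 = λ eq → 0≢1 (cong proj₁ eq)
    ; inverse = inverseₖ
    ; toFin = encode₃ ; fromFin = decode₃ ; toFin-cong = cong encode₃
    ; from∘to = decode∘encode₃ ; to∘from = encode∘decode₃ {q} }

  open Normalisation extension using (normalise)

  -- The columns are the images of `1 , x , x²` under multiplication, reduced by `x³ = x + c`.
  φ : K → Mat 3
  φ (a₀ , a₁ , a₂) zero zero = a₀
  φ (a₀ , a₁ , a₂) zero (suc zero) = c ⊗ a₂
  φ (a₀ , a₁ , a₂) zero (suc (suc zero)) = c ⊗ a₁
  φ (a₀ , a₁ , a₂) (suc zero) zero = a₁
  φ (a₀ , a₁ , a₂) (suc zero) (suc zero) = a₀ ⊕ a₂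
  φ (a₀ , a₁ , a₂) (suc zero) (suc (suc zero)) = a₁ ⊕ (c ⊗ a₂)
  φ (a₀ , a₁ , a₂) (suc (suc zero)) zero = a₂
  φ (a₀ , a₁ , a₂) (suc (suc zero)) (suc zero) = a₁
  φ (a₀ , a₁ , a₂) (suc (suc zero)) (suc (suc zero)) = a₀ ⊕ a₂

  φ-+ : ∀ x y → φ (x +ₖ y) ≈ₘ (φ x +ₘ φ y)
  φ-+ (a₀ , a₁ , a₂) (b₀ , b₁ , b₂) zero zero = solve 7 (λ c a₀ a₁ a₂ b₀ b₁ b₂ → (a₀ :+ b₀) := a₀ :+ b₀) refl c a₀ a₁ a₂ b₀ b₁ b₂
  φ-+ (a₀ , a₁ , a₂) (b₀ , b₁ , b₂) zero (suc zero) = solve 7 (λ c a₀ a₁ a₂ b₀ b₁ b₂ → (c :* (a₂ :+ b₂)) := (c :* a₂) :+ (c :* b₂)) refl c a₀ a₁ a₂ b₀ b₁ b₂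
  φ-+ (a₀ , a₁ , a₂) (b₀ , b₁ , b₂) zero (suc (suc zero)) = solve 7 (λ c a₀ a₁ a₂ b₀ b₁ b₂ → (c :* (a₁ :+ b₁)) := (c :* a₁) :+ (c :* b₁)) refl c a₀ a₁ a₂ b₀ b₁ b₂
  φ-+ (a₀ , a₁ , a₂) (b₀ , b₁ , b₂) (suc zero) zero = solve 7 (λ c a₀ a₁ a₂ b₀ b₁ b₂ → (a₁ :+ b₁) := a₁ :+ b₁) refl c a₀ a₁ a₂ b₀ b₁ b₂
  φ-+ (a₀ , a₁ , a₂) (b₀ , b₁ , b₂) (suc zero) (suc zero) = solve 7 (λ c a₀ a₁ a₂ b₀ b₁ b₂ → ((a₀ :+ b₀) :+ (a₂ :+ b₂)) := (a₀ :+ a₂) :+ (b₀ :+ b₂)) refl c a₀ a₁ a₂ b₀ b₁ b₂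
  φ-+ (a₀ , a₁ , a₂) (b₀ , b₁ , b₂) (suc zero) (suc (suc zero)) = solve 7 (λ c a₀ a₁ a₂ b₀ b₁ b₂ → ((a₁ :+ b₁) :+ (c :* (a₂ :+ b₂))) := (a₁ :+ (c :* a₂)) :+ (b₁ :+ (c :* b₂))) refl c a₀ a₁ a₂ b₀ b₁ b₂
  φ-+ (a₀ , a₁ , a₂) (b₀ , b₁ , b₂) (suc (suc zero)) zero = solve 7 (λ c a₀ a₁ a₂ b₀ b₁ b₂ → (a₂ :+ b₂) := a₂ :+ b₂) refl c a₀ a₁ a₂ b₀ b₁ b₂
  φ-+ (a₀ , a₁ , a₂) (b₀ , b₁ , b₂) (suc (suc zero)) (suc zero) = solve 7 (λ c a₀ a₁ a₂ b₀ b₁ b₂ → (a₁ :+ b₁) := a₁ :+ b₁) refl c a₀ a₁ a₂ b₀ b₁ b₂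
  φ-+ (a₀ , a₁ , a₂) (b₀ , b₁ , b₂) (suc (suc zero)) (suc (suc zero)) = solve 7 (λ c a₀ a₁ a₂ b₀ b₁ b₂ → ((a₀ :+ b₀) :+ (a₂ :+ b₂)) := (a₀ :+ a₂) :+ (b₀ :+ b₂)) refl c a₀ a₁ a₂ b₀ b₁ b₂

  φ-* : ∀ x y → φ (x *ₖ y) ≈ₘ (φ x *ₘ φ y)
  φ-* (a₀ , a₁ , a₂) (b₀ , b₁ , b₂) zero zero = solve 7 (λ c a₀ a₁ a₂ b₀ b₁ b₂ → (proj₁ (product _:+_ _:*_ c (a₀ , a₁ , a₂) (b₀ , b₁ , b₂))) := a₀ :* b₀ :+ ((c :* a₂) :* b₁ :+ ((c :* a₁) :* b₂ :+ con 0ℤ))) refl c a₀ a₁ a₂ b₀ b₁ b₂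
  φ-* (a₀ , a₁ , a₂) (b₀ , b₁ , b₂) zero (suc zero) = solve 7 (λ c a₀ a₁ a₂ b₀ b₁ b₂ → (c :* (proj₂ (proj₂ (product _:+_ _:*_ c (a₀ , a₁ , a₂) (b₀ , b₁ , b₂))))) := a₀ :* (c :* b₂) :+ ((c :* a₂) :* (b₀ :+ b₂) :+ ((c :* a₁) :* b₁ :+ con 0ℤ))) refl c a₀ a₁ a₂ b₀ b₁ b₂
  φ-* (a₀ , a₁ , a₂) (b₀ , b₁ , b₂) zero (suc (suc zero)) = solve 7 (λ c a₀ a₁ a₂ b₀ b₁ b₂ → (c :* (proj₁ (proj₂ (product _:+_ _:*_ c (a₀ , a₁ , a₂) (b₀ , b₁ , b₂))))) := a₀ :* (c :* b₁) :+ ((c :* a₂) :* (b₁ :+ (c :* b₂)) :+ ((c :* a₁) :* (b₀ :+ b₂) :+ con 0ℤ))) refl c a₀ a₁ a₂ b₀ b₁ b₂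
  φ-* (a₀ , a₁ , a₂) (b₀ , b₁ , b₂) (suc zero) zero = solve 7 (λ c a₀ a₁ a₂ b₀ b₁ b₂ → (proj₁ (proj₂ (product _:+_ _:*_ c (a₀ , a₁ , a₂) (b₀ , b₁ , b₂)))) := a₁ :* b₀ :+ ((a₀ :+ a₂) :* b₁ :+ ((a₁ :+ (c :* a₂)) :* b₂ :+ con 0ℤ))) refl c a₀ a₁ a₂ b₀ b₁ b₂
  φ-* (a₀ , a₁ , a₂) (b₀ , b₁ , b₂) (suc zero) (suc zero) = solve 7 (λ c a₀ a₁ a₂ b₀ b₁ b₂ → ((proj₁ (product _:+_ _:*_ c (a₀ , a₁ , a₂) (b₀ , b₁ , b₂))) :+ (proj₂ (proj₂ (product _:+_ _:*_ c (a₀ , a₁ , a₂) (b₀ , b₁ , b₂))))) := a₁ :* (c :* b₂) :+ ((a₀ :+ a₂) :* (b₀ :+ b₂) :+ ((a₁ :+ (c :* a₂)) :* b₁ :+ con 0ℤ))) refl c a₀ a₁ a₂ b₀ b₁ b₂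
  φ-* (a₀ , a₁ , a₂) (b₀ , b₁ , b₂) (suc zero) (suc (suc zero)) = solve 7 (λ c a₀ a₁ a₂ b₀ b₁ b₂ → ((proj₁ (proj₂ (product _:+_ _:*_ c (a₀ , a₁ , a₂) (b₀ , b₁ , b₂)))) :+ (c :* (proj₂ (proj₂ (product _:+_ _:*_ c (a₀ , a₁ , a₂) (b₀ , b₁ , b₂)))))) := a₁ :* (c :* b₁) :+ ((a₀ :+ a₂) :* (b₁ :+ (c :* b₂)) :+ ((a₁ :+ (c :* a₂)) :* (b₀ :+ b₂) :+ con 0ℤ))) refl c a₀ a₁ a₂ b₀ b₁ b₂
  φ-* (a₀ , a₁ , a₂) (b₀ , b₁ , b₂) (suc (suc zero)) zero = solve 7 (λ c a₀ a₁ a₂ b₀ b₁ b₂ → (proj₂ (proj₂ (product _:+_ _:*_ c (a₀ , a₁ , a₂) (b₀ , b₁ , b₂)))) := a₂ :* b₀ :+ (a₁ :* b₁ :+ ((a₀ :+ a₂) :* b₂ :+ con 0ℤ))) refl c a₀ a₁ a₂ b₀ b₁ b₂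
  φ-* (a₀ , a₁ , a₂) (b₀ , b₁ , b₂) (suc (suc zero)) (suc zero) = solve 7 (λ c a₀ a₁ a₂ b₀ b₁ b₂ → (proj₁ (proj₂ (product _:+_ _:*_ c (a₀ , a₁ , a₂) (b₀ , b₁ , b₂)))) := a₂ :* (c :* b₂) :+ (a₁ :* (b₀ :+ b₂) :+ ((a₀ :+ a₂) :* b₁ :+ con 0ℤ))) refl c a₀ a₁ a₂ b₀ b₁ b₂
  φ-* (a₀ , a₁ , a₂) (b₀ , b₁ , b₂) (suc (suc zero)) (suc (suc zero)) = solve 7 (λ c a₀ a₁ a₂ b₀ b₁ b₂ → ((proj₁ (product _:+_ _:*_ c (a₀ , a₁ , a₂) (b₀ , b₁ , b₂))) :+ (proj₂ (proj₂ (product _:+_ _:*_ c (a₀ , a₁ , a₂) (b₀ , b₁ , b₂))))) := a₂ :* (c :* b₁) :+ (a₁ :* (b₁ :+ (c :* b₂)) :+ ((a₀ :+ a₂) :* (b₀ :+ b₂) :+ con 0ℤ))) refl c a₀ a₁ a₂ b₀ b₁ b₂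

  φ-scalar : ∀ a i j → φ (a , 0# , 0#) i j ≡ Δ i j ⊗ a
  φ-scalar a zero zero = solve 2 (λ c a → a := con 1ℤ :* a) refl c a
  φ-scalar a zero (suc zero) = solve 2 (λ c a → (c :* con 0ℤ) := con 0ℤ :* a) refl c a
  φ-scalar a zero (suc (suc zero)) = solve 2 (λ c a → (c :* con 0ℤ) := con 0ℤ :* a) refl c a
  φ-scalar a (suc zero) zero = solve 2 (λ c a → con 0ℤ := con 0ℤ :* a) refl c a
  φ-scalar a (suc zero) (suc zero) = solve 2 (λ c a → (a :+ con 0ℤ) := con 1ℤ :* a) refl c a
  φ-scalar a (suc zero) (suc (suc zero)) = solve 2 (λ c a → (con 0ℤ :+ (c :* con 0ℤ)) := con 0ℤ :* a) refl c a
  φ-scalar a (suc (suc zero)) zero = solve 2 (λ c a → con 0ℤ := con 0ℤ :* a) refl c a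
  φ-scalar a (suc (suc zero)) (suc zero) = solve 2 (λ c a → con 0ℤ := con 0ℤ :* a) refl c a
  φ-scalar a (suc (suc zero)) (suc (suc zero)) = solve 2 (λ c a → (a :+ con 0ℤ) := con 1ℤ :* a) refl c a

  SumOfPowers-scalar : ∀ k → 1 ℕ.≤ k → (gcd k (q ℕ.^ 3 ∸ 1) ∸ 1) ℕ.^ 4 ℕ.< q ℕ.^ 3 → ∀ a → SumOfPowers {3} k (λ i j → Δ i j ⊗ a)
  SumOfPowers-scalar k 1≤k bound a = let (A , B , eq) = SumOfPowers-ψ k 1≤k bound (encode₃ (a , 0# , 0#)) in
    A , B , λ i j → trans (sym (trans (cong (λ z → φ z i j) (decode∘encode₃ (a , 0# , 0#))) (φ-scalar a i j))) (eq i j)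
    where
    open Representation F normalise (φ ∘ decode₃)
      (λ x y i j → trans (cong (λ z → φ z i j) (decode∘encode₃ (decode₃ x +ₖ decode₃ y))) (φ-+ (decode₃ x) (decode₃ y) i j))
      (λ x y i j → trans (cong (λ z → φ z i j) (decode∘encode₃ (decode₃ x *ₖ decode₃ y))) (φ-* (decode₃ x) (decode₃ y) i j))
      (λ i j → trans (cong (λ z → φ z i j) (decode∘encode₃ 1ₖ)) (trans (φ-scalar 1# i j) (*-identityʳ (Δ i j))))

open import Data.Nat using (_+_; _*_; _^_; _≤_; _<_)

-- Block diagonal matrices.

module BlockDiagonal {q} (F : Field q) (m n : ℕ) where

  open Field F hiding (_^_)
  open FieldProperties F
  open MatrixAlgebra F

  -- Indexing by the disjoint union turns each law into four cases that compute; `splitAt` is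
  -- applied only at the end.
  entry : Mat m → Mat n → Fin m ⊎ Fin n → Fin m ⊎ Fin n → Fin q
  entry A B (inj₁ i) (inj₁ j) = A i j
  entry A B (inj₂ i) (inj₂ j) = B i j
  entry A B (inj₁ _) (inj₂ _) = 0#
  entry A B (inj₂ _) (inj₁ _) = 0#

  blockDiag : Mat m → Mat n → Mat (m + n)
  blockDiag A B i j = entry A B (splitAt m i) (splitAt m j)

  Σ#-splitAt : ∀ m {n} (f : Fin (m + n) → Fin q) → Σ# f ≡ Σ# (λ t → f (t ↑ˡ n)) ⊕ Σ# (λ t → f (m ↑ʳ t))
  Σ#-splitAt zero f = sym (+-identityˡ _)
  Σ#-splitAt (suc m) f = trans (cong (f zero ⊕_) (Σ#-splitAt m (f ∘ suc))) (sym (+-assoc _ _ _))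

  entry-* : ∀ A B C D s t → Σ# (λ u → entry A B s (inj₁ u) ⊗ entry C D (inj₁ u) t) ⊕ Σ# (λ u → entry A B s (inj₂ u) ⊗ entry C D (inj₂ u) t) ≡ entry (A *ₘ C) (B *ₘ D) s t
  entry-* A B C D (inj₁ i) (inj₁ j) = trans (cong ((A *ₘ C) i j ⊕_) (Σ#-zero {n} _ (λ _ → zeroˡ _))) (+-identityʳ _)
  entry-* A B C D (inj₂ i) (inj₂ j) = trans (cong (_⊕ (B *ₘ D) i j) (Σ#-zero {m} _ (λ _ → zeroˡ _))) (+-identityˡ _)
  entry-* A B C D (inj₁ i) (inj₂ j) = trans (cong₂ _⊕_ (Σ#-zero {m} _ (λ _ → zeroʳ _)) (Σ#-zero {n} _ (λ _ → zeroˡ _))) (+-identityˡ 0#)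
  entry-* A B C D (inj₂ i) (inj₁ j) = trans (cong₂ _⊕_ (Σ#-zero {m} _ (λ _ → zeroˡ _)) (Σ#-zero {n} _ (λ _ → zeroʳ _))) (+-identityˡ 0#)

  blockDiag-* : ∀ A B C D → (blockDiag A B *ₘ blockDiag C D) ≈ₘ blockDiag (A *ₘ C) (B *ₘ D)
  blockDiag-* A B C D i j = begin
    Σ# (λ t → blockDiag A B i t ⊗ blockDiag C D t j) ≡⟨ Σ#-splitAt m (λ t → blockDiag A B i t ⊗ blockDiag C D t j) ⟩
    Σ# (λ t → blockDiag A B i (t ↑ˡ n) ⊗ blockDiag C D (t ↑ˡ n) j) ⊕ Σ# (λ t → blockDiag A B i (m ↑ʳ t) ⊗ blockDiag C D (m ↑ʳ t) j)
      ≡⟨ cong₂ _⊕_ (Σ#-cong (λ t → cong (λ s → entry A B (splitAt m i) s ⊗ entry C D s (splitAt m j)) (splitAt-↑ˡ m t n))) (Σ#-cong (λ t → cong (λ s → entry A B (splitAt m i) s ⊗ entry C D s (splitAt m j)) (splitAt-↑ʳ m n t))) ⟩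
    Σ# (λ u → entry A B (splitAt m i) (inj₁ u) ⊗ entry C D (inj₁ u) (splitAt m j)) ⊕ Σ# (λ u → entry A B (splitAt m i) (inj₂ u) ⊗ entry C D (inj₂ u) (splitAt m j)) ≡⟨ entry-* A B C D (splitAt m i) (splitAt m j) ⟩
    blockDiag (A *ₘ C) (B *ₘ D) i j ∎
    where open ≡-Reasoning

  entry-cong : ∀ {A A′ B B′} → A ≈ₘ A′ → B ≈ₘ B′ → ∀ s t → entry A B s t ≡ entry A′ B′ s t
  entry-cong A≈ B≈ (inj₁ i) (inj₁ j) = A≈ i j
  entry-cong A≈ B≈ (inj₂ i) (inj₂ j) = B≈ i j
  entry-cong A≈ B≈ (inj₁ i) (inj₂ j) = refl
  entry-cong A≈ B≈ (inj₂ i) (inj₁ j) = refl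

  entry-Δ-refl : ∀ s → entry Δ Δ s s ≡ 1#
  entry-Δ-refl (inj₁ i) = Δ-refl i
  entry-Δ-refl (inj₂ i) = Δ-refl i

  entry-Δ-≢ : ∀ s t → s ≢ t → entry Δ Δ s t ≡ 0#
  entry-Δ-≢ (inj₁ i) (inj₁ j) s≢t = Δ-≢ (s≢t ∘ cong inj₁)
  entry-Δ-≢ (inj₂ i) (inj₂ j) s≢t = Δ-≢ (s≢t ∘ cong inj₂)
  entry-Δ-≢ (inj₁ i) (inj₂ j) s≢t = refl
  entry-Δ-≢ (inj₂ i) (inj₁ j) s≢t = refl

  blockDiag-Δ : ∀ i j → blockDiag Δ Δ i j ≡ Δ i j
  blockDiag-Δ i j with i ≟ j
  ... | yes refl = trans (entry-Δ-refl (splitAt m i)) (sym (Δ-refl i))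
  ... | no i≢j = trans (entry-Δ-≢ (splitAt m i) (splitAt m j) (λ eq → i≢j (trans (sym (join-splitAt m n i)) (trans (cong (join m n) eq) (join-splitAt m n j))))) (sym (Δ-≢ i≢j))

  blockDiag-^ : ∀ A B k → (blockDiag A B ^ₘ k) ≈ₘ blockDiag (A ^ₘ k) (B ^ₘ k)
  blockDiag-^ A B zero i j = trans (identity≡Δ i j) (trans (sym (blockDiag-Δ i j)) (sym (entry-cong identity≡Δ identity≡Δ (splitAt m i) (splitAt m j))))
  blockDiag-^ A B (suc k) = ≈ₘ-trans (*ₘ-cong (λ _ _ → refl) (blockDiag-^ A B k)) (blockDiag-* A B (A ^ₘ k) (B ^ₘ k))

  entry-+ : ∀ A B C D s t → entry (A +ₘ C) (B +ₘ D) s t ≡ entry A B s t ⊕ entry C D s t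
  entry-+ A B C D (inj₁ i) (inj₁ j) = refl
  entry-+ A B C D (inj₂ i) (inj₂ j) = refl
  entry-+ A B C D (inj₁ i) (inj₂ j) = sym (+-identityˡ 0#)
  entry-+ A B C D (inj₂ i) (inj₁ j) = sym (+-identityˡ 0#)

  entry-⊗ : ∀ A B a s t → entry (λ i j → A i j ⊗ a) (λ i j → B i j ⊗ a) s t ≡ entry A B s t ⊗ a
  entry-⊗ A B a (inj₁ i) (inj₁ j) = refl
  entry-⊗ A B a (inj₂ i) (inj₂ j) = refl
  entry-⊗ A B a (inj₁ i) (inj₂ j) = sym (zeroˡ a)
  entry-⊗ A B a (inj₂ i) (inj₁ j) = sym (zeroˡ a)

  SumOfPowers-blockDiag : ∀ k a → SumOfPowers {m} k (λ i j → Δ i j ⊗ a) → SumOfPowers {n} k (λ i j → Δ i j ⊗ a) → SumOfPowers {m + n} k (λ i j → Δ i j ⊗ a)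
  SumOfPowers-blockDiag k a (A , B , eq) (C , D , eq′) = blockDiag A C , blockDiag B D , λ i j → begin
    Δ i j ⊗ a ≡⟨ cong (_⊗ a) (blockDiag-Δ i j) ⟨
    entry Δ Δ (splitAt m i) (splitAt m j) ⊗ a ≡⟨ entry-⊗ Δ Δ a (splitAt m i) (splitAt m j) ⟨
    blockDiag (λ i j → Δ i j ⊗ a) (λ i j → Δ i j ⊗ a) i j ≡⟨ entry-cong eq eq′ (splitAt m i) (splitAt m j) ⟩
    blockDiag ((A ^ₘ k) +ₘ (B ^ₘ k)) ((C ^ₘ k) +ₘ (D ^ₘ k)) i j ≡⟨ entry-+ (A ^ₘ k) (C ^ₘ k) (B ^ₘ k) (D ^ₘ k) (splitAt m i) (splitAt m j) ⟩
    blockDiag (A ^ₘ k) (C ^ₘ k) i j ⊕ blockDiag (B ^ₘ k) (D ^ₘ k) i j ≡⟨ cong₂ _⊕_ (sym (blockDiag-^ A C k i j)) (sym (blockDiag-^ B D k i j)) ⟩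
    (blockDiag A C ^ₘ k) i j ⊕ (blockDiag B D ^ₘ k) i j ∎
    where open ≡-Reasoning

-- Scalar matrices of every size, and the union of the two cases.

module Main {q} (F : Field q) (k : ℕ) (1≤k : 1 ≤ k) (k·1≢0 : FieldProperties._·_ F k (Field.1# F) ≢ Field.0# F)
  (bound₁ : (gcd k (q ∸ 1) ∸ 1) ^ 6 + 6 * gcd k (q ∸ 1) ≤ q ^ 2)
  (bound₂ : (gcd k (q ^ 2 ∸ 1) ∸ 1) ^ 2 + 1 ≤ q)
  (bound₃ : (gcd k (q ^ 3 ∸ 1) ∸ 1) ^ 4 < q ^ 3) where

  open Field F using (_⊗_)
  open MatrixAlgebra F
  open PrescribedDiagonal F using (pivot-or-scalar; SumOfPowers-apply; apply)

  bound₂′ : (gcd k (q ^ 2 ∸ 1) ∸ 1) ^ 4 < q ^ 2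
  bound₂′ = subst (_< q ^ 2) (ℕ.^-*-assoc (gcd k (q ^ 2 ∸ 1) ∸ 1) 2 2) (ℕ.^-monoˡ-< 2 (subst (_≤ q) (ℕ.+-comm _ 1) bound₂))

  -- A block of size 1 would call for `(d - 1)⁴ < q`, which is not among the hypotheses; this is why
  -- odd sizes end in a block of size 3.
  SumOfPowers-scalar : ∀ n → 2 ≤ n → ∀ a → SumOfPowers {n} k (λ i j → Δ i j ⊗ a)
  SumOfPowers-scalar (suc zero) (s≤s ()) a
  SumOfPowers-scalar (suc (suc zero)) _ a = QuadraticExtension.SumOfPowers-scalar F k 1≤k bound₂′ a
  SumOfPowers-scalar (suc (suc (suc zero))) _ a = CubicExtension.SumOfPowers-scalar F k 1≤k bound₃ a
  SumOfPowers-scalar (suc (suc n@(suc (suc _)))) _ a = BlockDiagonal.SumOfPowers-blockDiag F 2 n k a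
    (QuadraticExtension.SumOfPowers-scalar F k 1≤k bound₂′ a) (SumOfPowers-scalar n (s≤s (s≤s z≤n)) a)

  SumOfPowers-all : ∀ n → 2 ≤ n → (M : Mat n) → SumOfPowers k M
  SumOfPowers-all (suc zero) (s≤s ()) M
  SumOfPowers-all (suc (suc n)) 2≤n M with pivot-or-scalar n M
  ... | inj₁ (ts , pivot) = SumOfPowers-apply {k = k} ts M (NonScalar.SumOfPowers-pivot F k 1≤k bound₁ k·1≢0 n (apply ts M) pivot)
  ... | inj₂ scalar = let (A , B , eq) = SumOfPowers-scalar (suc (suc n)) 2≤n (M zero zero) in A , B , λ i j → trans (scalar i j) (eq i j)

-- The bounds on `q` are stated with radicals cleared: the first is squared, and `⌊ x ⌋ + 1 ≤ q` is
-- equivalent to `x < q`, which for `x = (d₃ - 1)^(4/3)` is cubed.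
theorem1p10 : ∀ {c ℓ : Level} (p l n k : ℕ) → Prime p → 1 ≤ l
    → (F : FiniteField c ℓ (p ^ l))
    → 2 ≤ n → 1 ≤ k → ¬ (p ∣ k)
    → (gcd k (p ^ l ∸ 1) ∸ 1) ^ 6 + 6 * gcd k (p ^ l ∸ 1) ≤ (p ^ l) ^ 2
    → (gcd k ((p ^ l) ^ 2 ∸ 1) ∸ 1) ^ 2 + 1 ≤ p ^ l
    → (gcd k ((p ^ l) ^ 3 ∸ 1) ∸ 1) ^ 4 < (p ^ l) ^ 3
    → let open Matrices F in
    ∀ (M : Mat n) → ∃[ A ] ∃[ B ] (M ≈ₘ ((A ^ₘ k) +ₘ (B ^ₘ k)))
theorem1p10 p l n k p-prime _ F 2≤n 1≤k p∤k bound₁ bound₂ bound₃ M = SumOfPowers-fromFin k M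
  (Main.SumOfPowers-all normalise k 1≤k (k·1≢0 (prime∤⇒coprime p-prime p∤k) (p·1≡0 p l refl)) bound₁ bound₂ bound₃ n 2≤n (λ i j → FiniteField.toFin F (M i j)))
  where
  open Normalisation F
  open Characteristic normalise
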